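{- Fix $d\ge3$ and put $$c_d=\frac{d-1}{32d^2},\qquad C_d=8d(d+1).$$ Uniformly for every $0<\tau\le1$, every odd prime power $q\ge C_d/\tau$, and every $\gamma\in\mathbb F_q$, the root-evaluation system $\mathcal D_{d,\gamma}$ admits no $(\tau,\varepsilon)$-centered block decomposition with $\varepsilon\le c_d\tau^2$. In particular, this conclusion holds for the rational-normal-curve sphere system $(P_{\mathrm{rn}},\mathcal S_{\mathrm{rn}})$ described in the context. More quantitatively, writing $P$ and $\mathcal S$ for the two sides (points and objects) of $\mathcal D_{d,\gamma}$ and $\Sigma=\sigma(P,\mathcal S)$, every integer $m\ge2$ and all matched partitions $\mathcal S=\mathcal S_1\sqcup\cdots\sqcup\mathcal S_m$, $P=A_1\sqcup\cdots\sqcup A_m\sqcup R$ satisfying $$\sigma(A_i,\mathcal S_i)\ge\tau\Sigma\ (1\le i\le m)\qquad\text{and}\qquad\sigma(R,\mathcal S)\le c_d\tau^2\Sigma$$ obey $$\sum_{i\ne j}\sigma(A_i,\mathcal S_j)_+\ge2c_d\tau^2\Sigma.$$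
   Context: Root-evaluation system: for $d\ge3$, $\gamma\in\mathbb F_q$, $\mathcal D_{d,\gamma}$ is the bipartite incidence system with object set $\mathbb F_q$, point set $$\mathfrak A_{d,\gamma}=\Bigl\{A\subseteq\mathbb F_q:|A|=d,\ -\sum_{a\in A}a\ne\gamma\Bigr\},$$ and $A$ incident to $t$ exactly when $t\in A$. For a set $B$ of points and a set $\mathcal T$ of objects (or spheres), $\sigma(B,\mathcal T)=I(B,\mathcal T)-|B||\mathcal T|/q$, where $I$ counts incident pairs. Put $x_+=\max\{x,0\}$. Let $\Sigma=\sigma(P,\mathcal S)>0$, $0<\tau\le1$, $\varepsilon\ge0$. A $(\tau,\varepsilon)$-centered block decomposition consists of an integer $m\ge2$ and partitions $\mathcal S=\mathcal S_1\sqcup\cdots\sqcup\mathcal S_m$, $P=A_1\sqcup\cdots\sqcup A_m\sqcup R$ such that $\sigma(A_i,\mathcal S_i)\ge\tau\Sigma$ for $1\le i\le m$, $\sigma(R,\mathcal S)\le\varepsilon\Sigma$, and $\sum_{i\ne j}\sigma(A_i,\mathcal S_j)_+\le\varepsilon\Sigma$. Rational-normal-curve sphere system: let $Q$ be a nondegenerate quadratic form on $\mathbb F_q^d$, $\langle x,y\rangle_Q=\frac{Q(x+y)-Q(x)-Q(y)}2$, $S_Q(c,r)=\{x:Q(x-c)=r\}$. Use a Witt decomposition $\mathbb F_q^d=\mathbb F_qe\oplus\mathbb F_qf\oplus V_0$ with $Q(xe+yf+z)=xy+Q_\perp(z)$, $Q_\perp$ nondegenerate, and a basis $u_1,\dots,u_{d-2}$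 of $V_0$. Put $z_t=\sum_{j=1}^{d-2}t^ju_j$, $c_t=t^{d-1}f+z_t$, $\gamma=-1-Q(c_1)$, $g(t)=Q(c_t)+t^d+\gamma t^{d-1}$; choose $\kappa$ with $-\kappa\notin g(\mathbb F_q)$ (possible since $g(0)=g(1)$); put $r_t=Q(c_t)+t^d+\gamma t^{d-1}+\kappa$, $S_t=S_Q(c_t,r_t)$, $\mathcal S_{\mathrm{rn}}=\{S_t:t\in\mathbb F_q\}$. The map $\Psi(xe+yf+z)(T)=T^d+(x+\gamma)T^{d-1}+\sum_{j=1}^{d-2}2\langle z,u_j\rangle_QT^j+\kappa-Q(xe+yf+z)$ is a bijection from $\{xe+yf+z:x\ne0\}$ onto the monic degree-$d$ polynomials with $T^{d-1}$-coefficient $\ne\gamma$; $p_A$ is the point with $\Psi(p_A)=\prod_{a\in A}(T-a)$, and $P_{\mathrm{rn}}=\{p_A:A\in\mathfrak A_{d,\gamma}\}$. With this $\gamma$, $(P_{\mathrm{rn}},\mathcal S_{\mathrm{rn}})$ is incidence-isomorphic to $\mathcal D_{d,\gamma}$ via $p_A\leftrightarrow A$, $S_t\leftrightarrow t$. -}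

module Defs where

open import Algebra.Bundles using (CommutativeRing)
open import Algebra.Structures using (IsCommutativeRing)
open import Data.Bool.Base using (true; false)
open import Data.Fin.Base using (Fin; toℕ)
import Data.Fin.Properties as Fin
open import Data.Fin.Subset using (Subset; ∣_∣) renaming (_∈_ to _∈ₛ_)
open import Data.Fin.Subset.Properties using () renaming (_∈?_ to _∈ₛ?_)
import Data.Integer.Base as ℤ
open import Data.List.Base as List
  using (List; []; _∷_; _++_; [_]; length; filter; concat; foldr; cartesianProduct;
         cartesianProductWith; allFin; tabulate; deduplicate)
import Data.List.Membership.DecPropositional as DecMembership
import Data.List.Properties as List
open import Data.List.Relation.Unary.All using ([]; _∷_)
open import Data.List.Relation.Unary.AllPairs using ([]; _∷_)
open import Data.List.Relation.Unary.Unique.Propositional using (Unique)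
import Data.List.Relation.Unary.Unique.Propositional.Properties as Unique
import Data.List.Relation.Unary.Unique.DecPropositional.Properties as DecUnique
open import Data.List.Relation.Binary.Permutation.Propositional using (_↭_)
open import Data.List.Relation.Unary.Any using (Any; any?)
open import Data.List.Membership.Propositional using (_∈_)
open import Data.Nat.Base as ℕ using (ℕ; zero; suc; _∸_; _⊔_)
open import Data.Nat.Divisibility using (_∣_)
open import Data.Nat.Primality using (Prime)
import Data.Nat.Properties as ℕ
open import Data.Product.Base using (Σ; ∃; ∃₂; _×_; _,_; proj₁)
open import Data.Rational.Base as ℚ using (ℚ; 0ℚ; 1ℚ; _/_)
import Data.Rational.Properties as ℚ
open import Data.Rational.Solver using (module +-*-Solver)
open import Data.Vec.Base as Vec using (Vec; []; _∷_)
import Data.Vec.Properties as Vec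
open import Function.Bundles using (_↔_; module Inverse; module Injection)
open import Function.Properties.Inverse using (↔⇒↣; ↔-sym)
open import Level using (0ℓ)
open import Relation.Binary.Definitions using (DecidableEquality)
open import Relation.Binary.PropositionalEquality
  using (_≡_; _≢_; refl; sym; trans; cong; module ≡-Reasoning)
open import Relation.Nullary.Decidable using (Dec; via-injection; ¬?; _×-dec_)
open import Relation.Nullary.Negation using (¬_)

------------------------------------------------------------------------
-- Real numbers, as Cauchy sequences of rationals

IsCauchy : (ℕ → ℚ) → Set
IsCauchy x = ∀ δ → 0ℚ ℚ.< δ →
  ∃ λ N → ∀ i j → N ℕ.≤ i → N ℕ.≤ j → ℚ.∣ x i ℚ.- x j ∣ ℚ.≤ δ

record ℝ : Set where
  constructor real
  field
    seq      : ℕ → ℚ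
    isCauchy : IsCauchy seq

open ℝ public

infix 4 _≤ᴿ_ _<ᴿ_

_≤ᴿ_ : ℝ → ℝ → Set
x ≤ᴿ y = ∀ δ → 0ℚ ℚ.< δ → ∃ λ N → ∀ n → N ℕ.≤ n → seq x n ℚ.≤ seq y n ℚ.+ δ

_<ᴿ_ : ℝ → ℝ → Set
x <ᴿ y = ∃ λ δ → 0ℚ ℚ.< δ × ∃ λ N → ∀ n → N ℕ.≤ n → seq x n ℚ.+ δ ℚ.≤ seq y n

fromℚ : ℚ → ℝ
fromℚ a = real (λ _ → a) λ δ 0<δ → 0 , λ _ _ _ _ →
  ℚ.≤-trans (ℚ.≤-reflexive (cong ℚ.∣_∣ (ℚ.+-inverseʳ a))) (ℚ.<⇒≤ 0<δ)

fromℕ : ℕ → ℝ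
fromℕ n = fromℚ (ℤ.+ n / 1)

0ᴿ 1ᴿ : ℝ
0ᴿ = fromℚ 0ℚ
1ᴿ = fromℚ 1ℚ

private
  eventually-bounded : ∀ {x} → IsCauchy x →
    ∃ λ K → ℚ.Positive K × ∃ λ N → ∀ n → N ℕ.≤ n → ℚ.∣ x n ∣ ℚ.≤ K
  eventually-bounded {x} cx with cx 1ℚ (ℚ.positive⁻¹ 1ℚ)
  ... | N , close = K , K>0 , N , bound
    where
    open ℚ.≤-Reasoning
    instance
      _ : ℚ.NonNegative ℚ.∣ x N ∣
      _ = ℚ.∣-∣-nonNeg (x N)
    K = 1ℚ ℚ.+ ℚ.∣ x N ∣
    K>0 : ℚ.Positive K
    K>0 = ℚ.pos+nonNeg⇒pos 1ℚ ℚ.∣ x N ∣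
    open +-*-Solver
    bound : ∀ n → N ℕ.≤ n → ℚ.∣ x n ∣ ℚ.≤ K
    bound n N≤n = begin
      ℚ.∣ x n ∣                           ≡⟨ cong ℚ.∣_∣ (solve 2 (λ a b → a := (a :- b) :+ b) refl (x n) (x N)) ⟩
      ℚ.∣ (x n ℚ.- x N) ℚ.+ x N ∣         ≤⟨ ℚ.∣p+q∣≤∣p∣+∣q∣ (x n ℚ.- x N) (x N) ⟩
      ℚ.∣ x n ℚ.- x N ∣ ℚ.+ ℚ.∣ x N ∣     ≤⟨ ℚ.+-monoˡ-≤ ℚ.∣ x N ∣ (close n N N≤n ℕ.≤-refl) ⟩
      K                                   ∎

  product-difference : ∀ a b c e →
    a ℚ.* b ℚ.- c ℚ.* e ≡ a ℚ.* (b ℚ.- e) ℚ.+ e ℚ.* (a ℚ.- c)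
  product-difference = solve 4
    (λ a b c e → a :* b :- c :* e := a :* (b :- e) :+ e :* (a :- c)) refl
    where open +-*-Solver

  split-error : ∀ K L δ .{{_ : ℚ.NonZero (K ℚ.+ L)}} →
    K ℚ.* (δ ℚ.* ℚ.1/ (K ℚ.+ L)) ℚ.+ L ℚ.* (δ ℚ.* ℚ.1/ (K ℚ.+ L)) ≡ δ
  split-error K L δ = begin
    K ℚ.* (δ ℚ.* r) ℚ.+ L ℚ.* (δ ℚ.* r)   ≡⟨ ℚ.*-distribʳ-+ (δ ℚ.* r) K L ⟨
    (K ℚ.+ L) ℚ.* (δ ℚ.* r)               ≡⟨ ℚ.*-comm (K ℚ.+ L) (δ ℚ.* r) ⟩
    δ ℚ.* r ℚ.* (K ℚ.+ L)                 ≡⟨ ℚ.*-assoc δ r (K ℚ.+ L) ⟩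
    δ ℚ.* (r ℚ.* (K ℚ.+ L))               ≡⟨ cong (δ ℚ.*_) (ℚ.*-inverseˡ (K ℚ.+ L)) ⟩
    δ ℚ.* 1ℚ                              ≡⟨ ℚ.*-identityʳ δ ⟩
    δ                                     ∎
    where
    open ≡-Reasoning
    r = ℚ.1/ (K ℚ.+ L)

  *-bound : ∀ a b {c e} → ℚ.NonNegative e → ℚ.∣ a ∣ ℚ.≤ c → ℚ.∣ b ∣ ℚ.≤ e →
            ℚ.∣ a ℚ.* b ∣ ℚ.≤ c ℚ.* e
  *-bound a b {c} {e} 0≤e a≤c b≤e = begin
    ℚ.∣ a ℚ.* b ∣         ≡⟨ ℚ.∣p*q∣≡∣p∣*∣q∣ a b ⟩
    ℚ.∣ a ∣ ℚ.* ℚ.∣ b ∣   ≤⟨ ℚ.*-monoˡ-≤-nonNeg ℚ.∣ a ∣ {{ℚ.∣-∣-nonNeg a}} b≤e ⟩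
    ℚ.∣ a ∣ ℚ.* e         ≤⟨ ℚ.*-monoʳ-≤-nonNeg e {{0≤e}} a≤c ⟩
    c ℚ.* e               ∎
    where open ℚ.≤-Reasoning

  tolerance : ∀ δ K L → ℚ.Positive δ → ℚ.Positive K → ℚ.Positive L →
    ∃ λ η → ℚ.Positive η × K ℚ.* η ℚ.+ L ℚ.* η ≡ δ
  tolerance δ K L δ>0 K>0 L>0 = δ ℚ.* ℚ.1/ (K ℚ.+ L)
    , ℚ.pos*pos⇒pos δ {{δ>0}} (ℚ.1/ (K ℚ.+ L)) {{ℚ.1/pos⇒pos (K ℚ.+ L) {{K+L>0}}}}
    , split-error K L δ
    where
    K+L>0 : ℚ.Positive (K ℚ.+ L)
    K+L>0 = ℚ.pos+pos⇒pos K {{K>0}} L {{L>0}}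
    instance
      _ : ℚ.NonZero (K ℚ.+ L)
      _ = ℚ.pos⇒nonZero (K ℚ.+ L) {{K+L>0}}

  product-close : ∀ {K L η δ} → ℚ.Positive η → K ℚ.* η ℚ.+ L ℚ.* η ≡ δ → ∀ a b c e →
    ℚ.∣ a ∣ ℚ.≤ K → ℚ.∣ e ∣ ℚ.≤ L → ℚ.∣ b ℚ.- e ∣ ℚ.≤ η → ℚ.∣ a ℚ.- c ∣ ℚ.≤ η →
    ℚ.∣ a ℚ.* b ℚ.- c ℚ.* e ∣ ℚ.≤ δ
  product-close {K} {L} {η} {δ} η>0 split a b c e a≤K e≤L b-e≤η a-c≤η = begin
    ℚ.∣ a ℚ.* b ℚ.- c ℚ.* e ∣
      ≡⟨ cong ℚ.∣_∣ (product-difference a b c e) ⟩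
    ℚ.∣ a ℚ.* (b ℚ.- e) ℚ.+ e ℚ.* (a ℚ.- c) ∣
      ≤⟨ ℚ.∣p+q∣≤∣p∣+∣q∣ (a ℚ.* (b ℚ.- e)) (e ℚ.* (a ℚ.- c)) ⟩
    ℚ.∣ a ℚ.* (b ℚ.- e) ∣ ℚ.+ ℚ.∣ e ℚ.* (a ℚ.- c) ∣
      ≤⟨ ℚ.+-mono-≤ (*-bound a (b ℚ.- e) η≥0 a≤K b-e≤η) (*-bound e (a ℚ.- c) η≥0 e≤L a-c≤η) ⟩
    K ℚ.* η ℚ.+ L ℚ.* η
      ≡⟨ split ⟩
    δ ∎
    where
    open ℚ.≤-Reasoning
    η≥0 : ℚ.NonNegative η
    η≥0 = ℚ.pos⇒nonNeg η {{η>0}}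

  *-isCauchy : ∀ {x y} → IsCauchy x → IsCauchy y → IsCauchy (λ n → x n ℚ.* y n)
  *-isCauchy {x} {y} cx cy δ 0<δ =
    let K , K>0 , N₁ , ∣x∣≤K = eventually-bounded {x} cx
        L , L>0 , N₂ , ∣y∣≤L = eventually-bounded {y} cy
        η , η>0 , split      = tolerance δ K L (ℚ.positive 0<δ) K>0 L>0
        0<η                  = ℚ.positive⁻¹ η {{η>0}}
        N₃ , x-close         = cx η 0<η
        N₄ , y-close         = cy η 0<η
        N₁₂                  = N₁ ⊔ N₂
        N₃₄                  = N₃ ⊔ N₄
    in N₁₂ ⊔ N₃₄ , λ i j N≤i N≤j →
      let i₁₂ = ℕ.m⊔n≤o⇒m≤o N₁₂ N₃₄ N≤i
          i₃₄ = ℕ.m⊔n≤o⇒n≤o N₁₂ N₃₄ N≤i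
          j₁₂ = ℕ.m⊔n≤o⇒m≤o N₁₂ N₃₄ N≤j
          j₃₄ = ℕ.m⊔n≤o⇒n≤o N₁₂ N₃₄ N≤j
      in product-close η>0 split (x i) (y i) (x j) (y j)
           (∣x∣≤K i (ℕ.m⊔n≤o⇒m≤o N₁ N₂ i₁₂)) (∣y∣≤L j (ℕ.m⊔n≤o⇒n≤o N₁ N₂ j₁₂))
           (y-close i j (ℕ.m⊔n≤o⇒n≤o N₃ N₄ i₃₄) (ℕ.m⊔n≤o⇒n≤o N₃ N₄ j₃₄))
           (x-close i j (ℕ.m⊔n≤o⇒m≤o N₃ N₄ i₃₄) (ℕ.m⊔n≤o⇒m≤o N₃ N₄ j₃₄))

infixl 7 _*ᴿ_

_*ᴿ_ : ℝ → ℝ → ℝ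
seq      (x *ᴿ y) n = seq x n ℚ.* seq y n
isCauchy (x *ᴿ y)   = *-isCauchy {seq x} {seq y} (isCauchy x) (isCauchy y)

------------------------------------------------------------------------
-- Finite incidence systems

-- Finite sets are duplicate-free lists; q is the number in σ's density 1/q.
record IncidenceSystem : Set₁ where
  field
    q         : ℕ
    q-nonZero : ℕ.NonZero q
    Point     : Set
    Object    : Set
    points    : List Point
    objects   : List Object
    points-unique  : Unique points
    objects-unique : Unique objects
    Incident  : Point → Object → Set
    incident? : ∀ p s → Dec (Incident p s)

  incidences : List Point → List Object → ℕ
  incidences B T = length (filter (λ (p , s) → incident? p s) (cartesianProduct B T))

  σ : List Point → List Object → ℚ
  σ B T = ℤ.+ incidences B T / 1 ℚ.- (ℤ.+ (length B ℕ.* length T) / q) {{q-nonZero}}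

infix 8 _₊

_₊ : ℚ → ℚ
x ₊ = x ℚ.⊔ 0ℚ

sumℚ : List ℚ → ℚ
sumℚ = foldr ℚ._+_ 0ℚ

module _ (X : IncidenceSystem) where
  open IncidenceSystem X

  Σσ : ℚ
  Σσ = σ points objects

  -- As `points` and `objects` are duplicate-free, being a rearrangement of
  -- the concatenated blocks says that the blocks are sets partitioning them.
  record MatchedPartition (m : ℕ) : Set where
    field
      𝒮 : Fin m → List Object
      A : Fin m → List Point
      R : List Point
      objects-partition : concat (tabulate 𝒮) ↭ objects
      points-partition  : concat (tabulate A) ++ R ↭ points

    offDiagonal : ℚ
    offDiagonal = sumℚ (List.map (λ (i , j) → σ (A i) (𝒮 j) ₊)
      (filter (λ (i , j) → ¬? (i Fin.≟ j)) (cartesianProduct (allFin m) (allFin m))))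

  record CenteredBlockDecomposition (τ ε : ℝ) : Set where
    field
      Σ-positive    : 0ℚ ℚ.< Σσ
      m             : ℕ
      m≥2           : 2 ℕ.≤ m
      partition     : MatchedPartition m
    open MatchedPartition partition
    field
      diagonal-large    : ∀ i → τ *ᴿ fromℚ Σσ ≤ᴿ fromℚ (σ (A i) (𝒮 i))
      remainder-small   : fromℚ (σ R objects) ≤ᴿ ε *ᴿ fromℚ Σσ
      offDiagonal-small : fromℚ offDiagonal ≤ᴿ ε *ᴿ fromℚ Σσ

------------------------------------------------------------------------
-- Finite fields

OddPrimePower : ℕ → Set
OddPrimePower q = (∃₂ λ p k → Prime p × 1 ℕ.≤ k × q ≡ p ℕ.^ k) × ¬ 2 ∣ q

record FiniteField (q : ℕ) : Set₁ where
  infixl 6 _+_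
  infixl 7 _*_
  infix  8 -_
  infix  9 _⁻¹
  field
    Carrier           : Set
    _+_ _*_           : Carrier → Carrier → Carrier
    -_ _⁻¹            : Carrier → Carrier
    0# 1#             : Carrier
    isCommutativeRing : IsCommutativeRing _≡_ _+_ _*_ -_ 0# 1#
    0≢1               : 0# ≢ 1#
    -- 0# ⁻¹ is unconstrained.
    *-inverseʳ        : ∀ x → x ≢ 0# → x * x ⁻¹ ≡ 1#
    enumeration       : Fin q ↔ Carrier

  commutativeRing : CommutativeRing 0ℓ 0ℓ
  commutativeRing = record { isCommutativeRing = isCommutativeRing }

  open CommutativeRing commutativeRing public using (_-_; semiring)
  open import Algebra.Properties.Semiring.Exp semiring public using (_^_)

  element : Fin q → Carrier
  element = Inverse.to enumeration

  index : Carrier → Fin q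
  index = Inverse.from enumeration

  elements : List Carrier
  elements = tabulate element

  elements-unique : Unique elements
  elements-unique = Unique.tabulate⁺ (Injection.injective (↔⇒↣ enumeration))

  infix 4 _≟_
  _≟_ : DecidableEquality Carrier
  _≟_ = via-injection (↔⇒↣ (↔-sym enumeration)) Fin._≟_

  order-nonZero : ℕ.NonZero q
  order-nonZero = Fin.nonZeroIndex (index 0#)

------------------------------------------------------------------------
-- Root-evaluation systems

allVecs : ∀ {A : Set} → List A → ∀ n → List (Vec A n)
allVecs xs zero    = [ [] ]
allVecs xs (suc n) = cartesianProductWith _∷_ xs (allVecs xs n)

allVecs-unique : ∀ {A : Set} {xs : List A} → Unique xs → ∀ n → Unique (allVecs xs n)
allVecs-unique xs! zero    = [] ∷ []
allVecs-unique xs! (suc n) =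
  Unique.cartesianProductWith⁺ _∷_ Vec.∷-injective xs! (allVecs-unique xs! n)

allSubsets : ∀ n → List (Subset n)
allSubsets = allVecs (true ∷ false ∷ [])

allSubsets-unique : ∀ n → Unique (allSubsets n)
allSubsets-unique = allVecs-unique (((λ ()) ∷ []) ∷ [] ∷ [])

module _ {q} (F : FiniteField q) where
  open FiniteField F

  -- Subsets of the field are coded by Subset q through the enumeration.
  members : Subset q → List Carrier
  members A = filter (λ t → index t ∈ₛ? A) elements

  elementSum : Subset q → Carrier
  elementSum A = foldr _+_ 0# (members A)

  𝔄 : ℕ → Carrier → List (Subset q)
  𝔄 d γ = filter (λ A → (∣ A ∣ ℕ.≟ d) ×-dec ¬? (- elementSum A ≟ γ))
                 (allSubsets q)

  𝔄-unique : ∀ d γ → Unique (𝔄 d γ)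
  𝔄-unique d γ = Unique.filter⁺ (λ A → (∣ A ∣ ℕ.≟ d) ×-dec ¬? (- elementSum A ≟ γ))
                                (allSubsets-unique q)

  rootEvaluation : ℕ → Carrier → IncidenceSystem
  rootEvaluation d γ = record
    { q         = q
    ; q-nonZero = order-nonZero
    ; Point     = Subset q
    ; Object    = Carrier
    ; points    = 𝔄 d γ
    ; objects   = elements
    ; points-unique  = 𝔄-unique d γ
    ; objects-unique = elements-unique
    ; Incident  = λ A t → index t ∈ₛ A
    ; incident? = λ A t → index t ∈ₛ? A
    }

------------------------------------------------------------------------
-- Quadratic forms

  infixl 6 _+ᵥ_ _-ᵥ_
  infixl 7 _*ᵥ_

  _+ᵥ_ _-ᵥ_ : ∀ {d} → Vec Carrier d → Vec Carrier d → Vec Carrier d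
  _+ᵥ_ = Vec.zipWith _+_
  _-ᵥ_ = Vec.zipWith _-_

  _*ᵥ_ : ∀ {d} → Carrier → Vec Carrier d → Vec Carrier d
  a *ᵥ x = Vec.map (a *_) x

  0ᵥ : ∀ {d} → Vec Carrier d
  0ᵥ = Vec.replicate _ 0#

  linearCombination : ∀ {d n} → Vec Carrier n → (Fin n → Vec Carrier d) → Vec Carrier d
  linearCombination ζ u = foldr _+ᵥ_ 0ᵥ (tabulate λ j → Vec.lookup ζ j *ᵥ u j)

  polar : ∀ {d} → (Vec Carrier d → Carrier) → Vec Carrier d → Vec Carrier d → Carrier
  polar Q x y = Q (x +ᵥ y) - Q x - Q y

  -- ⟨x,y⟩_Q; meaningful in odd characteristic.
  inner : ∀ {d} → (Vec Carrier d → Carrier) → Vec Carrier d → Vec Carrier d → Carrier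
  inner Q x y = polar Q x y * (1# + 1#) ⁻¹

  record IsQuadraticForm {d} (Q : Vec Carrier d → Carrier) : Set where
    field
      homogeneous : ∀ a x → Q (a *ᵥ x) ≡ a ^ 2 * Q x
      -- Linearity in the second argument follows by symmetry.
      polar-+     : ∀ x y z → polar Q (x +ᵥ y) z ≡ polar Q x z + polar Q y z
      polar-*     : ∀ a x y → polar Q (a *ᵥ x) y ≡ a * polar Q x y

  Nondegenerate : ∀ {d} → (Vec Carrier d → Carrier) → Set
  Nondegenerate Q = ∀ x → (∀ y → inner Q x y ≡ 0#) → x ≡ 0ᵥ

  record Coordinates (d : ℕ) : Set where
    constructor coords
    field
      x y : Carrier
      ζ   : Vec Carrier (d ∸ 2)

  -- V₀ is the span of u, and Q⊥ is the restriction of Q to it; that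
  -- F^d is the direct sum of the three summands and u a basis of V₀ amounts to
  -- (e , f , u) being a basis of F^d.
  record WittDecomposition {d} (Q : Vec Carrier d → Carrier) : Set where
    field
      e f : Vec Carrier d
      u   : Fin (d ∸ 2) → Vec Carrier d

    z[_] : Vec Carrier (d ∸ 2) → Vec Carrier d
    z[ ζ ] = linearCombination ζ u

    point : Carrier → Carrier → Vec Carrier (d ∸ 2) → Vec Carrier d
    point x y ζ = x *ᵥ e +ᵥ y *ᵥ f +ᵥ z[ ζ ]

    field
      spanning       : ∀ p → Σ (Coordinates d) λ (coords x y ζ) → point x y ζ ≡ p
      independent    : ∀ x y ζ → point x y ζ ≡ 0ᵥ → x ≡ 0# × y ≡ 0# × ζ ≡ 0ᵥ
      hyperbolic     : ∀ x y ζ → Q (point x y ζ) ≡ x * y + Q z[ ζ ]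
      nondegenerate⊥ : ∀ ζ → (∀ ζ′ → inner Q z[ ζ ] z[ ζ′ ] ≡ 0#) → z[ ζ ] ≡ 0ᵥ

    coordinates : Vec Carrier d → Coordinates d
    coordinates p = proj₁ (spanning p)

------------------------------------------------------------------------
-- Polynomials, as coefficient lists with the constant term first

  timesLinear : Carrier → List Carrier → List Carrier
  timesLinear a p = List.zipWith _+_ (0# ∷ p) (List.map (- a *_) p ++ [ 0# ])

  -- ∏_{a∈A} (T − a)
  rootPolynomial : Subset q → List Carrier
  rootPolynomial A = foldr timesLinear [ 1# ] (members A)

------------------------------------------------------------------------
-- The rational-normal-curve sphere system

  module RationalNormal {d} (Q : Vec Carrier d → Carrier)
                        (W : WittDecomposition Q) where
    open WittDecomposition W

    centre : Carrier → Vec Carrier d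
    centre t = t ^ (d ∸ 1) *ᵥ f +ᵥ z[ Vec.tabulate (λ j → t ^ suc (toℕ j)) ]

    γ : Carrier
    γ = - 1# - Q (centre 1#)

    g : Carrier → Carrier
    g t = Q (centre t) + t ^ d + γ * t ^ (d ∸ 1)

    space : List (Vec Carrier d)
    space = allVecs elements d

    -- A sphere is the set of its points, in the order of `space`.
    sphere : Vec Carrier d → Carrier → List (Vec Carrier d)
    sphere c r = filter (λ p → Q (p -ᵥ c) ≟ r) space

    module _ (κ : Carrier) where

      radius : Carrier → Carrier
      radius t = Q (centre t) + t ^ d + γ * t ^ (d ∸ 1) + κ

      Ψ : Vec Carrier d → List Carrier
      Ψ p = (κ - Q p)
          ∷ tabulate (λ j → (1# + 1#) * inner Q z[ ζ ] (u j))
          ++ (x + γ) ∷ 1# ∷ []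
        where open Coordinates (coordinates p)

      -- p = p_A for some A ∈ 𝔄 d γ: Ψ is injective on {x ≠ 0}, so p_A is the only
      -- point there with Ψ p_A = ∏_{a∈A} (T − a).
      IsRootPoint : Vec Carrier d → Set
      IsRootPoint p = Coordinates.x (coordinates p) ≢ 0#
                    × Any (λ A → Ψ p ≡ rootPolynomial A) (𝔄 d γ)

      isRootPoint? : ∀ p → Dec (IsRootPoint p)
      isRootPoint? p = ¬? (Coordinates.x (coordinates p) ≟ 0#)
                     ×-dec any? (λ A → List.≡-dec _≟_ (Ψ p) (rootPolynomial A)) (𝔄 d γ)

      Pᵣₙ : List (Vec Carrier d)
      Pᵣₙ = filter isRootPoint? space

      𝒮ᵣₙ : List (List (Vec Carrier d))
      𝒮ᵣₙ = deduplicate (List.≡-dec (Vec.≡-dec _≟_))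
                        (List.map (λ t → sphere (centre t) (radius t)) elements)

      system : IncidenceSystem
      system = record
        { q         = q
        ; q-nonZero = order-nonZero
        ; Point     = Vec Carrier d
        ; Object    = List (Vec Carrier d)
        ; points    = Pᵣₙ
        ; objects   = 𝒮ᵣₙ
        ; points-unique  = Unique.filter⁺ isRootPoint? (allVecs-unique elements-unique d)
        ; objects-unique = DecUnique.deduplicate-! (List.≡-dec (Vec.≡-dec _≟_)) _
        ; Incident  = _∈_
        ; incident? = DecMembership._∈?_ (Vec.≡-dec _≟_)
        }

------------------------------------------------------------------------
-- Constants

-- (d − 1) / (32 d²), with the junk value 0 at d = 0
c : ℕ → ℚ
c zero      = 0ℚ
c d@(suc k) = ℤ.+ k / (32 ℕ.* d ℕ.^ 2)

C : ℕ → ℕ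
C d = 8 ℕ.* d ℕ.* (d ℕ.+ 1)

{-# OPTIONS --safe #-}

-- Weigh a point A ∈ A_i by its contribution (d − 1) − |A ∩ S_i| + |S_i|/q to
-- Σ_{j≠i} σ(A_i, S_j).  Only points with A ⊆ S_i contribute negatively.  Exchanging
-- one element of such a point for an object outside S_i gives a point with d − 1
-- elements in S_i, and double counting these exchanges shows that the negative
-- contributions are at most half of the positive ones of the points with d − 1
-- elements in one block.  With b the least block size, the total contribution is
-- thus at least b²|P|/(2q²) minus the loss |R| from the remainder.  The same
-- exchanges bound the degree of an object by d|P|/(q − 1), so σ(A_i, S_i) ≥ τΣ
-- forces b ≥ τ(d − 1)q/(2d).
--
-- For the spheres, r_t − Q(p − c_t) is the value of Ψ(p) at t, so that p ↦ {t : p ∈ S_t}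
-- and S_t ↦ t carry block decompositions over to the root-evaluation system.

module Submission where

open import Defs
open import Data.Nat.Base as ℕ using (ℕ)
open import Data.Product.Base using (_×_; _,_)
open import Data.Rational.Base as ℚ using (ℚ)
open import Data.Vec.Base using (Vec)
open import Relation.Binary.PropositionalEquality using (_≢_)
open import Relation.Nullary.Negation using (¬_)

-- The contribution of a point depends on the block it is assigned to, while exchanges ignore the
-- assignment: swapping one element may carry a point into another A_j or into the remainder. The
-- contribution is therefore bounded below by a weight of `A` alone, valid for every assignment, and
-- this weight is summed over all of P; completing the sum over R costs at most 1 per point. A set
-- with at least d - 1 elements in a block has at most one element elsewhere; as d ≥ 3, that block
-- is unique, so the weights of different blocks do not interfere. For a block of size s with r = q
-- - s, let M sets lie inside it and let G sets have d - 1 elements in it. Double counting gives d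
-- (r - 1) M ≤ s G. The condition q ≥ C_d / τ forces b ≥ 3, hence r ≥ 3 and d (r - 1) ≥ 2 r: this is
-- the origin of the factor one half. Since Σ = (d - 1) |P|, the lower bound for b makes b² |P| / (2
-- q²) at least 4 c_d τ² Σ, which explains the 32 d² in c_d; the remainder costs at most c_d τ² Σ.

-- Sums of natural numbers over finite lists.

module FiniteSums where

  open import Data.Fin.Base using (Fin)
  open import Data.List.Base as List
    using (List; []; _∷_; _++_; map; concat; filter; length; cartesianProduct; tabulate;
           allFin)
  import Data.List.Properties as List
  open import Data.List.Membership.Propositional using (_∈_)
  import Data.List.Membership.Propositional.Properties as ∈
  open import Data.List.Membership.Propositional.Properties.WithK using (unique∧set⇒bag)
  open import Data.List.Relation.Binary.BagAndSetEquality using (∼bag⇒↭)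
  open import Data.List.Relation.Binary.Permutation.Propositional using (_↭_; ↭⇒↭ₛ)
  import Data.List.Relation.Binary.Permutation.Propositional.Properties as ↭
  import Data.List.Relation.Binary.Permutation.Setoid.Properties as ↭ₛ
  open import Data.List.Relation.Unary.All as All using (All; []; _∷_)
  open import Data.List.Relation.Unary.Any using (here; there)
  open import Data.List.Relation.Unary.AllPairs using ([]; _∷_)
  open import Data.List.Relation.Unary.Unique.Propositional using (Unique)
  import Data.List.Relation.Unary.Unique.Propositional.Properties as Unique
  open import Data.Nat.Base as ℕ using (ℕ; _+_; _*_; _≤_; z≤n)
  open import Data.Nat.ListAction using (sum)
  open import Data.Nat.ListAction.Properties using (sum-++; sum-↭)
  import Data.Nat.Properties as ℕ
  open import Data.Nat.Solver using (module +-*-Solver)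
  open import Data.Product.Base using (∃; _×_; _,_)
  open import Function.Base using (_∘_)
  open import Function.Bundles using (mk⇔)
  open import Relation.Binary.PropositionalEquality hiding (J)
  open import Relation.Binary.Definitions using (DecidableEquality)
  open import Relation.Nullary.Decidable using (Dec; yes; no)
  open import Relation.Nullary.Negation using (¬_; contradiction)
  open import Relation.Unary using (Pred; Decidable)

  private variable
    X Y Z : Set

  -- Turns a bijection between finite sets into a reindexing of sums.
  unique-⊆⇒↭ : {xs ys : List X} → Unique xs → Unique ys →
               (∀ {x} → x ∈ xs → x ∈ ys) → (∀ {x} → x ∈ ys → x ∈ xs) → xs ↭ ys
  unique-⊆⇒↭ xs! ys! xs⊆ys ys⊆xs = ∼bag⇒↭ (unique∧set⇒bag xs! ys! (mk⇔ xs⊆ys ys⊆xs))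

  Unique-resp-↭ : {xs ys : List X} → xs ↭ ys → Unique xs → Unique ys
  Unique-resp-↭ {X = X} xs↭ys = ↭ₛ.Unique-resp-↭ (setoid X) (↭⇒↭ₛ xs↭ys)

  ∑ : List X → (X → ℕ) → ℕ
  ∑ xs f = sum (map f xs)

  module _ {f g : X → ℕ} where

    ∑-mono : ∀ xs → (∀ {x} → x ∈ xs → f x ≤ g x) → ∑ xs f ≤ ∑ xs g
    ∑-mono []       f≤g = z≤n
    ∑-mono (x ∷ xs) f≤g = ℕ.+-mono-≤ (f≤g (here refl)) (∑-mono xs (f≤g ∘ there))

    ∑-cong : ∀ xs → (∀ {x} → x ∈ xs → f x ≡ g x) → ∑ xs f ≡ ∑ xs g
    ∑-cong []       f≡g = refl
    ∑-cong (x ∷ xs) f≡g = cong₂ _+_ (f≡g (here refl)) (∑-cong xs (f≡g ∘ there))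

  ∑-+ : ∀ (xs : List X) {f g : X → ℕ} → ∑ xs (λ x → f x + g x) ≡ ∑ xs f + ∑ xs g
  ∑-+ []       = refl
  ∑-+ (x ∷ xs) {f} {g} = begin
    f x + g x + ∑ xs (λ x → f x + g x)   ≡⟨ cong (f x + g x +_) (∑-+ xs) ⟩
    f x + g x + (∑ xs f + ∑ xs g)
      ≡⟨ solve 4 (λ a b c e → a :+ b :+ (c :+ e) := a :+ c :+ (b :+ e)) refl (f x) (g x) (∑ xs f) (∑ xs g) ⟩
    f x + ∑ xs f + (g x + ∑ xs g)        ∎
    where
    open ≡-Reasoning
    open +-*-Solver

  ∑-*ˡ : ∀ (xs : List X) k {f} → ∑ xs (λ x → k * f x) ≡ k * ∑ xs f
  ∑-*ˡ []       k = sym (ℕ.*-zeroʳ k)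
  ∑-*ˡ (x ∷ xs) k {f} = trans (cong (k * f x +_) (∑-*ˡ xs k)) (sym (ℕ.*-distribˡ-+ k (f x) (∑ xs f)))

  ∑-*ʳ : ∀ (xs : List X) k {f} → ∑ xs (λ x → f x * k) ≡ ∑ xs f * k
  ∑-*ʳ []       k = refl
  ∑-*ʳ (x ∷ xs) k {f} = trans (cong (f x * k +_) (∑-*ʳ xs k)) (sym (ℕ.*-distribʳ-+ k (f x) (∑ xs f)))

  ∑-const : ∀ (xs : List X) k → ∑ xs (λ _ → k) ≡ length xs * k
  ∑-const []       k = refl
  ∑-const (x ∷ xs) k = cong (k +_) (∑-const xs k)

  ∑-zero : ∀ (xs : List X) → ∑ xs (λ _ → 0) ≡ 0
  ∑-zero xs = trans (∑-const xs 0) (ℕ.*-zeroʳ (length xs))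

  ∑-++ : ∀ (xs ys : List X) {f} → ∑ (xs ++ ys) f ≡ ∑ xs f + ∑ ys f
  ∑-++ xs ys {f} = trans (cong sum (List.map-++ f xs ys)) (sum-++ (map f xs) (map f ys))

  ∑-↭ : {xs ys : List X} → xs ↭ ys → ∀ {f} → ∑ xs f ≡ ∑ ys f
  ∑-↭ xs↭ys = sum-↭ (↭.map⁺ _ xs↭ys)

  ∑-map : ∀ (h : Y → X) ys {f} → ∑ (map h ys) f ≡ ∑ ys (f ∘ h)
  ∑-map h ys = cong sum (sym (List.map-∘ ys))

  ∑-comm : ∀ (xs : List X) (ys : List Y) {f : X → Y → ℕ} →
           ∑ xs (λ x → ∑ ys (f x)) ≡ ∑ ys (λ y → ∑ xs (λ x → f x y))
  ∑-comm []       ys = sym (∑-zero ys)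
  ∑-comm (x ∷ xs) ys {f} = trans (cong (∑ ys (f x) +_) (∑-comm xs ys)) (sym (∑-+ ys))

  ∑-concat-map : ∀ (xs : List X) (h : X → List Y) {f} →
                 ∑ (concat (map h xs)) f ≡ ∑ xs (λ x → ∑ (h x) f)
  ∑-concat-map []       h = refl
  ∑-concat-map (x ∷ xs) h {f} = trans (∑-++ (h x) (concat (map h xs))) (cong (∑ (h x) f +_) (∑-concat-map xs h))

  tabulate≡map-allFin : ∀ {m} (h : Fin m → X) → tabulate h ≡ map h (allFin m)
  tabulate≡map-allFin h = sym (List.map-tabulate (λ i → i) h)

  ∑-concat-tabulate : ∀ {m} (h : Fin m → List Y) {f} →
                      ∑ (concat (tabulate h)) f ≡ ∑ (allFin m) (λ i → ∑ (h i) f)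
  ∑-concat-tabulate {m = m} h {f} =
    trans (cong (λ l → ∑ (concat l) f) (tabulate≡map-allFin h)) (∑-concat-map (allFin m) h)

  ∑-cartesianProduct : ∀ (xs : List X) (ys : List Y) {f : X × Y → ℕ} →
                       ∑ (cartesianProduct xs ys) f ≡ ∑ xs (λ x → ∑ ys (λ y → f (x , y)))
  ∑-cartesianProduct []       ys = refl
  ∑-cartesianProduct (x ∷ xs) ys {f} = begin
    ∑ (map (x ,_) ys ++ cartesianProduct xs ys) f          ≡⟨ ∑-++ (map (x ,_) ys) (cartesianProduct xs ys) ⟩
    ∑ (map (x ,_) ys) f + ∑ (cartesianProduct xs ys) f
      ≡⟨ cong₂ _+_ (∑-map (x ,_) ys) (∑-cartesianProduct xs ys) ⟩
    ∑ ys (λ y → f (x , y)) + ∑ xs (λ x → ∑ ys (λ y → f (x , y))) ∎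
    where open ≡-Reasoning

  length≡∑ : ∀ (xs : List X) → length xs ≡ ∑ xs (λ _ → 1)
  length≡∑ xs = sym (trans (∑-const xs 1) (ℕ.*-identityʳ _))

  𝟙 : ∀ {P : Set} → Dec P → ℕ
  𝟙 (yes _) = 1
  𝟙 (no _)  = 0

  module _ {P : Set} where

    𝟙-yes : ∀ (P? : Dec P) → P → 𝟙 P? ≡ 1
    𝟙-yes (yes _) p = refl
    𝟙-yes (no ¬p) p = contradiction p ¬p

    𝟙-no : ∀ (P? : Dec P) → ¬ P → 𝟙 P? ≡ 0
    𝟙-no (yes p) ¬p = contradiction p ¬p
    𝟙-no (no _)  ¬p = refl

    𝟙≤1 : ∀ (P? : Dec P) → 𝟙 P? ≤ 1
    𝟙≤1 (yes _) = ℕ.≤-refl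
    𝟙≤1 (no _)  = z≤n

  count-self : ∀ (_≟_ : DecidableEquality X) {xs x} → Unique xs → x ∈ xs → ∑ xs (λ y → 𝟙 (y ≟ x)) ≡ 1
  count-self _≟_ {x ∷ xs} (x∉xs ∷ _) (here refl) = cong₂ _+_ (𝟙-yes (x ≟ x) refl)
    (trans (∑-cong xs λ {y} y∈xs → 𝟙-no (y ≟ x) λ y≡x → All.lookup x∉xs y∈xs (sym y≡x)) (∑-zero xs))
  count-self _≟_ {y ∷ xs} {x} (y∉xs ∷ xs!) (there x∈xs) =
    cong₂ _+_ (𝟙-no (y ≟ x) (All.lookup y∉xs x∈xs)) (count-self _≟_ xs! x∈xs)

  ∑-filter : ∀ {P : Pred X _} (P? : Decidable P) xs {f} →
             ∑ (filter P? xs) f ≡ ∑ xs (λ x → 𝟙 (P? x) * f x)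
  ∑-filter P? []       = refl
  ∑-filter P? (x ∷ xs) {f} with P? x
  ... | yes _ = cong₂ _+_ (sym (ℕ.+-identityʳ (f x))) (∑-filter P? xs)
  ... | no  _ = ∑-filter P? xs

  length-filter : ∀ {P : Pred X _} (P? : Decidable P) xs → length (filter P? xs) ≡ ∑ xs (λ x → 𝟙 (P? x))
  length-filter P? xs = trans (length≡∑ (filter P? xs)) (trans (∑-filter P? xs) (∑-cong xs λ _ → ℕ.*-identityʳ _))

  ∈⇒≤∑ : ∀ {xs : List X} {x} → x ∈ xs → ∀ {f} → f x ≤ ∑ xs f
  ∈⇒≤∑ {xs = x ∷ xs} (here refl)  {f} = ℕ.m≤m+n (f x) (∑ xs f)
  ∈⇒≤∑ {xs = y ∷ xs} (there x∈xs) {f} = ℕ.≤-trans (∈⇒≤∑ x∈xs) (ℕ.m≤n+m (∑ xs f) (f y))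

  ∈⇒↭-head : ∀ {xs : List X} {x} → x ∈ xs → ∃ λ ys → xs ↭ x ∷ ys
  ∈⇒↭-head x∈xs with ys , zs , refl ← ∈.∈-∃++ x∈xs = ys ++ zs , ↭.shift _ ys zs

  -- Separates one block from all the others in a sum over blocks.
  remove-index : ∀ {m} (i : Fin m) → ∃ λ js → allFin m ↭ i ∷ js × All (i ≢_) js
  remove-index {m} i with js , all↭i∷js ← ∈⇒↭-head (∈.∈-allFin i)
    with i∉js ∷ _ ← Unique-resp-↭ all↭i∷js (Unique.allFin⁺ m) = js , all↭i∷js , i∉js

  module _ {m} {f : Fin m → ℕ} where

    ∑-collapse : ∀ i → (∀ j → i ≢ j → f j ≡ 0) → ∑ (allFin m) f ≡ f i
    ∑-collapse i f≡0 with js , all↭i∷js , i∉js ← remove-index i = begin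
      ∑ (allFin m) f    ≡⟨ ∑-↭ all↭i∷js ⟩
      f i + ∑ js f      ≡⟨ cong (f i +_) (∑-cong js λ {j} j∈js → f≡0 j (All.lookup i∉js j∈js)) ⟩
      f i + ∑ js (λ _ → 0)  ≡⟨ cong (f i +_) (∑-zero js) ⟩
      f i + 0           ≡⟨ ℕ.+-identityʳ (f i) ⟩
      f i               ∎
      where open ≡-Reasoning

    pair≤∑ : ∀ {i j} → i ≢ j → f i + f j ≤ ∑ (allFin m) f
    pair≤∑ {i} {j} i≢j with js , all↭i∷js , i∉js ← remove-index i = begin
      f i + f j        ≤⟨ ℕ.+-monoʳ-≤ (f i) (∈⇒≤∑ (j∈ (↭.∈-resp-↭ all↭i∷js (∈.∈-allFin j)))) ⟩
      f i + ∑ js f     ≡⟨ ∑-↭ all↭i∷js ⟨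
      ∑ (allFin m) f   ∎
      where
      open ℕ.≤-Reasoning
      j∈ : j ∈ i ∷ js → j ∈ js
      j∈ (here j≡i) = contradiction (sym j≡i) i≢j
      j∈ (there p)  = p

  ∑-off-diagonal : ∀ {m} (_≟_ : ∀ (i j : Fin m) → Dec (i ≡ j)) (f : Fin m → Fin m → ℕ) i →
    ∑ (allFin m) (λ j → 𝟙 (i ≟ j) * f i j) ≡ f i i
  ∑-off-diagonal _≟_ f i = trans
    (∑-collapse i λ j i≢j → cong (_* f i j) (𝟙-no (i ≟ j) i≢j))
    (trans (cong (_* f i i) (𝟙-yes (i ≟ i) refl)) (ℕ.*-identityˡ _))

-- Exchange counting in uniform set systems.

module SwapSystems where

  open FiniteSums
  open import Data.List.Base using (List; _++_; length)
  open import Data.List.Membership.Propositional using (_∈_)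
  import Data.List.Membership.Propositional.Properties as ∈
  open import Data.List.Relation.Binary.Permutation.Propositional using (_↭_; ↭-sym)
  import Data.List.Relation.Binary.Permutation.Propositional.Properties as ↭
  open import Data.List.Relation.Unary.Unique.Propositional using (Unique)
  import Data.List.Properties as List
  open import Data.Nat.Base as ℕ using (ℕ; suc; _+_; _*_; _∸_; _≤_; z≤n)
  import Data.Nat.Properties as ℕ
  open import Data.Nat.Solver using (module +-*-Solver)
  open import Relation.Binary.PropositionalEquality hiding (J)
  open import Relation.Nullary.Decidable using (Dec; yes; no)
  open import Relation.Nullary.Negation using (¬_)
  open import Relation.Binary.Definitions using (DecidableEquality)

  -- A d-uniform set system in which each a ∈ A can be exchanged for every t ∉ A
  -- with at most one exception: for sets of field elements, the one t giving the
  -- forbidden sum.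
  record SwapSystem : Set₁ where
    infix 4 _∋_ _∋?_ _≟_
    field
      Point Object   : Set
      points         : List Point
      objects        : List Object
      objects-unique : Unique objects
      _≟_            : DecidableEquality Object
      _∋_            : Point → Object → Set
      _∋?_           : ∀ A t → Dec (A ∋ t)
      Swappable      : Point → Object → Object → Set
      swappable?     : ∀ A a t → Dec (Swappable A a t)
      swap           : Point → Object → Object → Point
      d              : ℕ
      uniform        : ∀ {A} → A ∈ points → ∑ objects (λ t → 𝟙 (A ∋? t)) ≡ d
      old∈           : ∀ {A a t} → Swappable A a t → A ∋ a
      new∉           : ∀ {A a t} → Swappable A a t → ¬ A ∋ t
      -- Additive form, so that summing over `x` involves no truncated subtraction.
      swap-∋         : ∀ {A a t} → Swappable A a t → ∀ x →
                       𝟙 (swap A a t ∋? x) + 𝟙 (x ≟ a) ≡ 𝟙 (A ∋? x) + 𝟙 (x ≟ t)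
      -- Swapping back restores a point with the roles of `a` and `t` reversed; this is the
      -- resulting reindexing, for an arbitrary test function `f`.
      exchange       : ∀ a t {f : Point → ℕ} →
                       ∑ points (λ A → 𝟙 (swappable? A a t) * f A)
                       ≡ ∑ points (λ A → 𝟙 (swappable? A t a) * f (swap A t a))
      swappable-many : ∀ {A a} → A ∈ points → A ∋ a →
                       length objects ≤ suc d + ∑ objects (λ t → 𝟙 (swappable? A a t))

    meet : List Object → Point → ℕ
    meet T A = ∑ T (λ t → 𝟙 (A ∋? t))

    module Split (T T′ : List Object) (split : T ++ T′ ↭ objects) where

      private
        N = length points
        s = length T
        r = length T′

      s+r : s + r ≡ length objects
      s+r = trans (sym (List.length-++ T)) (↭.↭-length split)

      ∑-split : ∀ {f} → ∑ objects f ≡ ∑ T f + ∑ T′ f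
      ∑-split = trans (∑-↭ (↭-sym split)) (∑-++ T T′)

      meet-split : ∀ {A} → A ∈ points → meet T A + meet T′ A ≡ d
      meet-split A∈P = trans (sym ∑-split) (uniform A∈P)

      private
        1≤count : ∀ {U a} → a ∈ U → 1 ≤ ∑ U (λ x → 𝟙 (x ≟ a))
        1≤count {U} {a} a∈U = ℕ.≤-trans (ℕ.≤-reflexive (sym (𝟙-yes (a ≟ a) refl))) (∈⇒≤∑ a∈U)

        count-total : ∀ {a} → a ∈ objects → ∑ T (λ x → 𝟙 (x ≟ a)) + ∑ T′ (λ x → 𝟙 (x ≟ a)) ≡ 1
        count-total a∈E = trans (sym ∑-split) (count-self _≟_ objects-unique a∈E)

        count-∈ : ∀ {a} → a ∈ T → ∑ T (λ x → 𝟙 (x ≟ a)) ≡ 1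
        count-∈ {a} a∈T = ℕ.≤-antisym
          (ℕ.≤-trans (ℕ.m≤m+n _ _) (ℕ.≤-reflexive (count-total (↭.∈-resp-↭ split (∈.∈-++⁺ˡ a∈T)))))
          (1≤count a∈T)

        count-∉ : ∀ {t} → t ∈ T′ → ∑ T (λ x → 𝟙 (x ≟ t)) ≡ 0
        count-∉ {t} t∈T′ = ℕ.n≤0⇒n≡0 (ℕ.+-cancelʳ-≤ 1 _ 0
          (ℕ.≤-trans (ℕ.+-monoʳ-≤ _ (1≤count t∈T′))
            (ℕ.≤-reflexive (count-total (↭.∈-resp-↭ split (∈.∈-++⁺ʳ T t∈T′))))))

      -- Here `t` leaves and `a` enters: the loss lies outside `T`, the gain inside.
      meet-swap : ∀ {A a t} → a ∈ T → t ∈ T′ → Swappable A t a → meet T (swap A t a) ≡ suc (meet T A)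
      meet-swap {A} {a} {t} a∈T t∈T′ ok = begin
        meet T A′                               ≡⟨ ℕ.+-identityʳ _ ⟨
        meet T A′ + 0                           ≡⟨ cong (meet T A′ +_) (count-∉ t∈T′) ⟨
        meet T A′ + ∑ T (λ x → 𝟙 (x ≟ t))       ≡⟨ ∑-+ T ⟨
        ∑ T (λ x → 𝟙 (A′ ∋? x) + 𝟙 (x ≟ t))     ≡⟨ ∑-cong T (λ {x} _ → swap-∋ ok x) ⟩
        ∑ T (λ x → 𝟙 (A ∋? x) + 𝟙 (x ≟ a))      ≡⟨ ∑-+ T ⟩
        meet T A + ∑ T (λ x → 𝟙 (x ≟ a))        ≡⟨ cong (meet T A +_) (count-∈ a∈T) ⟩
        meet T A + 1                            ≡⟨ ℕ.+-comm (meet T A) 1 ⟩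
        suc (meet T A)                          ∎
        where
        open ≡-Reasoning
        A′ = swap A t a

      exchange-∑ : ∀ U V {f : Point → ℕ} →
        ∑ points (λ A → ∑ U λ a → ∑ V λ t → 𝟙 (swappable? A a t) * f A)
        ≡ ∑ points (λ A → ∑ U λ a → ∑ V λ t → 𝟙 (swappable? A t a) * f (swap A t a))
      exchange-∑ U V {f} = begin
        ∑ points (λ A → ∑ U λ a → ∑ V λ t → 𝟙 (swappable? A a t) * f A)   ≡⟨ ∑-comm points U ⟩
        ∑ U (λ a → ∑ points λ A → ∑ V λ t → 𝟙 (swappable? A a t) * f A)   ≡⟨ ∑-cong U (λ _ → ∑-comm points V) ⟩
        ∑ U (λ a → ∑ V λ t → ∑ points λ A → 𝟙 (swappable? A a t) * f A)
          ≡⟨ ∑-cong U (λ {a} _ → ∑-cong V λ {t} _ → exchange a t) ⟩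
        ∑ U (λ a → ∑ V λ t → ∑ points λ A → 𝟙 (swappable? A t a) * f (swap A t a))
          ≡⟨ ∑-cong U (λ _ → ∑-comm points V) ⟨
        ∑ U (λ a → ∑ points λ A → ∑ V λ t → 𝟙 (swappable? A t a) * f (swap A t a))   ≡⟨ ∑-comm points U ⟨
        ∑ points (λ A → ∑ U λ a → ∑ V λ t → 𝟙 (swappable? A t a) * f (swap A t a))   ∎
        where open ≡-Reasoning

      private
        swappable≤∋ : ∀ A t a → 𝟙 (swappable? A t a) ≤ 𝟙 (A ∋? t)
        swappable≤∋ A t a with swappable? A t a
        ... | no _  = z≤n
        ... | yes ok = ℕ.≤-reflexive (sym (𝟙-yes (A ∋? t) (old∈ ok)))

        swappable+∋ : ∀ A t a → 𝟙 (swappable? A t a) + 𝟙 (A ∋? a) ≤ 1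
        swappable+∋ A t a with swappable? A t a
        ... | no _   = 𝟙≤1 (A ∋? a)
        ... | yes ok = ℕ.≤-reflexive (cong suc (𝟙-no (A ∋? a) (new∉ ok)))

        swappable+∋∋ : ∀ A t a → 𝟙 (swappable? A t a) * 1 + 𝟙 (A ∋? a) * 𝟙 (A ∋? t) ≤ 𝟙 (A ∋? t)
        swappable+∋∋ A t a with A ∋? t | swappable≤∋ A t a
        ... | no _  | le = ℕ.≤-reflexive (cong₂ _+_ (trans (ℕ.*-identityʳ _) (ℕ.n≤0⇒n≡0 le)) (ℕ.*-zeroʳ (𝟙 (A ∋? a))))
        ... | yes _ | _  = ℕ.≤-trans (ℕ.≤-reflexive (cong₂ _+_ (ℕ.*-identityʳ (𝟙 (swappable? A t a))) (ℕ.*-identityʳ (𝟙 (A ∋? a))))) (swappable+∋ A t a)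

      -- Count exchanges that replace some `a` in `T` lying in `A`. Each incident pair (A, a) has at
      -- least q - d - 1 of them. Read backwards, a pair (A, a) with `a` not in `A` arises at most d
      -- times, once for each element of `A` that can make room. With J incidences between points
      -- and `T` this is (q - 1 - d) J ≤ d (s N - J).
      degree-bound : (length objects ∸ 1) * ∑ points (meet T) ≤ d * s * N
      degree-bound = begin
        (q ∸ 1) * J                    ≤⟨ ℕ.*-monoˡ-≤ J q∸1≤ ⟩
        ((q ∸ suc d) + d) * J          ≡⟨ ℕ.*-distribʳ-+ J (q ∸ suc d) d ⟩
        (q ∸ suc d) * J + d * J        ≤⟨ ℕ.+-monoˡ-≤ (d * J) lower ⟩
        ∑ points (λ A → ∑ T λ a → ∑ objects λ t → 𝟙 (swappable? A a t) * 1) + d * J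
          ≡⟨ cong (_+ d * J) (exchange-∑ T objects {λ _ → 1}) ⟩
        ∑ points (λ A → ∑ T λ a → ∑ objects λ t → 𝟙 (swappable? A t a) * 1) + d * J
          ≡⟨ cong₂ _+_ refl (∑-*ˡ points d) ⟨
        ∑ points (λ A → ∑ T λ a → ∑ objects λ t → 𝟙 (swappable? A t a) * 1) + ∑ points (λ A → d * meet T A)
          ≡⟨ ∑-+ points ⟨
        ∑ points (λ A → (∑ T λ a → ∑ objects λ t → 𝟙 (swappable? A t a) * 1) + d * meet T A)
          ≤⟨ ∑-mono points upper ⟩
        ∑ points (λ A → s * d)         ≡⟨ ∑-const points (s * d) ⟩
        N * (s * d)                    ≡⟨ solve 3 (λ N s d → N :* (s :* d) := d :* s :* N) refl N s d ⟩
        d * s * N                      ∎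
        where
        open ℕ.≤-Reasoning
        open +-*-Solver
        q = length objects
        J = ∑ points (meet T)
        -- This form also covers q ≤ d, where the truncated difference is 0 and the summand d
        -- suffices.
        q∸1≤ : q ∸ 1 ≤ (q ∸ suc d) + d
        q∸1≤ = begin
          q ∸ 1               ≤⟨ ℕ.m≤n+m∸n (q ∸ 1) d ⟩
          d + (q ∸ 1 ∸ d)     ≡⟨ cong (d +_) (ℕ.∸-+-assoc q 1 d) ⟩
          d + (q ∸ suc d)     ≡⟨ ℕ.+-comm d _ ⟩
          (q ∸ suc d) + d     ∎
        lower : (q ∸ suc d) * J ≤ ∑ points (λ A → ∑ T λ a → ∑ objects λ t → 𝟙 (swappable? A a t) * 1)
        lower = begin
          (q ∸ suc d) * J                                 ≡⟨ ∑-*ˡ points (q ∸ suc d) ⟨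
          ∑ points (λ A → (q ∸ suc d) * meet T A)         ≡⟨ ∑-cong points (λ _ → ∑-*ˡ T (q ∸ suc d)) ⟨
          ∑ points (λ A → ∑ T λ a → (q ∸ suc d) * 𝟙 (A ∋? a))
            ≤⟨ ∑-mono points (λ A∈P → ∑-mono T λ {a} _ → many A∈P a) ⟩
          ∑ points (λ A → ∑ T λ a → ∑ objects λ t → 𝟙 (swappable? A a t) * 1) ∎
          where
          many : ∀ {A} → A ∈ points → ∀ a → (q ∸ suc d) * 𝟙 (A ∋? a) ≤ ∑ objects λ t → 𝟙 (swappable? A a t) * 1
          many {A} A∈P a with A ∋? a
          ... | no _ = ℕ.≤-trans (ℕ.≤-reflexive (ℕ.*-zeroʳ (q ∸ suc d))) z≤n
          ... | yes A∋a = begin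
            (q ∸ suc d) * 1       ≡⟨ ℕ.*-identityʳ _ ⟩
            q ∸ suc d             ≤⟨ ℕ.m≤n+o⇒m∸n≤o q (suc d) (swappable-many A∈P A∋a) ⟩
            ∑ objects (λ t → 𝟙 (swappable? A a t))      ≡⟨ ∑-cong objects (λ _ → ℕ.*-identityʳ _) ⟨
            ∑ objects (λ t → 𝟙 (swappable? A a t) * 1)  ∎
        upper : ∀ {A} → A ∈ points → (∑ T λ a → ∑ objects λ t → 𝟙 (swappable? A t a) * 1) + d * meet T A ≤ s * d
        upper {A} A∈P = begin
          (∑ T λ a → ∑ objects λ t → 𝟙 (swappable? A t a) * 1) + d * meet T A
            ≡⟨ cong₂ _+_ refl (∑-*ˡ T d) ⟨
          (∑ T λ a → ∑ objects λ t → 𝟙 (swappable? A t a) * 1) + ∑ T (λ a → d * 𝟙 (A ∋? a))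
            ≡⟨ ∑-+ T ⟨
          ∑ T (λ a → (∑ objects λ t → 𝟙 (swappable? A t a) * 1) + d * 𝟙 (A ∋? a))
            ≤⟨ ∑-mono T (λ {a} _ → single a) ⟩
          ∑ T (λ _ → d)   ≡⟨ ∑-const T d ⟩
          s * d           ∎
          where
          -- If `a` is already in `A`, no exchange can insert it and the second summand uses the
          -- whole budget d.
          single : ∀ a → (∑ objects λ t → 𝟙 (swappable? A t a) * 1) + d * 𝟙 (A ∋? a) ≤ d
          single a = begin
            (∑ objects λ t → 𝟙 (swappable? A t a) * 1) + d * 𝟙 (A ∋? a)
              ≡⟨ cong₂ _+_ refl (ℕ.*-comm d (𝟙 (A ∋? a))) ⟩
            (∑ objects λ t → 𝟙 (swappable? A t a) * 1) + 𝟙 (A ∋? a) * d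
              ≡⟨ cong (λ e → (∑ objects λ t → 𝟙 (swappable? A t a) * 1) + 𝟙 (A ∋? a) * e) (uniform A∈P) ⟨
            (∑ objects λ t → 𝟙 (swappable? A t a) * 1) + 𝟙 (A ∋? a) * meet objects A
              ≡⟨ cong₂ _+_ refl (∑-*ˡ objects (𝟙 (A ∋? a))) ⟨
            (∑ objects λ t → 𝟙 (swappable? A t a) * 1) + ∑ objects (λ t → 𝟙 (A ∋? a) * 𝟙 (A ∋? t))
              ≡⟨ ∑-+ objects ⟨
            ∑ objects (λ t → 𝟙 (swappable? A t a) * 1 + 𝟙 (A ∋? a) * 𝟙 (A ∋? t))
              ≤⟨ ∑-mono objects (λ {t} _ → swappable+∋∋ A t a) ⟩
            meet objects A  ≡⟨ uniform A∈P ⟩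
            d               ∎

      contained nearly : Point → ℕ
      contained A = 𝟙 (meet T A ℕ.≟ d)
      nearly    A = 𝟙 (suc (meet T A) ℕ.≟ d)

      -- A set inside `T` can give up any of its d elements, each for at least r - 1 objects outside
      -- `T`. To undo such an exchange, a set with d - 1 elements in `T` replaces its only outside
      -- element by one of at most s objects of `T`.
      mono-bound : d * (r ∸ 1) * ∑ points contained ≤ s * ∑ points nearly
      mono-bound = begin
        d * (r ∸ 1) * ∑ points contained                ≡⟨ ∑-*ˡ points (d * (r ∸ 1)) ⟨
        ∑ points (λ A → d * (r ∸ 1) * contained A)      ≤⟨ ∑-mono points lower ⟩
        ∑ points (λ A → ∑ T λ a → ∑ T′ λ t → 𝟙 (swappable? A a t) * contained A)
          ≡⟨ exchange-∑ T T′ {contained} ⟩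
        ∑ points (λ A → ∑ T λ a → ∑ T′ λ t → 𝟙 (swappable? A t a) * contained (swap A t a))
          ≤⟨ ∑-mono points upper ⟩
        ∑ points (λ A → s * nearly A)                   ≡⟨ ∑-*ˡ points s ⟩
        s * ∑ points nearly                             ∎
        where
        open ℕ.≤-Reasoning
        lower : ∀ {A} → A ∈ points →
          d * (r ∸ 1) * contained A ≤ ∑ T λ a → ∑ T′ λ t → 𝟙 (swappable? A a t) * contained A
        lower {A} A∈P with meet T A ℕ.≟ d
        ... | no _ = ℕ.≤-trans (ℕ.≤-reflexive (ℕ.*-zeroʳ (d * (r ∸ 1)))) z≤n
        ... | yes meet≡d = begin
          d * (r ∸ 1) * 1                        ≡⟨ ℕ.*-identityʳ _ ⟩
          d * (r ∸ 1)                            ≡⟨ cong (_* (r ∸ 1)) meet≡d ⟨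
          meet T A * (r ∸ 1)                     ≡⟨ ∑-*ʳ T (r ∸ 1) ⟨
          ∑ T (λ a → 𝟙 (A ∋? a) * (r ∸ 1))       ≤⟨ ∑-mono T (λ {a} _ → many a) ⟩
          (∑ T λ a → ∑ T′ λ t → 𝟙 (swappable? A a t) * 1)  ∎
          where
          -- Replacements within `T` avoid the d elements of `A`, so at most s - d of the at least q
          -- - d - 1 replacements are lost there; r - 1 remain outside.
          inT : ∀ a → ∑ T (λ t → 𝟙 (swappable? A a t)) + d ≤ s
          inT a = begin
            ∑ T (λ t → 𝟙 (swappable? A a t)) + d         ≡⟨ cong₂ _+_ refl meet≡d ⟨
            ∑ T (λ t → 𝟙 (swappable? A a t)) + meet T A  ≡⟨ ∑-+ T ⟨
            ∑ T (λ t → 𝟙 (swappable? A a t) + 𝟙 (A ∋? t)) ≤⟨ ∑-mono T (λ {t} _ → swappable+∋ A a t) ⟩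
            ∑ T (λ _ → 1)                                ≡⟨ length≡∑ T ⟨
            s ∎
          many : ∀ a → 𝟙 (A ∋? a) * (r ∸ 1) ≤ ∑ T′ λ t → 𝟙 (swappable? A a t) * 1
          many a with A ∋? a
          ... | no _ = z≤n
          ... | yes A∋a = begin
            1 * (r ∸ 1)     ≡⟨ ℕ.*-identityˡ _ ⟩
            r ∸ 1           ≤⟨ ℕ.m≤n+o⇒m∸n≤o r 1 (ℕ.+-cancelˡ-≤ (s + d) r (1 + g′) total) ⟩
            g′              ≡⟨ ∑-cong T′ (λ _ → ℕ.*-identityʳ _) ⟨
            ∑ T′ (λ t → 𝟙 (swappable? A a t) * 1) ∎
            where
            g  = ∑ T (λ t → 𝟙 (swappable? A a t))
            g′ = ∑ T′ (λ t → 𝟙 (swappable? A a t))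
            open +-*-Solver
            total : s + d + r ≤ s + d + (1 + g′)
            total = begin
              s + d + r                ≡⟨ solve 3 (λ s d r → s :+ d :+ r := s :+ r :+ d) refl s d r ⟩
              s + r + d                ≡⟨ cong (_+ d) s+r ⟩
              length objects + d       ≤⟨ ℕ.+-monoˡ-≤ d (swappable-many A∈P A∋a) ⟩
              suc d + ∑ objects (λ t → 𝟙 (swappable? A a t)) + d  ≡⟨ cong (λ e → suc d + e + d) ∑-split ⟩
              suc d + (g + g′) + d
                ≡⟨ solve 3 (λ d g g′ → con 1 :+ d :+ (g :+ g′) :+ d := (g :+ d) :+ d :+ (con 1 :+ g′))
                     refl d g g′ ⟩
              (g + d) + d + (1 + g′)   ≤⟨ ℕ.+-monoˡ-≤ (1 + g′) (ℕ.+-monoˡ-≤ d (inT a)) ⟩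
              s + d + (1 + g′)         ∎
        upper : ∀ {A} → A ∈ points →
          (∑ T λ a → ∑ T′ λ t → 𝟙 (swappable? A t a) * contained (swap A t a)) ≤ s * nearly A
        upper {A} A∈P with suc (meet T A) ℕ.≟ d
        ... | yes meet≡d-1 = begin
          (∑ T λ a → ∑ T′ λ t → 𝟙 (swappable? A t a) * contained (swap A t a))
            ≤⟨ ∑-mono T (λ {a} _ → ∑-mono T′ λ {t} _ → ℕ.≤-trans
                 (ℕ.*-mono-≤ (swappable≤∋ A t a) (𝟙≤1 (meet T (swap A t a) ℕ.≟ d))) (ℕ.≤-reflexive (ℕ.*-identityʳ _))) ⟩
          ∑ T (λ _ → meet T′ A)     ≡⟨ ∑-const T (meet T′ A) ⟩
          s * meet T′ A             ≡⟨ cong (s *_) meet′≡1 ⟩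
          s * 1                     ∎
          where
          meet′≡1 : meet T′ A ≡ 1
          meet′≡1 = ℕ.+-cancelˡ-≡ (meet T A) (meet T′ A) 1
            (trans (meet-split A∈P) (trans (sym meet≡d-1) (ℕ.+-comm 1 (meet T A))))
        ... | no meet≢d-1 = ℕ.≤-trans (ℕ.≤-reflexive (trans
            (∑-cong T λ {a} a∈T → trans (∑-cong T′ λ {t} t∈T′ → vanish a t a∈T t∈T′) (∑-zero T′)) (∑-zero T))) z≤n
          where
          -- The exchange raises the intersection with `T` by exactly one, so a contained set can
          -- only come from a set with d - 1 elements in `T`.
          vanish : ∀ a t → a ∈ T → t ∈ T′ → 𝟙 (swappable? A t a) * contained (swap A t a) ≡ 0
          vanish a t a∈T t∈T′ with swappable? A t a
          ... | no _   = refl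
          ... | yes ok = trans (ℕ.*-identityˡ _) (𝟙-no (meet T (swap A t a) ℕ.≟ d)
                λ eq → meet≢d-1 (trans (sym (meet-swap a∈T t∈T′ ok)) eq))

-- Lower bound for the total off-diagonal contribution.

module BlockInequality where

  open FiniteSums
  open SwapSystems
  open import Data.Fin.Base as Fin using (Fin)
  import Data.Fin.Properties as Fin
  open import Data.List.Base using (List; _++_; map; concat; tabulate; allFin; length)
  open import Data.List.Membership.Propositional using (_∈_)
  import Data.List.Membership.Propositional.Properties as ∈
  open import Data.List.Relation.Binary.Permutation.Propositional
    using (_↭_; ↭-sym; ↭-trans; ↭-reflexive)
  import Data.List.Relation.Binary.Permutation.Propositional.Properties as ↭
  open import Data.Nat.Base as ℕ using (ℕ; zero; suc; _+_; _*_; _∸_; _≤_; z≤n; s≤s)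
  import Data.Nat.Properties as ℕ
  open import Data.Nat.Solver using (module +-*-Solver)
  open import Data.Product.Base using (∃; _,_; proj₁; proj₂)
  open import Relation.Binary.Definitions using (tri<; tri≈; tri>)
  open import Relation.Binary.PropositionalEquality hiding (J)
  open import Relation.Nullary.Decidable using (yes; no)
  open import Relation.Nullary.Negation using (contradiction)

  concat-↭ : ∀ {X : Set} {xss yss : List (List X)} → xss ↭ yss → concat xss ↭ concat yss
  concat-↭ _↭_.refl = _↭_.refl
  concat-↭ (_↭_.prep xs p) = ↭.++⁺ˡ xs (concat-↭ p)
  concat-↭ (_↭_.swap xs ys p) = ↭-trans (↭.shifts xs ys) (↭.++⁺ˡ ys (↭.++⁺ˡ xs (concat-↭ p)))
  concat-↭ (_↭_.trans p p′) = ↭-trans (concat-↭ p) (concat-↭ p′)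

  another : ∀ {m} → 2 ≤ m → (i : Fin m) → ∃ λ j → i ≢ j
  another (s≤s (s≤s _)) Fin.zero    = Fin.suc Fin.zero , λ ()
  another (s≤s (s≤s _)) (Fin.suc i) = Fin.zero , λ ()

  -- From d (r - 1) ≥ 3 (r - 1) ≥ 2 r, where the second step needs r ≥ 3, one gets 2 r M ≤ s G. Half
  -- of 2 q s G thus pays for 2 q r M. The other half is at least 2 b s G, which covers b² G because
  -- b ≤ s, and b² M because b M ≤ s G.
  weight-inequality : ∀ {b d q r s} M G → 3 ≤ d → 3 ≤ r → b ≤ r → b ≤ s → 2 * b ≤ q →
    d * (r ∸ 1) * M ≤ s * G →
    2 * q * (r * M) + b * b * (G + M) ≤ 2 * q * (s * G)
  weight-inequality {b} {d} {q} {r} {s} M G 3≤d 3≤r b≤r b≤s 2b≤q dM≤sG = begin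
    2 * q * (r * M) + b * b * (G + M)
      ≡⟨ solve 5 (λ q r M b G → con 2 :* q :* (r :* M) :+ b :* b :* (G :+ M)
                  := q :* (con 2 :* r :* M) :+ (b :* b :* G :+ b :* (b :* M))) refl q r M b G ⟩
    q * (2 * r * M) + (b * b * G + b * (b * M))
      ≤⟨ ℕ.+-mono-≤ (ℕ.*-monoʳ-≤ q 2rM≤sG)
          (ℕ.+-mono-≤ (ℕ.*-monoˡ-≤ G (ℕ.*-monoʳ-≤ b b≤s)) (ℕ.*-monoʳ-≤ b bM≤sG)) ⟩
    q * (s * G) + (b * s * G + b * (s * G))
      ≡⟨ solve 4 (λ q s G b → q :* (s :* G) :+ (b :* s :* G :+ b :* (s :* G))
                  := q :* (s :* G) :+ con 2 :* b :* (s :* G)) refl q s G b ⟩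
    q * (s * G) + 2 * b * (s * G)
      ≤⟨ ℕ.+-monoʳ-≤ (q * (s * G)) (ℕ.*-monoˡ-≤ (s * G) 2b≤q) ⟩
    q * (s * G) + q * (s * G)
      ≡⟨ solve 2 (λ q e → q :* e :+ q :* e := con 2 :* q :* e) refl q (s * G) ⟩
    2 * q * (s * G) ∎
    where
    open ℕ.≤-Reasoning
    open +-*-Solver
    2r≤3[r-1] : ∀ {r} → 3 ≤ r → 2 * r ≤ 3 * (r ∸ 1)
    2r≤3[r-1] (s≤s (s≤s (s≤s {n = n} _))) = begin
      2 * (3 + n)   ≡⟨ solve 1 (λ n → con 2 :* (con 3 :+ n) := con 6 :+ con 2 :* n) refl n ⟩
      6 + 2 * n     ≤⟨ ℕ.+-monoʳ-≤ 6 (ℕ.*-monoˡ-≤ n {2} {3} (s≤s (s≤s z≤n))) ⟩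
      6 + 3 * n     ≡⟨ solve 1 (λ n → con 6 :+ con 3 :* n := con 3 :* (con 2 :+ n)) refl n ⟩
      3 * (2 + n)   ∎
    2rM≤sG : 2 * r * M ≤ s * G
    2rM≤sG = ℕ.≤-trans (ℕ.*-monoˡ-≤ M (ℕ.≤-trans (2r≤3[r-1] 3≤r) (ℕ.*-monoˡ-≤ (r ∸ 1) 3≤d))) dM≤sG
    bM≤sG : b * M ≤ s * G
    bM≤sG = ℕ.≤-trans (ℕ.*-monoˡ-≤ M (ℕ.≤-trans b≤r (ℕ.m≤m+n r (r + 0)))) 2rM≤sG

  module Blocks (𝒳 : SwapSystem) {m}
    (𝒮 : Fin m → List (SwapSystem.Object 𝒳))
    (𝒜 : Fin m → List (SwapSystem.Point 𝒳)) (R : List (SwapSystem.Point 𝒳))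
    (objects-partition : concat (tabulate 𝒮) ↭ SwapSystem.objects 𝒳)
    (points-partition : concat (tabulate 𝒜) ++ R ↭ SwapSystem.points 𝒳)
    (2≤m : 2 ≤ m) (3≤d : 3 ≤ SwapSystem.d 𝒳) where

    open SwapSystem 𝒳

    private
      N = length points
      q = length objects

      s a n⁼ : Fin m → ℕ
      s j = length (𝒮 j)
      a i = length (𝒜 i)
      n⁼ i = ∑ (𝒜 i) (meet (𝒮 i))

      others : Fin m → List Object
      others j = concat (map 𝒮 (proj₁ (remove-index j)))

      split : ∀ j → 𝒮 j ++ others j ↭ objects
      split j = ↭-trans (↭-sym (concat-↭ (↭.map⁺ 𝒮 (proj₁ (proj₂ (remove-index j))))))
        (↭-trans (↭-reflexive (cong concat (sym (tabulate≡map-allFin 𝒮)))) objects-partition)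

      module Block j = Split (𝒮 j) (others j) (split j)

      r : Fin m → ℕ
      r j = length (others j)

      s+r : ∀ j → s j + r j ≡ q
      s+r = Block.s+r

      ∑objects : ∀ {f} → ∑ objects f ≡ ∑ (allFin m) (λ j → ∑ (𝒮 j) f)
      ∑objects = trans (∑-↭ (↭-sym objects-partition)) (∑-concat-tabulate 𝒮)

      ∑points : ∀ {f} → ∑ (allFin m) (λ i → ∑ (𝒜 i) f) + ∑ R f ≡ ∑ points f
      ∑points = trans (cong (_+ _) (sym (∑-concat-tabulate 𝒜))) (trans (sym (∑-++ (concat (tabulate 𝒜)) R)) (∑-↭ points-partition))

      ∑s : ∑ (allFin m) s ≡ q
      ∑s = trans (∑-cong (allFin m) λ _ → length≡∑ (𝒮 _)) (trans (sym ∑objects) (sym (length≡∑ objects)))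

      ∑meet : ∀ {A} → A ∈ points → ∑ (allFin m) (λ j → meet (𝒮 j) A) ≡ d
      ∑meet A∈P = trans (sym ∑objects) (uniform A∈P)

      ∈-points : ∀ i {A} → A ∈ 𝒜 i → A ∈ points
      ∈-points i {A} A∈ = ↭.∈-resp-↭ points-partition (∈.∈-++⁺ˡ (∈.∈-concat⁺′ A∈ (∈.∈-tabulate⁺ i)))

    module _ {b : ℕ} (b≤s : ∀ i → b ≤ length (𝒮 i)) (3≤b : 3 ≤ b) where

      private
        -- As m ≥ 2, the complement of a block contains another block.
        b≤r : ∀ j → b ≤ r j
        b≤r j with k , j≢k ← another 2≤m j = ℕ.≤-trans (b≤s k) (ℕ.+-cancelˡ-≤ (s j) (s k) (r j)
          (ℕ.≤-trans (pair≤∑ j≢k) (ℕ.≤-reflexive (trans ∑s (sym (s+r j))))))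

        2b≤q : 2 * b ≤ q
        2b≤q with i ← Fin.fromℕ< (ℕ.≤-trans (s≤s z≤n) 2≤m) = begin
          2 * b        ≡⟨ cong (b +_) (ℕ.+-identityʳ b) ⟩
          b + b        ≤⟨ ℕ.+-mono-≤ (b≤s i) (b≤r i) ⟩
          s i + r i    ≡⟨ s+r i ⟩
          q            ∎
          where open ℕ.≤-Reasoning

        contained nearly : Fin m → Point → ℕ
        contained j = Block.contained j
        nearly j    = Block.nearly j

        -- Up to the factor q, w⁺ A − w⁻ A bounds from below the contribution
        -- of A to Σ_{j≠i} σ(A_i, S_j), whichever block A_i contains A.
        w⁺ w⁻ : Point → ℕ
        w⁺ A = b + ∑ (allFin m) (λ j → nearly j A * (s j ∸ b))
        w⁻ A = ∑ (allFin m) (λ j → contained j A * (r j + b))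

        -- The single summand `b` is covered by the `b` removed from one of the blocks. This bound
        -- serves both for points with at most d - 2 elements in their block and for the points of
        -- `R`.
        w⁺≤q : ∀ A → w⁺ A ≤ q
        w⁺≤q A = begin
          b + ∑ (allFin m) (λ j → nearly j A * (s j ∸ b))
            ≤⟨ ℕ.+-monoʳ-≤ b (∑-mono (allFin m) λ {j} _ →
                 ℕ.≤-trans (ℕ.*-monoˡ-≤ (s j ∸ b) (𝟙≤1 (suc (meet (𝒮 j) A) ℕ.≟ d))) (ℕ.≤-reflexive (ℕ.*-identityˡ _))) ⟩
          b + ∑ (allFin m) (λ j → s j ∸ b)
            ≤⟨ ℕ.+-monoˡ-≤ _ (∈⇒≤∑ (∈.∈-allFin i) {λ _ → b}) ⟩
          ∑ (allFin m) (λ _ → b) + ∑ (allFin m) (λ j → s j ∸ b)   ≡⟨ ∑-+ (allFin m) ⟨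
          ∑ (allFin m) (λ j → b + (s j ∸ b))
            ≡⟨ ∑-cong (allFin m) (λ {j} _ → ℕ.m+[n∸m]≡n (b≤s j)) ⟩
          ∑ (allFin m) s                                          ≡⟨ ∑s ⟩
          q                                                       ∎
          where
          open ℕ.≤-Reasoning
          i = Fin.fromℕ< (ℕ.≤-trans (s≤s z≤n) 2≤m)

        D = d ∸ 1

        suc-D : suc D ≡ d
        suc-D = ℕ.m+[n∸m]≡n {1} {d} (ℕ.≤-trans (s≤s z≤n) 3≤d)

        q*d : ∀ e → q * D + q + e ≡ q * d + e
        q*d e = cong (_+ e) (trans (ℕ.+-comm (q * D) q) (trans (sym (ℕ.*-suc q D)) (cong (q *_) suc-D)))

        -- At most one element of `A` is left for another block, and 1 < d - 1 because d ≥ 3.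
        nearly-other : ∀ {A} → A ∈ points → ∀ {i j} → i ≢ j → d ≤ suc (meet (𝒮 i) A) → nearly j A ≡ 0
        nearly-other {A} A∈P {i} {j} i≢j large = 𝟙-no (suc (meet (𝒮 j) A) ℕ.≟ d) λ eq →
          ℕ.<⇒≱ 3≤d (ℕ.≤-trans (ℕ.≤-reflexive (sym eq)) (s≤s (ℕ.+-cancelˡ-≤ (meet (𝒮 i) A) (meet (𝒮 j) A) 1
            (ℕ.≤-trans (pair≤∑ i≢j) (ℕ.≤-trans (ℕ.≤-reflexive (∑meet A∈P))
              (ℕ.≤-trans large (ℕ.≤-reflexive (ℕ.+-comm 1 _))))))))

        w⁺-collapse : ∀ {A} → A ∈ points → ∀ i → d ≤ suc (meet (𝒮 i) A) → w⁺ A ≡ b + nearly i A * (s i ∸ b)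
        w⁺-collapse A∈P i large = cong (b +_) (∑-collapse i λ j i≢j →
          cong (_* (s j ∸ b)) (nearly-other A∈P i≢j large))

        -- With n elements of `A` in its block, q times the contribution is q (d - 1) - q n + s_i.
        -- This is at least q for n ≤ d - 2, equal to s_i for n = d - 1 and equal to -r_i for n = d.
        -- The weights attain the last two values exactly, hence the shifts by `b` in `w⁺` and `w⁻`.
        contribution : ∀ {A} → A ∈ points → ∀ i → q * meet (𝒮 i) A + w⁺ A ≤ q * D + s i + w⁻ A
        contribution {A} A∈P i with ℕ.<-cmp (suc (meet (𝒮 i) A)) d
        ... | tri< 2+n≤d _ _ = begin
          q * n + w⁺ A          ≤⟨ ℕ.+-monoʳ-≤ (q * n) (w⁺≤q A) ⟩
          q * n + q             ≡⟨ trans (ℕ.+-comm (q * n) q) (sym (ℕ.*-suc q n)) ⟩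
          q * suc n             ≤⟨ ℕ.*-monoʳ-≤ q (ℕ.≤-pred (ℕ.≤-trans 2+n≤d (ℕ.≤-reflexive (sym suc-D)))) ⟩
          q * D                 ≤⟨ ℕ.m≤m+n _ _ ⟩
          q * D + s i           ≤⟨ ℕ.m≤m+n _ _ ⟩
          q * D + s i + w⁻ A    ∎
          where
          open ℕ.≤-Reasoning
          n = meet (𝒮 i) A
        ... | tri≈ _ 1+n≡d _ = begin
          q * n + w⁺ A                  ≡⟨ cong₂ (λ x y → q * x + y) (ℕ.suc-injective (trans 1+n≡d (sym suc-D)))
                                             (w⁺-collapse A∈P i (ℕ.≤-reflexive (sym 1+n≡d))) ⟩
          q * D + (b + nearly i A * (s i ∸ b))
                                        ≡⟨ cong (λ e → q * D + (b + e * (s i ∸ b))) (𝟙-yes (suc n ℕ.≟ d) 1+n≡d) ⟩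
          q * D + (b + 1 * (s i ∸ b))   ≡⟨ cong (λ e → q * D + (b + e)) (ℕ.*-identityˡ _) ⟩
          q * D + (b + (s i ∸ b))       ≡⟨ cong (q * D +_) (ℕ.m+[n∸m]≡n (b≤s i)) ⟩
          q * D + s i                   ≤⟨ ℕ.m≤m+n _ _ ⟩
          q * D + s i + w⁻ A            ∎
          where
          open ℕ.≤-Reasoning
          n = meet (𝒮 i) A
        ... | tri> ¬n<d 1+n≢d d≤n = begin
          q * n + w⁺ A                    ≡⟨ cong₂ (λ x y → q * x + y) n≡d (w⁺-collapse A∈P i (ℕ.<⇒≤ d≤n)) ⟩
          q * d + (b + nearly i A * (s i ∸ b))
                                          ≡⟨ cong (λ e → q * d + (b + e * (s i ∸ b))) (𝟙-no (suc n ℕ.≟ d) 1+n≢d) ⟩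
          q * d + (b + 0)                 ≡⟨ cong (q * d +_) (ℕ.+-identityʳ b) ⟩
          q * d + b                       ≡⟨ q*d b ⟨
          q * D + q + b                   ≡⟨ cong (λ e → q * D + e + b) (s+r i) ⟨
          q * D + (s i + r i) + b
            ≡⟨ solve 4 (λ D s r b → D :+ (s :+ r) :+ b := D :+ s :+ con 1 :* (r :+ b)) refl (q * D) (s i) (r i) b ⟩
          q * D + s i + 1 * (r i + b)     ≡⟨ cong (λ e → q * D + s i + e * (r i + b)) (𝟙-yes (n ℕ.≟ d) n≡d) ⟨
          q * D + s i + contained i A * (r i + b)  ≤⟨ ℕ.+-monoʳ-≤ (q * D + s i) (∈⇒≤∑ (∈.∈-allFin i)) ⟩
          q * D + s i + w⁻ A              ∎
          where
          open ℕ.≤-Reasoning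
          open +-*-Solver
          n = meet (𝒮 i) A
          n≡d : n ≡ d
          n≡d = ℕ.≤-antisym (ℕ.≤-trans (∈⇒≤∑ (∈.∈-allFin i)) (ℕ.≤-reflexive (∑meet A∈P))) (ℕ.≤-pred d≤n)

        W⁺ = ∑ points w⁺
        W⁻ = ∑ points w⁻
        ∑a = ∑ (allFin m) a
        ∑as = ∑ (allFin m) (λ i → a i * s i)
        ∑n⁼ = ∑ (allFin m) n⁼

        -- `contribution` is summed over all blocks. To reach sums over all points, `w⁺` is added on
        -- `R` at a price of q per point, and `w⁻` is extended to `R` on the larger side, where it
        -- only helps.
        total-contribution : q * ∑n⁼ + W⁺ ≤ ∑a * (q * D) + ∑as + W⁻ + length R * q
        total-contribution = begin
          q * ∑n⁼ + W⁺
            ≡⟨ cong₂ _+_ (∑-*ˡ (allFin m) q) ∑points ⟨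
          ∑ (allFin m) (λ i → q * n⁼ i) + (∑ (allFin m) (λ i → ∑ (𝒜 i) w⁺) + ∑ R w⁺)
            ≡⟨ ℕ.+-assoc (∑ (allFin m) (λ i → q * n⁼ i)) _ _ ⟨
          ∑ (allFin m) (λ i → q * n⁼ i) + ∑ (allFin m) (λ i → ∑ (𝒜 i) w⁺) + ∑ R w⁺
            ≡⟨ cong (_+ ∑ R w⁺) (trans (∑-cong (allFin m) λ {i} _ → trans (∑-+ (𝒜 i)) (cong (_+ ∑ (𝒜 i) w⁺) (∑-*ˡ (𝒜 i) q))) (∑-+ (allFin m))) ⟨
          ∑ (allFin m) (λ i → ∑ (𝒜 i) λ A → q * meet (𝒮 i) A + w⁺ A) + ∑ R w⁺
            ≤⟨ ℕ.+-mono-≤ (∑-mono (allFin m) λ {i} _ → ∑-mono (𝒜 i) λ A∈ → contribution (∈-points i A∈) i)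
                          (∑-mono R λ {A} _ → w⁺≤q A) ⟩
          ∑ (allFin m) (λ i → ∑ (𝒜 i) λ A → q * D + s i + w⁻ A) + ∑ R (λ _ → q)
            ≡⟨ cong₂ _+_ (∑-cong (allFin m) λ {i} _ → trans (∑-+ (𝒜 i)) (cong (_+ ∑ (𝒜 i) w⁻) (∑-const (𝒜 i) (q * D + s i)))) (∑-const R q) ⟩
          ∑ (allFin m) (λ i → a i * (q * D + s i) + ∑ (𝒜 i) w⁻) + length R * q
            ≡⟨ cong (_+ length R * q) (trans (∑-cong (allFin m) λ {i} _ → cong (_+ ∑ (𝒜 i) w⁻) (ℕ.*-distribˡ-+ (a i) (q * D) (s i)))
                 (trans (∑-+ (allFin m)) (cong (_+ ∑ (allFin m) (λ i → ∑ (𝒜 i) w⁻)) (trans (∑-+ (allFin m)) (cong (_+ ∑as) (∑-*ʳ (allFin m) (q * D))))))) ⟩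
          ∑a * (q * D) + ∑as + ∑ (allFin m) (λ i → ∑ (𝒜 i) w⁻) + length R * q
            ≤⟨ ℕ.+-monoˡ-≤ (length R * q) (ℕ.+-monoʳ-≤ (∑a * (q * D) + ∑as)
                 (ℕ.≤-trans (ℕ.m≤m+n _ (∑ R w⁻)) (ℕ.≤-reflexive ∑points))) ⟩
          ∑a * (q * D) + ∑as + W⁻ + length R * q ∎
          where open ℕ.≤-Reasoning

        M G : Fin m → ℕ
        M j = ∑ points (contained j)
        G j = ∑ points (nearly j)

        W⁺≡ : W⁺ ≡ N * b + ∑ (allFin m) (λ j → G j * (s j ∸ b))
        W⁺≡ = trans (∑-+ points) (cong₂ _+_ (∑-const points b)
          (trans (∑-comm points (allFin m)) (∑-cong (allFin m) λ _ → ∑-*ʳ points _)))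

        W⁻≡ : W⁻ ≡ ∑ (allFin m) (λ j → M j * (r j + b))
        W⁻≡ = trans (∑-comm points (allFin m)) (∑-cong (allFin m) λ _ → ∑-*ʳ points _)

        -- The blocks contain d elements of A altogether, and 2 (d − 1) > d.
        one-block : ∀ {A} → A ∈ points → ∑ (allFin m) (λ j → nearly j A + contained j A) ≤ 1
        one-block {A} A∈P = ℕ.≤-pred (ℕ.*-cancelʳ-< D (∑ (allFin m) (λ j → nearly j A + contained j A)) 2 (begin-strict
          ∑ (allFin m) (λ j → nearly j A + contained j A) * D     ≡⟨ ∑-*ʳ (allFin m) D ⟨
          ∑ (allFin m) (λ j → (nearly j A + contained j A) * D)   ≤⟨ ∑-mono (allFin m) (λ {j} _ → one j) ⟩
          ∑ (allFin m) (λ j → meet (𝒮 j) A)                       ≡⟨ ∑meet A∈P ⟩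
          d                                                       ≡⟨ suc-D ⟨
          1 + D
            <⟨ ℕ.+-monoˡ-< D (ℕ.≤-pred (ℕ.≤-trans 3≤d (ℕ.≤-reflexive (sym suc-D)))) ⟩
          D + D                                                   ≡⟨ cong (D +_) (ℕ.+-identityʳ D) ⟨
          2 * D                                                   ∎))
          where
          open ℕ.≤-Reasoning
          one : ∀ j → (nearly j A + contained j A) * D ≤ meet (𝒮 j) A
          one j with suc (meet (𝒮 j) A) ℕ.≟ d | meet (𝒮 j) A ℕ.≟ d
          ... | yes p | yes p′ = contradiction (trans p (sym p′)) ℕ.1+n≢n
          ... | yes p | no _   = ℕ.≤-reflexive (trans (ℕ.*-identityˡ D) (ℕ.suc-injective (trans suc-D (sym p))))
          ... | no _  | yes p′ = ℕ.≤-trans (ℕ.≤-reflexive (ℕ.*-identityˡ D)) (ℕ.≤-trans (ℕ.m∸n≤m d 1) (ℕ.≤-reflexive (sym p′)))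
          ... | no _  | no _   = z≤n

        G+M≤N : ∑ (allFin m) (λ j → G j + M j) ≤ N
        G+M≤N = begin
          ∑ (allFin m) (λ j → G j + M j)                               ≡⟨ ∑-cong (allFin m) (λ _ → ∑-+ points) ⟨
          ∑ (allFin m) (λ j → ∑ points λ A → nearly j A + contained j A) ≡⟨ ∑-comm (allFin m) points ⟩
          ∑ points (λ A → ∑ (allFin m) λ j → nearly j A + contained j A) ≤⟨ ∑-mono points one-block ⟩
          ∑ points (λ _ → 1)                                           ≡⟨ length≡∑ points ⟨
          N                                                            ∎
          where open ℕ.≤-Reasoning

        -- Shifting s_j and r_j by `b` costs 2 q b (G_j + M_j) in block j, and `weight-inequality`
        -- gives b² (G_j + M_j) back; this is the net cost per point.
        excess : ℕ
        excess = 2 * q * b ∸ b * b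

        excess+ : b * b + excess ≡ 2 * q * b
        excess+ = ℕ.m+[n∸m]≡n (ℕ.*-monoˡ-≤ b (ℕ.≤-trans (ℕ.m≤m+n b (b + 0)) (ℕ.≤-trans 2b≤q (ℕ.m≤m+n q (q + 0)))))

        block-inequality : ∀ j → 2 * q * (M j * (r j + b)) ≤ 2 * q * (G j * (s j ∸ b)) + excess * (G j + M j)
        block-inequality j = ℕ.+-cancelˡ-≤ (b * b * (G j + M j)) _ _ (begin
          b * b * (G j + M j) + 2 * q * (M j * (r j + b))
            ≡⟨ solve 5 (λ b G M q r → b :* b :* (G :+ M) :+ con 2 :* q :* (M :* (r :+ b))
                  := (con 2 :* q :* (r :* M) :+ b :* b :* (G :+ M)) :+ con 2 :* q :* b :* M)
                       refl b (G j) (M j) q (r j) ⟩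
          (2 * q * (r j * M j) + b * b * (G j + M j)) + 2 * q * b * M j
            ≤⟨ ℕ.+-monoˡ-≤ (2 * q * b * M j) (weight-inequality (M j) (G j) 3≤d (ℕ.≤-trans 3≤b (b≤r j)) (b≤r j) (b≤s j) 2b≤q (Block.mono-bound j)) ⟩
          2 * q * (s j * G j) + 2 * q * b * M j
            ≡⟨ cong (λ e → 2 * q * (e * G j) + 2 * q * b * M j) (ℕ.m∸n+n≡m (b≤s j)) ⟨
          2 * q * ((s j ∸ b + b) * G j) + 2 * q * b * M j
            ≡⟨ solve 5 (λ b G M q s′ → con 2 :* q :* ((s′ :+ b) :* G) :+ con 2 :* q :* b :* M
                  := con 2 :* q :* b :* (G :+ M) :+ con 2 :* q :* (G :* s′)) refl b (G j) (M j) q (s j ∸ b) ⟩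
          2 * q * b * (G j + M j) + 2 * q * (G j * (s j ∸ b))
            ≡⟨ cong (λ e → e * (G j + M j) + 2 * q * (G j * (s j ∸ b))) excess+ ⟨
          (b * b + excess) * (G j + M j) + 2 * q * (G j * (s j ∸ b))
            ≡⟨ solve 4 (λ b² e u v → (b² :+ e) :* u :+ v := b² :* u :+ (v :+ e :* u))
                 refl (b * b) excess (G j + M j) (2 * q * (G j * (s j ∸ b))) ⟩
          b * b * (G j + M j) + (2 * q * (G j * (s j ∸ b)) + excess * (G j + M j)) ∎)
          where
          open ℕ.≤-Reasoning
          open +-*-Solver

        -- By `G+M≤N` the net costs of all blocks add up to at most `excess * N`, whereas the
        -- constant part `b` of `w⁺` earns 2 q b N. What is left is b² N.
        W-inequality : N * (b * b) + 2 * q * W⁻ ≤ 2 * q * W⁺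
        W-inequality = begin
          N * (b * b) + 2 * q * W⁻
            ≡⟨ cong (N * (b * b) +_) (trans (cong (2 * q *_) W⁻≡) (sym (∑-*ˡ (allFin m) (2 * q)))) ⟩
          N * (b * b) + ∑ (allFin m) (λ j → 2 * q * (M j * (r j + b)))
            ≤⟨ ℕ.+-monoʳ-≤ (N * (b * b)) (∑-mono (allFin m) λ {j} _ → block-inequality j) ⟩
          N * (b * b) + ∑ (allFin m) (λ j → 2 * q * (G j * (s j ∸ b)) + excess * (G j + M j))
            ≡⟨ cong (N * (b * b) +_) (trans (∑-+ (allFin m)) (cong₂ _+_ (∑-*ˡ (allFin m) (2 * q)) (∑-*ˡ (allFin m) excess))) ⟩
          N * (b * b) + (2 * q * V + excess * ∑ (allFin m) (λ j → G j + M j))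
            ≤⟨ ℕ.+-monoʳ-≤ (N * (b * b)) (ℕ.+-monoʳ-≤ (2 * q * V) (ℕ.*-monoʳ-≤ excess G+M≤N)) ⟩
          N * (b * b) + (2 * q * V + excess * N)
            ≡⟨ solve 4 (λ N b² v e → N :* b² :+ (v :+ e :* N) := N :* (b² :+ e) :+ v)
                 refl N (b * b) (2 * q * V) excess ⟩
          N * (b * b + excess) + 2 * q * V
            ≡⟨ cong (λ e → N * e + 2 * q * V) excess+ ⟩
          N * (2 * q * b) + 2 * q * V
            ≡⟨ solve 4 (λ N q b v → N :* (con 2 :* q :* b) :+ con 2 :* q :* v := con 2 :* q :* (N :* b :+ v))
                 refl N q b V ⟩
          2 * q * (N * b + V)
            ≡⟨ cong (2 * q *_) W⁺≡ ⟨
          2 * q * W⁺ ∎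
          where
          open ℕ.≤-Reasoning
          open +-*-Solver
          V = ∑ (allFin m) (λ j → G j * (s j ∸ b))

      -- The hypotheses characterise `X` and `Y` as the sums over i ≠ j of the incidences and of the
      -- products |A_i| |S_j|. The conclusion is X - Y / q ≥ N b² / (2 q²) - |R| with denominators
      -- cleared.
      off-diagonal-bound : ∀ {X Y} →
        X + ∑ (allFin m) (λ i → ∑ (𝒜 i) (meet (𝒮 i))) ≡ d * ∑ (allFin m) (λ i → length (𝒜 i)) →
        Y + ∑ (allFin m) (λ i → length (𝒜 i) * length (𝒮 i)) ≡ q * ∑ (allFin m) (λ i → length (𝒜 i)) →
        N * (b * b) + 2 * q * Y ≤ 2 * q * (q * X + q * length R)
      off-diagonal-bound {X} {Y} X≡ Y≡ = ℕ.+-cancelʳ-≤ (2 * q * W⁻) _ _ (begin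
        N * (b * b) + 2 * q * Y + 2 * q * W⁻
          ≡⟨ solve 3 (λ x y z → x :+ y :+ z := (x :+ z) :+ y) refl (N * (b * b)) (2 * q * Y) (2 * q * W⁻) ⟩
        N * (b * b) + 2 * q * W⁻ + 2 * q * Y
          ≤⟨ ℕ.+-monoˡ-≤ (2 * q * Y) W-inequality ⟩
        2 * q * W⁺ + 2 * q * Y
          ≡⟨ ℕ.*-distribˡ-+ (2 * q) W⁺ Y ⟨
        2 * q * (W⁺ + Y)
          ≤⟨ ℕ.*-monoʳ-≤ (2 * q) W⁺+Y≤ ⟩
        2 * q * (q * X + W⁻ + q * length R)
          ≡⟨ solve 4 (λ p x w l → p :* (x :+ w :+ l) := p :* (x :+ l) :+ p :* w)
               refl (2 * q) (q * X) W⁻ (q * length R) ⟩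
        2 * q * (q * X + q * length R) + 2 * q * W⁻ ∎)
        where
        open ℕ.≤-Reasoning
        open +-*-Solver
        W⁺+Y≤ : W⁺ + Y ≤ q * X + W⁻ + q * length R
        W⁺+Y≤ = ℕ.+-cancelˡ-≤ (q * ∑n⁼ + ∑as) _ _ (begin
          q * ∑n⁼ + ∑as + (W⁺ + Y)
            ≡⟨ solve 4 (λ x y z t → x :+ y :+ (z :+ t) := (x :+ z) :+ (t :+ y)) refl (q * ∑n⁼) ∑as W⁺ Y ⟩
          (q * ∑n⁼ + W⁺) + (Y + ∑as)
            ≤⟨ ℕ.+-monoˡ-≤ (Y + ∑as) total-contribution ⟩
          ∑a * (q * D) + ∑as + W⁻ + length R * q + (Y + ∑as)
            ≡⟨ cong (∑a * (q * D) + ∑as + W⁻ + length R * q +_) Y≡ ⟩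
          ∑a * (q * D) + ∑as + W⁻ + length R * q + q * ∑a
            ≡⟨ solve 6 (λ a q D y w l → a :* (q :* D) :+ y :+ w :+ l :* q :+ q :* a
                  := q :* ((con 1 :+ D) :* a) :+ y :+ w :+ q :* l) refl ∑a q D ∑as W⁻ (length R) ⟩
          q * (suc D * ∑a) + ∑as + W⁻ + q * length R
            ≡⟨ cong (λ e → q * (e * ∑a) + ∑as + W⁻ + q * length R) suc-D ⟩
          q * (d * ∑a) + ∑as + W⁻ + q * length R
            ≡⟨ cong (λ e → q * e + ∑as + W⁻ + q * length R) X≡ ⟨
          q * (X + ∑n⁼) + ∑as + W⁻ + q * length R
            ≡⟨ solve 6 (λ q x n y w l → q :* (x :+ n) :+ y :+ w :+ q :* l := q :* n :+ y :+ (q :* x :+ w :+ q :* l))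
                 refl q X ∑n⁼ ∑as W⁻ (length R) ⟩
          q * ∑n⁼ + ∑as + (q * X + W⁻ + q * length R) ∎)

    -- Enlarging A_i to the set of all points only adds incidences, and then `degree-bound` applies
    -- to the block of objects.
    block-incidences : ∀ i → (q ∸ 1) * ∑ (𝒜 i) (meet (𝒮 i)) ≤ d * length (𝒮 i) * N
    block-incidences i = ℕ.≤-trans (ℕ.*-monoʳ-≤ (q ∸ 1) (begin
      ∑ (𝒜 i) (meet (𝒮 i))                                 ≤⟨ ∈⇒≤∑ (∈.∈-allFin i) {λ k → ∑ (𝒜 k) (meet (𝒮 i))} ⟩
      ∑ (allFin m) (λ k → ∑ (𝒜 k) (meet (𝒮 i)))            ≤⟨ ℕ.m≤m+n _ (∑ R (meet (𝒮 i))) ⟩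
      ∑ (allFin m) (λ k → ∑ (𝒜 k) (meet (𝒮 i))) + ∑ R (meet (𝒮 i)) ≡⟨ ∑points ⟩
      ∑ points (meet (𝒮 i))                                ∎)) (Block.degree-bound i)
      where open ℕ.≤-Reasoning

-- Rational estimates behind the constants.

module RationalArithmetic where

  open FiniteSums
  import Data.Integer.Base as ℤ
  import Data.Integer.Properties as ℤ
  open import Data.Nat.Base as ℕ using (ℕ; suc)
  import Data.Nat.Properties as ℕ
  open import Data.Rational.Base as ℚ
    using (ℚ; 0ℚ; 1ℚ; ½; _/_; _+_; _*_; _-_; -_; _≤_; _<_; fromℚᵘ)
  import Data.Rational.Properties as ℚ
  open import Data.Rational.Solver using (module +-*-Solver)
  import Data.Rational.Unnormalised.Base as ℚᵘ
  import Data.Rational.Unnormalised.Properties as ℚᵘ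
  open import Relation.Binary.PropositionalEquality hiding (J)

  fromℚᵘ-homo-+ : ∀ x y → fromℚᵘ x + fromℚᵘ y ≡ fromℚᵘ (x ℚᵘ.+ y)
  fromℚᵘ-homo-+ x y = ℚ.toℚᵘ-injective (ℚᵘ.≃-trans (ℚ.toℚᵘ-homo-+ (fromℚᵘ x) (fromℚᵘ y))
    (ℚᵘ.≃-trans (ℚᵘ.+-cong (ℚ.toℚᵘ-fromℚᵘ x) (ℚ.toℚᵘ-fromℚᵘ y)) (ℚᵘ.≃-sym (ℚ.toℚᵘ-fromℚᵘ (x ℚᵘ.+ y)))))

  fromℚᵘ-homo-* : ∀ x y → fromℚᵘ x * fromℚᵘ y ≡ fromℚᵘ (x ℚᵘ.* y)
  fromℚᵘ-homo-* x y = ℚ.toℚᵘ-injective (ℚᵘ.≃-trans (ℚ.toℚᵘ-homo-* (fromℚᵘ x) (fromℚᵘ y))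
    (ℚᵘ.≃-trans (ℚᵘ.*-cong (ℚ.toℚᵘ-fromℚᵘ x) (ℚ.toℚᵘ-fromℚᵘ y)) (ℚᵘ.≃-sym (ℚ.toℚᵘ-fromℚᵘ (x ℚᵘ.* y)))))

  toℚ : ℕ → ℚ
  toℚ n = ℤ.+ n / 1

  toℚ-+ : ∀ m n → toℚ (m ℕ.+ n) ≡ toℚ m + toℚ n
  toℚ-+ m n = sym (trans (fromℚᵘ-homo-+ (ℚᵘ.mkℚᵘ (ℤ.+ m) 0) (ℚᵘ.mkℚᵘ (ℤ.+ n) 0))
    (cong (_/ 1) (cong₂ ℤ._+_ (ℤ.*-identityʳ (ℤ.+ m)) (ℤ.*-identityʳ (ℤ.+ n)))))

  toℚ-* : ∀ m n → toℚ (m ℕ.* n) ≡ toℚ m * toℚ n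
  toℚ-* m n = sym (trans (fromℚᵘ-homo-* (ℚᵘ.mkℚᵘ (ℤ.+ m) 0) (ℚᵘ.mkℚᵘ (ℤ.+ n) 0)) (cong (_/ 1) (sym (ℤ.pos-* m n))))

  toℚ-mono : ∀ {m n} → m ℕ.≤ n → toℚ m ≤ toℚ n
  toℚ-mono {m} {n} m≤n = ℚ.toℚᵘ-cancel-≤
    (ℚᵘ.≤-respʳ-≃ (ℚᵘ.≃-sym (ℚ.toℚᵘ-fromℚᵘ (ℚᵘ.mkℚᵘ (ℤ.+ n) 0)))
      (ℚᵘ.≤-respˡ-≃ (ℚᵘ.≃-sym (ℚ.toℚᵘ-fromℚᵘ (ℚᵘ.mkℚᵘ (ℤ.+ m) 0)))
        (ℚᵘ.*≤* (ℤ.*-monoʳ-≤-nonNeg (ℤ.+ 1) (ℤ.+≤+ m≤n)))))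

  toℚ-cancel : ∀ {m n} → toℚ m ≤ toℚ n → m ℕ.≤ n
  toℚ-cancel {m} {n} le = ℤ.drop‿+≤+ (subst₂ ℤ._≤_ (ℤ.*-identityʳ (ℤ.+ m)) (ℤ.*-identityʳ (ℤ.+ n)) (ℚᵘ.drop-*≤*
    (ℚᵘ.≤-respʳ-≃ (ℚ.toℚᵘ-fromℚᵘ (ℚᵘ.mkℚᵘ (ℤ.+ n) 0)) (ℚᵘ.≤-respˡ-≃ (ℚ.toℚᵘ-fromℚᵘ (ℚᵘ.mkℚᵘ (ℤ.+ m) 0)) (ℚ.toℚᵘ-mono-≤ le)))))

  0≤toℚ : ∀ n → 0ℚ ≤ toℚ n
  0≤toℚ n = toℚ-mono {0} {n} ℕ.z≤n

  /-*-cancel : ∀ n m .{{_ : ℕ.NonZero m}} → (ℤ.+ n / m) * toℚ m ≡ toℚ n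
  /-*-cancel n m@(suc m-1) = trans (fromℚᵘ-homo-* (ℚᵘ.mkℚᵘ (ℤ.+ n) m-1) (ℚᵘ.mkℚᵘ (ℤ.+ m) 0))
    (ℚ.fromℚᵘ-cong {ℚᵘ.mkℚᵘ (ℤ.+ n) m-1 ℚᵘ.* ℚᵘ.mkℚᵘ (ℤ.+ m) 0} {ℚᵘ.mkℚᵘ (ℤ.+ n) 0} (ℚᵘ.*≡* (trans (ℤ.*-identityʳ _)
      (cong (λ k → ℤ.+ n ℤ.* ℤ.+ k) (sym (ℕ.*-identityʳ m))))))

  nonNeg-+ : ∀ {x y} → 0ℚ ≤ x → 0ℚ ≤ y → 0ℚ ≤ x + y
  nonNeg-+ = ℚ.+-mono-≤

  nonNeg-* : ∀ {x y} → 0ℚ ≤ x → 0ℚ ≤ y → 0ℚ ≤ x * y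
  nonNeg-* {x} {y} 0≤x 0≤y = ℚ.nonNegative⁻¹ (x * y)
    {{ℚ.nonNeg*nonNeg⇒nonNeg x {{ℚ.nonNegative 0≤x}} y {{ℚ.nonNegative 0≤y}}}}

  pos-* : ∀ {x y} → 0ℚ < x → 0ℚ < y → 0ℚ < x * y
  pos-* {x} {y} 0<x 0<y = ℚ.positive⁻¹ (x * y)
    {{ℚ.pos*pos⇒pos x {{ℚ.positive 0<x}} y {{ℚ.positive 0<y}}}}

  0≤y-x : ∀ {x y} → x ≤ y → 0ℚ ≤ y - x
  0≤y-x {x} {y} x≤y = subst (_≤ y - x) (ℚ.+-inverseʳ x) (ℚ.+-monoˡ-≤ (- x) x≤y)

  ≤-from-difference : ∀ {x y e} → 0ℚ ≤ e → y - x ≡ e → x ≤ y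
  ≤-from-difference {x} {y} {e} 0≤e eq = subst₂ _≤_ (ℚ.+-identityˡ x) (solve 2 (λ x y → y :- x :+ x := y) refl x y)
    (ℚ.+-monoˡ-≤ x (subst (0ℚ ≤_) (sym eq) 0≤e))
    where open +-*-Solver

  *-cancel-≤ : ∀ {k x y} → 0ℚ < k → k * x ≤ k * y → x ≤ y
  *-cancel-≤ {k} 0<k = ℚ.*-cancelˡ-≤-pos k {{ℚ.positive 0<k}}

  -- Here and below, the difference of the two sides is exhibited as a sum of
  -- products of nonnegative terms.

  block-size-bound : ∀ {t D Q N b d I δ} → 0ℚ < N → 1ℚ ≤ D * N → toℚ 3 ≤ Q → 0ℚ ≤ t →
    toℚ 4 * δ ≤ t → t * (D * N) ≤ I + δ → (Q - 1ℚ) * I ≤ d * b * N →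
    t * D * Q ≤ toℚ 2 * d * b
  block-size-bound {t} {D} {Q} {N} {b} {d} {I} {δ} 0<N 1≤DN 3≤Q 0≤t 4δ≤t tDN≤I+δ QI≤dbN =
    -- Since D N ≥ 1 and 4 δ ≤ t, the error removes at most a quarter of t D N, so (3/4) t D (Q - 1)
    -- ≤ d b. Then 3 (Q - 1) ≥ 2 Q, valid for Q ≥ 3, replaces Q - 1 by Q at the cost of the factor
    -- 2.
    *-cancel-≤ 0<N (≤-from-difference
      (nonNeg-+ (nonNeg-+ (nonNeg-+ (nonNeg-* (0≤toℚ 2) (0≤y-x QI≤dbN))
          (nonNeg-* (nonNeg-* (0≤toℚ 2) Q-1≥0) (0≤y-x tDN≤I+δ)))
          (nonNeg-* (nonNeg-* (ℚ.nonNegative⁻¹ ½) Q-1≥0) (0≤y-x 4δ≤t)))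
        (nonNeg-+ (nonNeg-* (nonNeg-* Q-2≥0 0≤t) (0≤y-x 1≤DN)) (nonNeg-* (nonNeg-* (ℚ.nonNegative⁻¹ ½) (0≤y-x 3≤Q)) 0≤t)))
      (solve 8 (λ t D Q N b d I δ → N :* (con (toℚ 2) :* d :* b) :- N :* (t :* D :* Q)
         := con (toℚ 2) :* (d :* b :* N :- (Q :- con 1ℚ) :* I) :+ con (toℚ 2) :* (Q :- con 1ℚ) :* (I :+ δ :- t :* (D :* N))
            :+ con ½ :* (Q :- con 1ℚ) :* (t :- con (toℚ 4) :* δ)
            :+ ((Q :- con (toℚ 2)) :* t :* (D :* N :- con 1ℚ) :+ con ½ :* (Q :- con (toℚ 3)) :* t))
                 refl t D Q N b d I δ))
    where
    open +-*-Solver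
    Q-1≥0 : 0ℚ ≤ Q - 1ℚ
    Q-1≥0 = 0≤y-x (ℚ.≤-trans (toℚ-mono {1} {3} (ℕ.s≤s ℕ.z≤n)) 3≤Q)
    Q-2≥0 : 0ℚ ≤ Q - toℚ 2
    Q-2≥0 = 0≤y-x (ℚ.≤-trans (toℚ-mono {2} {3} (ℕ.s≤s (ℕ.s≤s ℕ.z≤n))) 3≤Q)

  -- The lower bound for b turns N b² / (2 Q²) into 4 c t² (D N), where D N is Σ. The loss satisfies
  -- R ≤ D R ≤ c t² (D N) + δ, so more than the required multiple remains.
  off-diagonal-estimate : ∀ {t c D Q N b d R O X y δ} →
    0ℚ < Q → 0ℚ < d → 1ℚ ≤ D → 0ℚ ≤ R → 0ℚ ≤ t → 0ℚ ≤ c → 0ℚ ≤ b → 0ℚ ≤ N →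
    toℚ 32 * (d * d) * c ≡ D → t * D * Q ≤ toℚ 2 * d * b →
    N * (b * b) + toℚ 2 * Q * (y * Q) ≤ toℚ 2 * Q * (Q * X + Q * R) → X - y ≤ O →
    D * R ≤ c * (t * t) * (D * N) + δ →
    toℚ 2 * c * (t * t) * (D * N) ≤ O + δ
  off-diagonal-estimate {t} {c} {D} {Q} {N} {b} {d} {R} {O} {X} {y} {δ}
    0<Q 0<d 1≤D 0≤R 0≤t 0≤c 0≤b 0≤N refl tDQ≤2db NbbY X-y≤O DR≤ =
    ≤-from-difference
      (nonNeg-+ (nonNeg-+ (0≤y-x four) (0≤y-x DR≤)) (nonNeg-+ (nonNeg-* (0≤y-x 1≤D) 0≤R) e≥0))
      (solve 7 (λ c t D N O R δ → O :+ δ :- con (toℚ 2) :* c :* (t :* t) :* (D :* N)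
         := (O :+ R :- con (toℚ 4) :* (c :* (t :* t) :* (D :* N))) :+ (c :* (t :* t) :* (D :* N) :+ δ :- D :* R)
            :+ ((D :- con 1ℚ) :* R :+ c :* (t :* t) :* (D :* N))) refl c t D N O R δ)
    where
    open +-*-Solver
    0≤Q = ℚ.<⇒≤ 0<Q
    0≤d = ℚ.<⇒≤ 0<d
    D≥0 : 0ℚ ≤ D
    D≥0 = nonNeg-* (nonNeg-* (0≤toℚ 32) (nonNeg-* 0≤d 0≤d)) 0≤c
    e≥0 : 0ℚ ≤ c * (t * t) * (D * N)
    e≥0 = nonNeg-* (nonNeg-* 0≤c (nonNeg-* 0≤t 0≤t)) (nonNeg-* D≥0 0≤N)
    Nbb : N * (b * b) ≤ toℚ 2 * (Q * Q) * (O + R)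
    Nbb = ≤-from-difference (nonNeg-+ (0≤y-x NbbY) (nonNeg-* (nonNeg-* (0≤toℚ 2) (nonNeg-* 0≤Q 0≤Q)) (0≤y-x X-y≤O)))
      (solve 7 (λ Q N b O R X y → con (toℚ 2) :* (Q :* Q) :* (O :+ R) :- N :* (b :* b)
         := (con (toℚ 2) :* Q :* (Q :* X :+ Q :* R) :- (N :* (b :* b) :+ con (toℚ 2) :* Q :* (y :* Q)))
            :+ con (toℚ 2) :* (Q :* Q) :* (O :- (X :- y))) refl Q N b O R X y)
    -- After multiplication by 8 d² Q² the two sides become multiples of (2 d b)² and (t D Q)² by D
    -- = 32 d² c; the difference of squares is factored to use `tDQ≤2db`.
    four : toℚ 4 * (c * (t * t) * (D * N)) ≤ O + R
    four = *-cancel-≤ (pos-* (pos-* (ℚ.positive⁻¹ (toℚ 8)) (pos-* 0<d 0<d)) (pos-* 0<Q 0<Q)) (≤-from-difference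
      (nonNeg-+ (nonNeg-* (nonNeg-* (0≤toℚ 4) (nonNeg-* 0≤d 0≤d)) (0≤y-x Nbb))
        (nonNeg-* 0≤N (nonNeg-* (nonNeg-+ (nonNeg-* (nonNeg-* (0≤toℚ 2) 0≤d) 0≤b) (nonNeg-* (nonNeg-* 0≤t D≥0) 0≤Q)) (0≤y-x tDQ≤2db))))
      (solve 8 (λ t c d N Q O R b →
         let D = con (toℚ 32) :* (d :* d) :* c in
         con (toℚ 8) :* (d :* d) :* (Q :* Q) :* (O :+ R) :- con (toℚ 8) :* (d :* d) :* (Q :* Q) :* (con (toℚ 4) :* (c :* (t :* t) :* (D :* N)))
         := con (toℚ 4) :* (d :* d) :* (con (toℚ 2) :* (Q :* Q) :* (O :+ R) :- N :* (b :* b))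
            :+ N :* ((con (toℚ 2) :* d :* b :+ t :* D :* Q) :* (con (toℚ 2) :* d :* b :- t :* D :* Q)))
                 refl t c d N Q O R b))

-- Subsets of a finite field as an exchange system.

module FieldSubsets where

  open FiniteSums
  open SwapSystems
  open import Algebra.Bundles using (CommutativeRing)
  import Algebra.Properties.Group as GroupProperties
  open import Data.Bool.Base using (true; false)
  open import Data.Fin.Base using (Fin)
  import Data.Fin.Properties as Fin
  open import Data.Fin.Subset using (Subset; ∣_∣; inside; outside) renaming (_∈_ to _∈ₛ_)
  open import Data.Fin.Subset.Properties using (drop-there) renaming (_∈?_ to _∈ₛ?_)
  open import Data.List.Base using (List; []; _∷_; map; filter; length; foldr; tabulate)
  open import Data.List.Membership.Propositional using (_∈_)
  import Data.List.Membership.Propositional.Properties as ∈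
  open import Data.List.Relation.Binary.Permutation.Propositional using (_↭_; ↭⇒↭ₛ)
  import Data.List.Relation.Binary.Permutation.Propositional.Properties as ↭
  import Data.List.Relation.Binary.Permutation.Setoid.Properties as ↭ₛ
  open import Data.List.Relation.Unary.All as All using (All; []; _∷_)
  import Data.List.Relation.Unary.All.Properties as All
  open import Data.List.Relation.Unary.Any using (here; there)
  open import Data.List.Relation.Unary.AllPairs using ([]; _∷_)
  open import Data.List.Relation.Unary.Unique.Propositional using (Unique)
  import Data.List.Relation.Unary.Unique.Propositional.Properties as Unique
  import Data.List.Properties as List
  open import Data.Nat.Base as ℕ using (ℕ; zero; suc; z≤n; s≤s)
  import Data.Nat.Properties as ℕ
  open import Data.Product.Base using (_×_; _,_; proj₁; proj₂)
  open import Data.Vec.Base as Vec using (Vec; []; _∷_; lookup; _[_]≔_)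
  import Data.Vec.Properties as Vec
  import Data.Vec.Relation.Binary.Pointwise.Extensional as Ext
  import Data.Vec.Relation.Binary.Pointwise.Inductive as Ind
  open import Function.Bundles using (module Inverse)
  open import Function.Base using (_∘_)
  open import Relation.Binary.PropositionalEquality hiding (J)
  open import Relation.Nullary.Decidable using (Dec; yes; no; ¬?; _×-dec_)
  open import Relation.Nullary.Negation using (¬_; contradiction)

  module _ {X Y : Set} {f : X → Y} where

    Unique-map-injective : ∀ {xs} → (∀ {x y} → x ∈ xs → y ∈ xs → f x ≡ f y → x ≡ y) →
                           Unique xs → Unique (map f xs)
    Unique-map-injective {[]}     inj []          = []
    Unique-map-injective {x ∷ xs} inj (x∉ ∷ xs!) =
      All.map⁺ (All.tabulate λ y∈ fx≡fy → All.lookup x∉ y∈ (inj (here refl) (there y∈) fx≡fy))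
      ∷ Unique-map-injective (λ x∈ y∈ → inj (there x∈) (there y∈)) xs!

  lookup-≗⇒≡ : ∀ {X : Set} {n} {u v : Vec X n} → (∀ i → lookup u i ≡ lookup v i) → u ≡ v
  lookup-≗⇒≡ eq = Ind.Pointwise-≡⇒≡ (Ext.extensional⇒inductive (Ext.ext eq))

  -- The predicate is tied to `A` only through `f`, so that the induction can pass from `f` to its
  -- shift.
  ∣∣≡length-filter : ∀ {n} (A : Subset n) {X : Set} {P : X → Set} (P? : ∀ x → Dec (P x)) (f : Fin n → X) →
    (∀ i → P (f i) → i ∈ₛ A) → (∀ i → i ∈ₛ A → P (f i)) → length (filter P? (tabulate f)) ≡ ∣ A ∣
  ∣∣≡length-filter [] P? f to from = refl
  ∣∣≡length-filter (x ∷ A) P? f to from with P? (f Fin.zero) | x | ∣∣≡length-filter A P? (f ∘ Fin.suc)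
    (λ i → drop-there ∘ to (Fin.suc i)) (λ i → from (Fin.suc i) ∘ Vec.there) | to Fin.zero | from Fin.zero
  ... | yes _ | true  | ih | _   | _     = cong suc ih
  ... | no ¬p | true  | ih | _   | from₀ = contradiction (from₀ Vec.here) ¬p
  ... | yes p | false | ih | to₀ | _     = contradiction (to₀ p) λ ()
  ... | no _  | false | ih | _   | _     = ih

  allVecs-complete : ∀ {X : Set} {xs : List X} → (∀ x → x ∈ xs) → ∀ {n} (v : Vec X n) → v ∈ allVecs xs n
  allVecs-complete all []      = here refl
  allVecs-complete all (x ∷ v) = ∈.∈-cartesianProductWith⁺ _∷_ (all x) (allVecs-complete all v)

  module FieldProperties {q} (F : FiniteField q) where
    open FiniteField F public
    open CommutativeRing commutativeRing public
      using (+-assoc; +-comm; +-identityˡ; +-identityʳ; -‿inverseˡ; -‿inverseʳ; +-isCommutativeMonoid; +-group)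
    open GroupProperties +-group public using () renaming (∙-cancelˡ to +-cancelˡ; ∙-cancelʳ to +-cancelʳ)

    element-index : ∀ x → element (index x) ≡ x
    element-index x = Inverse.inverseˡ enumeration refl

    index-element : ∀ i → index (element i) ≡ i
    index-element i = Inverse.inverseʳ enumeration refl

    index-injective : ∀ {x y} → index x ≡ index y → x ≡ y
    index-injective {x} {y} eq = trans (sym (element-index x)) (trans (cong element eq) (element-index y))

    elements-complete : ∀ x → x ∈ elements
    elements-complete x = subst (_∈ elements) (element-index x) (∈.∈-tabulate⁺ (index x))

    length-elements : length elements ≡ q
    length-elements = List.length-tabulate element

    infix 4 _∋_ _∋?_
    _∋_ : Subset q → Carrier → Set
    A ∋ t = index t ∈ₛ A

    _∋?_ : ∀ A t → Dec (A ∋ t)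
    A ∋? t = index t ∈ₛ? A

    ∈-members⁺ : ∀ {A t} → A ∋ t → t ∈ members F A
    ∈-members⁺ {A} {t} = ∈.∈-filter⁺ (A ∋?_) (elements-complete t)

    ∈-members⁻ : ∀ {A t} → t ∈ members F A → A ∋ t
    ∈-members⁻ {A} = proj₂ ∘ ∈.∈-filter⁻ (A ∋?_) {xs = elements}

    members-unique : ∀ A → Unique (members F A)
    members-unique A = Unique.filter⁺ (A ∋?_) elements-unique

    length-members : ∀ A → length (members F A) ≡ ∣ A ∣
    length-members A = ∣∣≡length-filter A (A ∋?_) element
      (λ i → subst (_∈ₛ A) (index-element i)) (λ i → subst (_∈ₛ A) (sym (index-element i)))

    foldr-+-↭ : ∀ {xs ys} → xs ↭ ys → foldr _+_ 0# xs ≡ foldr _+_ 0# ys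
    foldr-+-↭ = ↭ₛ.foldr-commMonoid (setoid Carrier) +-isCommutativeMonoid ∘ ↭⇒↭ₛ

    swap : Subset q → Carrier → Carrier → Subset q
    swap A a t = A [ index a ]≔ outside [ index t ]≔ inside

    module _ {A a t} (A∋a : A ∋ a) (A∌t : ¬ A ∋ t) where

      private
        a≢t : index a ≢ index t
        a≢t eq = A∌t (subst (_∈ₛ A) eq A∋a)

      lookup-swap-new : lookup (swap A a t) (index t) ≡ inside
      lookup-swap-new = Vec.lookup∘update (index t) (A [ index a ]≔ outside) inside

      lookup-swap-old : lookup (swap A a t) (index a) ≡ outside
      lookup-swap-old = trans (Vec.lookup∘update′ a≢t (A [ index a ]≔ outside) inside)
        (Vec.lookup∘update (index a) A outside)

      lookup-swap-other : ∀ {i} → i ≢ index a → i ≢ index t → lookup (swap A a t) i ≡ lookup A i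
      lookup-swap-other i≢a i≢t = trans (Vec.lookup∘update′ i≢t (A [ index a ]≔ outside) inside)
        (Vec.lookup∘update′ i≢a A outside)

      swap-∋-new : swap A a t ∋ t
      swap-∋-new = Vec.lookup⇒[]= (index t) _ lookup-swap-new

      swap-∌-old : ¬ swap A a t ∋ a
      swap-∌-old p with () ← trans (sym lookup-swap-old) (Vec.[]=⇒lookup p)

      swap-∋⁺ : ∀ {x} → x ≢ a → A ∋ x → swap A a t ∋ x
      swap-∋⁺ {x} x≢a A∋x = Vec.lookup⇒[]= (index x) _ (trans
        (lookup-swap-other (x≢a ∘ index-injective) (λ eq → A∌t (subst (_∈ₛ A) eq A∋x))) (Vec.[]=⇒lookup A∋x))

      swap-∋⁻ : ∀ {x} → x ≢ t → swap A a t ∋ x → A ∋ x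
      swap-∋⁻ {x} x≢t A′∋x = Vec.lookup⇒[]= (index x) _ (trans
        (sym (lookup-swap-other (λ eq → swap-∌-old (subst (_∈ₛ swap A a t) eq A′∋x)) (x≢t ∘ index-injective)))
        (Vec.[]=⇒lookup A′∋x))

      -- Both the cardinality and the element sum of the swapped set are read off from this one
      -- permutation.
      swap-members : t ∷ members F A ↭ a ∷ members F (swap A a t)
      swap-members = unique-⊆⇒↭
        (All.tabulate (λ x∈ t≡x → A∌t (subst (A ∋_) (sym t≡x) (∈-members⁻ x∈))) ∷ members-unique A)
        (All.tabulate (λ x∈ a≡x → swap-∌-old (subst (swap A a t ∋_) (sym a≡x) (∈-members⁻ x∈))) ∷ members-unique _)
        to from
        where
        to : ∀ {x} → x ∈ t ∷ members F A → x ∈ a ∷ members F (swap A a t)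
        to (here refl) = there (∈-members⁺ swap-∋-new)
        to {x} (there x∈) with x ≟ a
        ... | yes refl = here refl
        ... | no x≢a   = there (∈-members⁺ (swap-∋⁺ x≢a (∈-members⁻ x∈)))
        from : ∀ {x} → x ∈ a ∷ members F (swap A a t) → x ∈ t ∷ members F A
        from (here refl) = there (∈-members⁺ A∋a)
        from {x} (there x∈) with x ≟ t
        ... | yes refl = here refl
        ... | no x≢t   = there (∈-members⁺ (swap-∋⁻ x≢t (∈-members⁻ x∈)))

      ∣swap∣ : ∣ swap A a t ∣ ≡ ∣ A ∣
      ∣swap∣ = trans (sym (length-members (swap A a t)))
        (trans (ℕ.suc-injective (sym (↭.↭-length swap-members))) (length-members A))

      elementSum-swap : t + elementSum F A ≡ a + elementSum F (swap A a t)
      elementSum-swap = foldr-+-↭ swap-members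

      𝟙-swap : ∀ x → 𝟙 (swap A a t ∋? x) ℕ.+ 𝟙 (x ≟ a) ≡ 𝟙 (A ∋? x) ℕ.+ 𝟙 (x ≟ t)
      𝟙-swap x with x ≟ a | x ≟ t
      ... | yes refl | yes refl = contradiction refl a≢t
      ... | yes refl | no _ = trans (cong (ℕ._+ 1) (𝟙-no (swap A a t ∋? x) swap-∌-old))
                                (sym (cong (ℕ._+ 0) (𝟙-yes (A ∋? x) A∋a)))
      ... | no _ | yes refl = trans (cong (ℕ._+ 0) (𝟙-yes (swap A a t ∋? x) swap-∋-new))
                                (sym (cong (ℕ._+ 1) (𝟙-no (A ∋? x) A∌t)))
      ... | no x≢a | no x≢t with A ∋? x
      ...   | yes A∋x = cong (ℕ._+ 0) (𝟙-yes (swap A a t ∋? x) (swap-∋⁺ x≢a A∋x))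
      ...   | no A∌x  = cong (ℕ._+ 0) (𝟙-no (swap A a t ∋? x) (A∌x ∘ swap-∋⁻ x≢t))

    swap-swap : ∀ {A a t} → A ∋ a → ¬ A ∋ t → swap (swap A a t) t a ≡ A
    swap-swap {A} {a} {t} A∋a A∌t = lookup-≗⇒≡ eq
      where
      A′ = swap A a t
      A′∋t = swap-∋-new {A} A∋a A∌t
      A′∌a = swap-∌-old {A} A∋a A∌t
      eq : ∀ i → lookup (swap A′ t a) i ≡ lookup A i
      eq i with i Fin.≟ index a | i Fin.≟ index t
      ... | yes refl | _        = trans (lookup-swap-new {A′} A′∋t A′∌a) (sym (Vec.[]=⇒lookup A∋a))
      ... | no _     | yes refl = trans (lookup-swap-old {A′} A′∋t A′∌a) (outside-lookup (lookup A (index t)) refl)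
        where
        outside-lookup : ∀ b → lookup A (index t) ≡ b → outside ≡ lookup A (index t)
        outside-lookup true  e = contradiction (Vec.lookup⇒[]= (index t) A e) A∌t
        outside-lookup false e = sym e
      ... | no i≢a   | no i≢t   = trans (lookup-swap-other {A′} A′∋t A′∌a i≢t i≢a) (lookup-swap-other {A} A∋a A∌t i≢a i≢t)

    module _ (d : ℕ) (γ : Carrier) where

      𝔄? : ∀ A → Dec (∣ A ∣ ≡ d × ¬ - elementSum F A ≡ γ)
      𝔄? A = (∣ A ∣ ℕ.≟ d) ×-dec ¬? (- elementSum F A ≟ γ)

      ∈-𝔄⁺ : ∀ {A} → ∣ A ∣ ≡ d → ¬ - elementSum F A ≡ γ → A ∈ 𝔄 F d γ
      ∈-𝔄⁺ {A} p p′ = ∈.∈-filter⁺ 𝔄? (allVecs-complete all A) (p , p′)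
        where
        all : ∀ b → b ∈ true ∷ false ∷ []
        all true  = here refl
        all false = there (here refl)

      ∈-𝔄⁻ : ∀ {A} → A ∈ 𝔄 F d γ → ∣ A ∣ ≡ d × ¬ - elementSum F A ≡ γ
      ∈-𝔄⁻ = proj₂ ∘ ∈.∈-filter⁻ 𝔄? {xs = allSubsets q}

      Swappable : Subset q → Carrier → Carrier → Set
      Swappable A a t = A ∋ a × ¬ A ∋ t × ¬ - elementSum F (swap A a t) ≡ γ

      swappable? : ∀ A a t → Dec (Swappable A a t)
      swappable? A a t = (A ∋? a) ×-dec ¬? (A ∋? t) ×-dec ¬? (- elementSum F (swap A a t) ≟ γ)

      -- The reverse exchange leads back to `A`, whose sum is allowed because `A` is a point.
      swappable-back : ∀ {A a t} → A ∈ 𝔄 F d γ → Swappable A a t →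
                       swap A a t ∈ 𝔄 F d γ × Swappable (swap A a t) t a
      swappable-back {A} {a} {t} A∈ (A∋a , A∌t , ok) =
        ∈-𝔄⁺ (trans (∣swap∣ {A} A∋a A∌t) (proj₁ (∈-𝔄⁻ A∈))) ok ,
        swap-∋-new {A} A∋a A∌t , swap-∌-old {A} A∋a A∌t ,
        subst (λ B → ¬ - elementSum F B ≡ γ) (sym (swap-swap A∋a A∌t)) (proj₂ (∈-𝔄⁻ A∈))

      swap-↭ : ∀ a t → filter (λ A → swappable? A a t) (𝔄 F d γ)
                     ↭ map (λ A → swap A t a) (filter (λ A → swappable? A t a) (𝔄 F d γ))
      swap-↭ a t = unique-⊆⇒↭
        (Unique.filter⁺ (λ A → swappable? A a t) (𝔄-unique F d γ))
        (Unique-map-injective injective (Unique.filter⁺ (λ A → swappable? A t a) (𝔄-unique F d γ)))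
        to from
        where
        back : ∀ {x y A} → A ∈ filter (λ A → swappable? A x y) (𝔄 F d γ) →
               swap (swap A x y) y x ≡ A × swap A x y ∈ filter (λ A → swappable? A y x) (𝔄 F d γ)
        back {x} {y} A∈ with A∈𝔄 , ok@(A∋x , A∌y , _) ← ∈.∈-filter⁻ (λ A → swappable? A x y) {xs = 𝔄 F d γ} A∈
          with A′∈ , ok′ ← swappable-back A∈𝔄 ok =
          swap-swap A∋x A∌y , ∈.∈-filter⁺ (λ A → swappable? A y x) A′∈ ok′
        injective : ∀ {A B} → A ∈ filter (λ A → swappable? A t a) (𝔄 F d γ) →
                    B ∈ filter (λ A → swappable? A t a) (𝔄 F d γ) → swap A t a ≡ swap B t a → A ≡ B
        injective A∈ B∈ eq = trans (sym (proj₁ (back A∈))) (trans (cong (λ C → swap C a t) eq) (proj₁ (back B∈)))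
        to : ∀ {A} → A ∈ filter (λ A → swappable? A a t) (𝔄 F d γ) →
             A ∈ map (λ A → swap A t a) (filter (λ A → swappable? A t a) (𝔄 F d γ))
        to A∈ = subst (_∈ _) (proj₁ (back A∈)) (∈.∈-map⁺ (λ A → swap A t a) (proj₂ (back A∈)))
        from : ∀ {A} → A ∈ map (λ A → swap A t a) (filter (λ A → swappable? A t a) (𝔄 F d γ)) →
               A ∈ filter (λ A → swappable? A a t) (𝔄 F d γ)
        from A∈ with B , B∈ , refl ← ∈.∈-map⁻ (λ A → swap A t a) A∈ = proj₂ (back B∈)

      swappable-many : ∀ {A a} → A ∈ 𝔄 F d γ → A ∋ a →
        ∑ elements (λ t → 𝟙 (A ∋? t)) ≡ d → ∑ elements (λ t → 𝟙 (t ≟ a + - γ + - elementSum F A)) ≡ 1 →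
        length elements ℕ.≤ suc d ℕ.+ ∑ elements (λ t → 𝟙 (swappable? A a t))
      swappable-many {A} {a} A∈ A∋a uniform single = begin
        length elements                ≡⟨ length≡∑ elements ⟩
        ∑ elements (λ _ → 1)           ≤⟨ ∑-mono elements (λ {t} _ → cover t) ⟩
        ∑ elements (λ t → 𝟙 (t ≟ t₀) ℕ.+ 𝟙 (A ∋? t) ℕ.+ 𝟙 (swappable? A a t))
          ≡⟨ trans (∑-+ elements) (cong (ℕ._+ ∑ elements (λ t → 𝟙 (swappable? A a t))) (∑-+ elements)) ⟩
        ∑ elements (λ t → 𝟙 (t ≟ t₀)) ℕ.+ ∑ elements (λ t → 𝟙 (A ∋? t)) ℕ.+ ∑ elements (λ t → 𝟙 (swappable? A a t))
          ≡⟨ cong₂ (λ x y → x ℕ.+ y ℕ.+ ∑ elements (λ t → 𝟙 (swappable? A a t))) single uniform ⟩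
        suc d ℕ.+ ∑ elements (λ t → 𝟙 (swappable? A a t)) ∎
        where
        open ℕ.≤-Reasoning
        -- Exchanging `a` for `t` changes the element sum by t - a; only this `t` produces the
        -- forbidden sum -γ.
        t₀ = a + - γ + - elementSum F A
        bad : ∀ {t} → ¬ A ∋ t → - elementSum F (swap A a t) ≡ γ → t ≡ t₀
        bad {t} A∌t refl = +-cancelʳ (elementSum F A) t t₀ (trans (elementSum-swap {A} A∋a A∌t) (sym
          (trans (+-assoc _ (- elementSum F A) (elementSum F A)) (trans (cong (a + - γ +_) (-‿inverseˡ (elementSum F A)))
            (trans (+-identityʳ (a + - γ)) (cong (a +_) (-‿involutive (elementSum F (swap A a t)))))))))
          where open GroupProperties +-group renaming (⁻¹-involutive to -‿involutive)
        cover : ∀ t → 1 ℕ.≤ 𝟙 (t ≟ t₀) ℕ.+ 𝟙 (A ∋? t) ℕ.+ 𝟙 (swappable? A a t)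
        cover t with t ≟ t₀
        ... | yes _ = s≤s z≤n
        ... | no t≢t₀ = cover′ (A ∋? t)
          where
          cover′ : Dec (A ∋ t) → 1 ℕ.≤ 𝟙 (A ∋? t) ℕ.+ 𝟙 (swappable? A a t)
          cover′ (yes A∋t) = ℕ.≤-trans (ℕ.≤-reflexive (sym (𝟙-yes (A ∋? t) A∋t))) (ℕ.m≤m+n _ _)
          cover′ (no A∌t)  = ℕ.≤-trans (ℕ.≤-reflexive (sym (𝟙-yes (swappable? A a t) (A∋a , A∌t , t≢t₀ ∘ bad A∌t)))) (ℕ.m≤n+m _ _)

      uniform : ∀ {A} → A ∈ 𝔄 F d γ → ∑ elements (λ t → 𝟙 (A ∋? t)) ≡ d
      uniform {A} A∈ = trans (sym (length-filter (A ∋?_) elements)) (trans (length-members A) (proj₁ (∈-𝔄⁻ A∈)))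

      swapSystem : SwapSystem
      swapSystem = record
        { Point          = Subset q
        ; Object         = Carrier
        ; points         = 𝔄 F d γ
        ; objects        = elements
        ; objects-unique = elements-unique
        ; _≟_            = _≟_
        ; _∋_            = _∋_
        ; _∋?_           = _∋?_
        ; Swappable      = Swappable
        ; swappable?     = swappable?
        ; swap           = swap
        ; d              = d
        ; uniform        = uniform
        ; old∈           = proj₁
        ; new∉           = proj₁ ∘ proj₂
        ; swap-∋         = λ {A} (A∋a , A∌t , _) → 𝟙-swap {A} A∋a A∌t
        ; exchange       = λ a t {f} → trans (sym (∑-filter (λ A → swappable? A a t) (𝔄 F d γ)))
            (trans (∑-↭ (swap-↭ a t)) (trans (∑-map (λ A → swap A t a) (filter (λ A → swappable? A t a) (𝔄 F d γ)))
              (∑-filter (λ A → swappable? A t a) (𝔄 F d γ))))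
        ; swappable-many = λ A∈ A∋a → swappable-many A∈ A∋a (uniform A∈) (count-self _≟_ elements-unique (elements-complete _))
        }

-- Discrepancies as rational numbers.

module Discrepancy where

  open FiniteSums
  open SwapSystems
  open BlockInequality
  open FieldSubsets
  open RationalArithmetic
  open import Data.Fin.Base as Fin using (Fin)
  import Data.Fin.Properties as Fin
  import Data.Integer.Base as ℤ
  open import Data.List.Base
    using (List; []; _∷_; map; allFin; length; filter; cartesianProduct)
  open import Data.List.Membership.Propositional using (_∈_)
  open import Data.Nat.Base as ℕ using (ℕ; zero; suc)
  open import Data.Nat.Divisibility using (_∣_; divides)
  import Data.Nat.Properties as ℕ
  open import Data.Product.Base using (∃; _×_; _,_)
  open import Data.Rational.Base as ℚ using (ℚ; 0ℚ; 1ℚ; _/_; _+_; _*_; _-_; -_; _≤_)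
  import Data.Rational.Properties as ℚ
  open import Data.Rational.Solver using (module +-*-Solver)
  open import Data.Sum.Base using (inj₁; inj₂)
  open import Function.Base using (_∘_)
  open import Relation.Binary.PropositionalEquality hiding (J)
  open import Relation.Nullary.Decidable using (yes; no; ¬?)
  open import Relation.Nullary.Negation using (¬_; contradiction)

  minimum : ∀ {m} → 1 ℕ.≤ m → (f : Fin m → ℕ) → ∃ λ i → ∀ j → f i ℕ.≤ f j
  minimum {suc zero}    _ f = Fin.zero , λ { Fin.zero → ℕ.≤-refl }
  minimum {suc (suc m)} _ f with i , fi≤ ← minimum {suc m} (ℕ.s≤s ℕ.z≤n) (f ∘ Fin.suc)
    with ℕ.≤-total (f Fin.zero) (f (Fin.suc i))
  ... | inj₁ le = Fin.zero , λ { Fin.zero → ℕ.≤-refl ; (Fin.suc j) → ℕ.≤-trans le (fi≤ j) }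
  ... | inj₂ ge = Fin.suc i , λ { Fin.zero → ge ; (Fin.suc j) → fi≤ j }

  module SystemProperties (X : IncidenceSystem) where
    open IncidenceSystem X

    private instance
      q-instance : ℕ.NonZero q
      q-instance = q-nonZero

    degree : List Object → Point → ℕ
    degree T p = ∑ T (λ s → 𝟙 (incident? p s))

    incidences≡∑ : ∀ B T → incidences B T ≡ ∑ B (degree T)
    incidences≡∑ B T = trans (length-filter (λ (p , s) → incident? p s) (cartesianProduct B T)) (∑-cartesianProduct B T)

    n/q≡ : ∀ n → ℤ.+ n / q ≡ toℚ n * (ℤ.+ 1 / q)
    n/q≡ n = begin
      ℤ.+ n / q                             ≡⟨ ℚ.*-identityʳ _ ⟨
      (ℤ.+ n / q) * 1ℚ                      ≡⟨ cong ((ℤ.+ n / q) *_) (/-*-cancel 1 q) ⟨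
      (ℤ.+ n / q) * ((ℤ.+ 1 / q) * toℚ q)
        ≡⟨ solve 3 (λ x y z → x :* (y :* z) := (x :* z) :* y) refl (ℤ.+ n / q) (ℤ.+ 1 / q) (toℚ q) ⟩
      (ℤ.+ n / q) * toℚ q * (ℤ.+ 1 / q)     ≡⟨ cong (_* (ℤ.+ 1 / q)) (/-*-cancel n q) ⟩
      toℚ n * (ℤ.+ 1 / q)                   ∎
      where
      open ≡-Reasoning
      open +-*-Solver

    -- Collects a sum of discrepancies into one incidence count and one area, the form in which the
    -- block inequality is available.
    sumℚ-σ : ∀ {Y : Set} (L : List Y) (f g : Y → ℕ) →
             sumℚ (map (λ x → toℚ (f x) - ℤ.+ g x / q) L) ≡ toℚ (∑ L f) - ℤ.+ ∑ L g / q
    sumℚ-σ []      f g = sym (cong (λ x → 0ℚ - x) (trans (n/q≡ 0) (ℚ.*-zeroˡ (ℤ.+ 1 / q))))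
    sumℚ-σ (x ∷ L) f g = begin
      toℚ (f x) - ℤ.+ g x / q + sumℚ (map (λ x → toℚ (f x) - ℤ.+ g x / q) L)
        ≡⟨ cong (toℚ (f x) - ℤ.+ g x / q +_) (sumℚ-σ L f g) ⟩
      toℚ (f x) - ℤ.+ g x / q + (toℚ (∑ L f) - ℤ.+ ∑ L g / q)
        ≡⟨ cong₂ (λ u v → toℚ (f x) - u + (toℚ (∑ L f) - v)) (n/q≡ (g x)) (n/q≡ (∑ L g)) ⟩
      toℚ (f x) - toℚ (g x) * r + (toℚ (∑ L f) - toℚ (∑ L g) * r)
        ≡⟨ solve 5 (λ a b c e r → a :- b :* r :+ (c :- e :* r) := (a :+ c) :- (b :+ e) :* r)
             refl (toℚ (f x)) (toℚ (g x)) (toℚ (∑ L f)) (toℚ (∑ L g)) r ⟩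
      (toℚ (f x) + toℚ (∑ L f)) - (toℚ (g x) + toℚ (∑ L g)) * r
        ≡⟨ cong₂ (λ u v → u - v * r) (toℚ-+ (f x) (∑ L f)) (toℚ-+ (g x) (∑ L g)) ⟨
      toℚ (∑ (x ∷ L) f) - toℚ (∑ (x ∷ L) g) * r
        ≡⟨ cong (λ u → toℚ (∑ (x ∷ L) f) - u) (n/q≡ (∑ (x ∷ L) g)) ⟨
      toℚ (∑ (x ∷ L) f) - ℤ.+ ∑ (x ∷ L) g / q ∎
      where
      open ≡-Reasoning
      open +-*-Solver
      r = ℤ.+ 1 / q

    sumℚ-mono : ∀ {Y : Set} (L : List Y) {f g : Y → ℚ} → (∀ x → f x ≤ g x) → sumℚ (map f L) ≤ sumℚ (map g L)
    sumℚ-mono []      f≤g = ℚ.≤-refl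
    sumℚ-mono (x ∷ L) f≤g = ℚ.+-mono-≤ (f≤g x) (sumℚ-mono L f≤g)

    sumℚ-nonNeg : ∀ {Y : Set} (L : List Y) {f : Y → ℚ} → (∀ x → 0ℚ ≤ f x) → 0ℚ ≤ sumℚ (map f L)
    sumℚ-nonNeg []      0≤f = ℚ.≤-refl
    sumℚ-nonNeg (x ∷ L) 0≤f = nonNeg-+ (0≤f x) (sumℚ-nonNeg L 0≤f)

    σ≤incidences : ∀ B T → σ B T ≤ toℚ (∑ B (degree T))
    σ≤incidences B T = ≤-from-difference (nonNeg-* (0≤toℚ (length B ℕ.* length T)) r≥0) (begin
      toℚ (∑ B (degree T)) - σ B T
        ≡⟨ cong₂ (λ u v → toℚ (∑ B (degree T)) - (toℚ u - v)) (incidences≡∑ B T) (n/q≡ (length B ℕ.* length T)) ⟩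
      toℚ (∑ B (degree T)) - (toℚ (∑ B (degree T)) - toℚ (length B ℕ.* length T) * (ℤ.+ 1 / q))
        ≡⟨ solve 2 (λ x y → x :- (x :- y) := y)
             refl (toℚ (∑ B (degree T))) (toℚ (length B ℕ.* length T) * (ℤ.+ 1 / q)) ⟩
      toℚ (length B ℕ.* length T) * (ℤ.+ 1 / q) ∎)
      where
      open ≡-Reasoning
      open +-*-Solver
      r≥0 : 0ℚ ≤ ℤ.+ 1 / q
      r≥0 = ℚ.nonNegative⁻¹ (ℤ.+ 1 / q) {{ℚ.normalize-nonNeg 1 q}}

    module _ {m} (𝒫 : MatchedPartition X m) where
      open MatchedPartition 𝒫

      offDiagonalPairs : List (Fin m × Fin m)
      offDiagonalPairs = filter (λ (i , j) → ¬? (i Fin.≟ j)) (cartesianProduct (allFin m) (allFin m))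

      ∑-offDiagonal : ∀ (f : Fin m → Fin m → ℕ) →
        ∑ offDiagonalPairs (λ (i , j) → f i j) ℕ.+ ∑ (allFin m) (λ i → f i i) ≡ ∑ (allFin m) (λ i → ∑ (allFin m) (f i))
      ∑-offDiagonal f = begin
        ∑ offDiagonalPairs (λ (i , j) → f i j) ℕ.+ ∑ (allFin m) (λ i → f i i)
          ≡⟨ cong₂ ℕ._+_ (trans (∑-filter (λ (i , j) → ¬? (i Fin.≟ j)) (cartesianProduct (allFin m) (allFin m)))
                           (∑-cartesianProduct (allFin m) (allFin m)))
                         (∑-cong (allFin m) λ {i} _ → sym (∑-off-diagonal Fin._≟_ f i)) ⟩
        ∑ (allFin m) (λ i → ∑ (allFin m) λ j → 𝟙 (¬? (i Fin.≟ j)) ℕ.* f i j) ℕ.+ ∑ (allFin m) (λ i → ∑ (allFin m) λ j → 𝟙 (i Fin.≟ j) ℕ.* f i j)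
          ≡⟨ ∑-+ (allFin m) ⟨
        ∑ (allFin m) (λ i → ∑ (allFin m) (λ j → 𝟙 (¬? (i Fin.≟ j)) ℕ.* f i j) ℕ.+ ∑ (allFin m) (λ j → 𝟙 (i Fin.≟ j) ℕ.* f i j))
          ≡⟨ ∑-cong (allFin m) (λ {i} _ → trans (sym (∑-+ (allFin m))) (∑-cong (allFin m) λ {j} _ → one i j)) ⟩
        ∑ (allFin m) (λ i → ∑ (allFin m) (f i)) ∎
        where
        open ≡-Reasoning
        one : ∀ i j → 𝟙 (¬? (i Fin.≟ j)) ℕ.* f i j ℕ.+ 𝟙 (i Fin.≟ j) ℕ.* f i j ≡ f i j
        one i j with i Fin.≟ j
        ... | yes _ = ℕ.*-identityˡ (f i j)
        ... | no _  = trans (ℕ.+-identityʳ _) (ℕ.*-identityˡ (f i j))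

      offIncidences offArea : ℕ
      offIncidences = ∑ offDiagonalPairs (λ (i , j) → ∑ (A i) (degree (𝒮 j)))
      offArea       = ∑ offDiagonalPairs (λ (i , j) → length (A i) ℕ.* length (𝒮 j))

      -- Each positive part dominates the discrepancy itself, and the signed sum is what the block
      -- inequality bounds from below.
      offDiagonal-lower : toℚ offIncidences - ℤ.+ offArea / q ≤ offDiagonal
      offDiagonal-lower = ℚ.≤-trans (ℚ.≤-reflexive (sym (sumℚ-σ offDiagonalPairs _ _)))
        (sumℚ-mono offDiagonalPairs λ (i , j) → ℚ.≤-trans
          (ℚ.≤-reflexive (cong (λ e → toℚ e - ℤ.+ (length (A i) ℕ.* length (𝒮 j)) / q) (sym (incidences≡∑ (A i) (𝒮 j)))))
          (ℚ.p≤p⊔q (σ (A i) (𝒮 j)) 0ℚ))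

      offDiagonal-nonNeg : 0ℚ ≤ offDiagonal
      offDiagonal-nonNeg = sumℚ-nonNeg offDiagonalPairs λ (i , j) → ℚ.p≤q⊔p (σ (A i) (𝒮 j)) 0ℚ

  0≢1⇒2≤ : ∀ {q} → FiniteField q → 2 ℕ.≤ q
  0≢1⇒2≤ {zero} F with () ← FiniteField.index F (FiniteField.0# F)
  0≢1⇒2≤ {suc zero} F = contradiction (index-injective (Fin1 _ _)) 0≢1
    where
    open FieldProperties F
    Fin1 : ∀ (i j : Fin 1) → i ≡ j
    Fin1 Fin.zero Fin.zero = refl
  0≢1⇒2≤ {suc (suc q)} F = ℕ.s≤s (ℕ.s≤s ℕ.z≤n)

  odd⇒3≤ : ∀ {q} → ¬ 2 ∣ q → FiniteField q → 3 ℕ.≤ q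
  odd⇒3≤ odd F = ℕ.≤∧≢⇒< (0≢1⇒2≤ F) λ { refl → odd (divides 1 refl) }

  module RootEvaluation {q} (F : FiniteField q) (d : ℕ) (3≤d : 3 ℕ.≤ d) (γ : FiniteField.Carrier F) where

    open FieldProperties F using (length-elements; swapSystem; uniform)
    𝒟 : IncidenceSystem
    𝒟 = rootEvaluation F d γ
    open IncidenceSystem 𝒟 using (σ; points; objects)
    open SystemProperties 𝒟

    private
      N = length points
      D = d ℕ.∸ 1
      instance
        q-instance : ℕ.NonZero q
        q-instance = FiniteField.order-nonZero F

    suc-D : suc D ≡ d
    suc-D = ℕ.m+[n∸m]≡n {1} {d} (ℕ.≤-trans (ℕ.s≤s ℕ.z≤n) 3≤d)

    -- Every point has d incidences, and its density term is q · (1/q) = 1.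
    σ-objects : ∀ {B} → (∀ {A} → A ∈ B → A ∈ points) → σ B objects ≡ toℚ D * toℚ (length B)
    σ-objects {B} B⊆P = begin
      toℚ (IncidenceSystem.incidences 𝒟 B objects) - ℤ.+ (length B ℕ.* length objects) / q
        ≡⟨ cong₂ (λ u v → toℚ u - v)
             (trans (incidences≡∑ B objects) (trans (∑-cong B λ A∈ → uniform d γ (B⊆P A∈)) (∑-const B d)))
             (trans (n/q≡ (length B ℕ.* length objects)) (cong (λ e → toℚ (length B ℕ.* e) * (ℤ.+ 1 / q)) length-elements)) ⟩
      toℚ (length B ℕ.* d) - toℚ (length B ℕ.* q) * (ℤ.+ 1 / q)
        ≡⟨ cong₂ (λ u v → u - v * (ℤ.+ 1 / q)) (trans (toℚ-* (length B) d) (cong (λ e → toℚ (length B) * toℚ e) (sym suc-D))) (toℚ-* (length B) q) ⟩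
      toℚ (length B) * toℚ (suc D) - toℚ (length B) * toℚ q * (ℤ.+ 1 / q)
        ≡⟨ cong (λ e → toℚ (length B) * e - toℚ (length B) * toℚ q * (ℤ.+ 1 / q)) (toℚ-+ 1 D) ⟩
      toℚ (length B) * (1ℚ + toℚ D) - toℚ (length B) * toℚ q * (ℤ.+ 1 / q)
        ≡⟨ solve 4 (λ B D q r → B :* (con 1ℚ :+ D) :- B :* q :* r := B :* (con 1ℚ :+ D) :- B :* (r :* q))
             refl (toℚ (length B)) (toℚ D) (toℚ q) (ℤ.+ 1 / q) ⟩
      toℚ (length B) * (1ℚ + toℚ D) - toℚ (length B) * ((ℤ.+ 1 / q) * toℚ q)
        ≡⟨ cong (λ e → toℚ (length B) * (1ℚ + toℚ D) - toℚ (length B) * e) (/-*-cancel 1 q) ⟩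
      toℚ (length B) * (1ℚ + toℚ D) - toℚ (length B) * 1ℚ
        ≡⟨ solve 2 (λ B D → B :* (con 1ℚ :+ D) :- B :* con 1ℚ := D :* B) refl (toℚ (length B)) (toℚ D) ⟩
      toℚ D * toℚ (length B) ∎
      where
      open ≡-Reasoning
      open +-*-Solver

    Σσ≡ : Σσ 𝒟 ≡ toℚ D * toℚ N
    Σσ≡ = σ-objects (λ A∈ → A∈)

    32d²c≡D : toℚ 32 * (toℚ d * toℚ d) * c d ≡ toℚ D
    -- `c` unfolds only at a successor, so d is first rewritten as `suc D`.
    32d²c≡D = subst (λ d → toℚ 32 * (toℚ d * toℚ d) * c d ≡ toℚ (d ℕ.∸ 1)) suc-D (begin
      toℚ 32 * (toℚ (suc D) * toℚ (suc D)) * c (suc D)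
        ≡⟨ cong (λ e → toℚ 32 * e * c (suc D)) (trans (cong (toℚ (suc D) *_) (cong toℚ (sym (ℕ.*-identityʳ (suc D))))) (sym (toℚ-* (suc D) (suc D ℕ.* 1)))) ⟩
      toℚ 32 * toℚ (suc D ℕ.^ 2) * c (suc D)
        ≡⟨ cong (_* c (suc D)) (toℚ-* 32 (suc D ℕ.^ 2)) ⟨
      toℚ (32 ℕ.* suc D ℕ.^ 2) * c (suc D)
        ≡⟨ ℚ.*-comm _ (c (suc D)) ⟩
      c (suc D) * toℚ (32 ℕ.* suc D ℕ.^ 2)
        ≡⟨ /-*-cancel D (32 ℕ.* suc D ℕ.^ 2) ⟩
      toℚ D ∎)
      where open ≡-Reasoning

  c-nonNeg : ∀ d → 0ℚ ≤ c d
  c-nonNeg zero    = ℚ.≤-refl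
  c-nonNeg (suc k) = ℚ.nonNegative⁻¹ (c (suc k)) {{ℚ.normalize-nonNeg k (32 ℕ.* suc k ℕ.^ 2)}}

-- From the block inequality to real parameters.

module PartitionBound where

  open FiniteSums
  open SwapSystems
  open BlockInequality
  open FieldSubsets
  open RationalArithmetic
  open Discrepancy
  open import Data.List.Base using (concat; tabulate; allFin; length)
  open import Data.List.Membership.Propositional using (_∈_)
  import Data.List.Membership.Propositional.Properties as ∈
  open import Data.List.Relation.Binary.Permutation.Propositional using (_↭_)
  import Data.List.Relation.Binary.Permutation.Propositional.Properties as ↭
  import Data.Integer.Base as ℤ
  open import Data.Nat.Base as ℕ using (ℕ; zero; suc; _⊔_)
  open import Data.Nat.Divisibility using (_∣_)
  import Data.Nat.Properties as ℕ
  open import Data.Product.Base using (_,_)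
  open import Data.Rational.Base as ℚ using (ℚ; 0ℚ; 1ℚ; ½; _/_; _+_; _*_; _-_; -_; _≤_; _<_)
  import Data.Rational.Properties as ℚ
  open import Data.Rational.Solver using (module +-*-Solver)
  import Data.Nat.Solver as ℕ-Solver
  open import Data.Sum.Base using ([_,_]′)
  open import Function.Base using (_∘_)
  open import Relation.Binary.PropositionalEquality hiding (J)
  open import Relation.Nullary.Decidable using (toSum)
  open import Relation.Nullary.Negation using (¬_)

  -- The extra `D` on the right of the hypothesis is D times the error 1 allowed in approximating
  -- C_d ≤ q τ. If b ≤ 2, the right side would be at most 4 d + d, which is less than 8 d ≤ D · C_d.
  block-large : ∀ {D d b} → 1 ℕ.≤ D → D ℕ.≤ d → 1 ℕ.≤ d → D ℕ.* C d ℕ.≤ 2 ℕ.* d ℕ.* b ℕ.+ D → 3 ℕ.≤ b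
  block-large {D} {d} {b} 1≤D D≤d 1≤d le = ℕ.≰⇒> λ b≤2 → ℕ.<⇒≱ (5d<8d) (begin
    8 ℕ.* d                  ≡⟨ ℕ.*-identityʳ _ ⟨
    8 ℕ.* d ℕ.* 1            ≤⟨ ℕ.*-monoʳ-≤ (8 ℕ.* d) (ℕ.m≤n+m 1 d) ⟩
    C d                      ≡⟨ ℕ.*-identityˡ _ ⟨
    1 ℕ.* C d                ≤⟨ ℕ.*-monoˡ-≤ (C d) 1≤D ⟩
    D ℕ.* C d                ≤⟨ le ⟩
    2 ℕ.* d ℕ.* b ℕ.+ D      ≤⟨ ℕ.+-mono-≤ (ℕ.*-monoʳ-≤ (2 ℕ.* d) b≤2) D≤d ⟩
    2 ℕ.* d ℕ.* 2 ℕ.+ d      ≡⟨ solve 1 (λ d → con 2 :* d :* con 2 :+ d := con 5 :* d) refl d ⟩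
    5 ℕ.* d                  ∎)
    where
    open ℕ.≤-Reasoning
    open ℕ-Solver.+-*-Solver
    5d<8d : 5 ℕ.* d ℕ.< 8 ℕ.* d
    5d<8d = ℕ.*-monoˡ-< d {{ℕ.>-nonZero 1≤d}} (ℕ.s≤s (ℕ.m≤m+n 5 2))

  module _ {q} (F : FiniteField q) {d} (3≤d : 3 ℕ.≤ d) (odd : ¬ 2 ∣ q) (γ : FiniteField.Carrier F) where

    open RootEvaluation F d 3≤d γ
    open FieldProperties F using (length-elements; swapSystem; uniform)
    open IncidenceSystem 𝒟 using (σ; points; objects)
    open SystemProperties 𝒟

    module _ {m} (2≤m : 2 ℕ.≤ m) (𝒫 : MatchedPartition 𝒟 m) where
      open MatchedPartition 𝒫

      private
        instance
          q-instance : ℕ.NonZero q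
          q-instance = FiniteField.order-nonZero F

        N = length points
        D = d ℕ.∸ 1

        module B = Blocks (swapSystem d γ) 𝒮 A R objects-partition points-partition 2≤m 3≤d

        ∈-points-R : ∀ {p} → p ∈ R → p ∈ points
        ∈-points-R = ↭.∈-resp-↭ points-partition ∘ ∈.∈-++⁺ʳ (concat (tabulate A))

        ∈-points-A : ∀ i {p} → p ∈ A i → p ∈ points
        ∈-points-A i p∈ = ↭.∈-resp-↭ points-partition (∈.∈-++⁺ˡ (∈.∈-concat⁺′ p∈ (∈.∈-tabulate⁺ i)))

        ∑-𝒮 : ∀ {f} → ∑ (allFin m) (λ j → ∑ (𝒮 j) f) ≡ ∑ objects f
        ∑-𝒮 = trans (sym (∑-concat-tabulate 𝒮)) (∑-↭ objects-partition)

        incidences-total : offIncidences 𝒫 ℕ.+ ∑ (allFin m) (λ i → ∑ (A i) (degree (𝒮 i))) ≡ d ℕ.* ∑ (allFin m) (λ i → length (A i))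
        incidences-total = trans (∑-offDiagonal 𝒫 (λ i j → ∑ (A i) (degree (𝒮 j))))
          (trans (∑-cong (allFin m) λ {i} _ → trans (∑-comm (allFin m) (A i))
            (trans (∑-cong (A i) λ p∈ → trans ∑-𝒮 (uniform d γ (∈-points-A i p∈)))
              (trans (∑-const (A i) d) (ℕ.*-comm (length (A i)) d))))
            (∑-*ˡ (allFin m) d))

        area-total : offArea 𝒫 ℕ.+ ∑ (allFin m) (λ i → length (A i) ℕ.* length (𝒮 i)) ≡ length objects ℕ.* ∑ (allFin m) (λ i → length (A i))
        area-total = trans (∑-offDiagonal 𝒫 (λ i j → length (A i) ℕ.* length (𝒮 j)))
          (trans (∑-cong (allFin m) λ {i} _ → trans (∑-*ˡ (allFin m) (length (A i)))
            (trans (cong (length (A i) ℕ.*_) (trans (∑-cong (allFin m) λ _ → length≡∑ (𝒮 _)) (trans ∑-𝒮 (sym (length≡∑ objects)))))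
              (ℕ.*-comm (length (A i)) (length objects))))
            (∑-*ˡ (allFin m) (length objects)))

        1≤D : 1 ℕ.≤ D
        1≤D = ℕ.≤-trans (ℕ.s≤s ℕ.z≤n) (ℕ.∸-monoˡ-≤ 1 3≤d)

      -- The estimate for one rational approximation `t` of τ, with `δ` and `δ′` as approximation
      -- errors. The diagonal inequality enters through a block of least size, whose lower bound
      -- then holds for all blocks.
      rational-bound : 1 ℕ.≤ N → ∀ i → (∀ j → length (𝒮 i) ℕ.≤ length (𝒮 j)) → ∀ {t δ δ′} →
        0ℚ ≤ t → toℚ 4 * δ′ ≤ t → t * Σσ 𝒟 ≤ σ (A i) (𝒮 i) + δ′ → toℚ (C d) ≤ toℚ q * t + 1ℚ →
        σ R objects ≤ c d * (t * t) * Σσ 𝒟 + δ →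
        toℚ 2 * c d * (t * t) * Σσ 𝒟 ≤ offDiagonal + δ
      rational-bound 1≤N i minimal {t} {δ} {δ′} 0≤t 4δ′≤t diagonal large remainder =
        subst (λ e → toℚ 2 * c d * (t * t) * e ≤ offDiagonal + δ) (sym Σσ≡)
          (off-diagonal-estimate (toℚ-pos 1≤q) (toℚ-pos (ℕ.≤-trans (ℕ.s≤s ℕ.z≤n) 3≤d)) (toℚ-mono 1≤D)
            (0≤toℚ (length R)) 0≤t (c-nonNeg d) (0≤toℚ b) (0≤toℚ N) 32d²c≡D tDq≤2db combinatorial (offDiagonal-lower 𝒫)
            (subst₂ (λ e f → e ≤ c d * (t * t) * f + δ) (σ-objects ∈-points-R) Σσ≡ remainder))
        where
        b = length (𝒮 i)
        I = ∑ (A i) (degree (𝒮 i))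
        1≤q : 1 ℕ.≤ q
        1≤q = ℕ.≤-trans (ℕ.s≤s ℕ.z≤n) (odd⇒3≤ odd F)
        toℚ-pos : ∀ {n} → 1 ℕ.≤ n → 0ℚ < toℚ n
        toℚ-pos 1≤n = ℚ.<-≤-trans (ℚ.positive⁻¹ 1ℚ) (toℚ-mono 1≤n)
        incidence-bound : (toℚ q - 1ℚ) * toℚ I ≤ toℚ d * toℚ b * toℚ N
        incidence-bound = subst₂ _≤_
          (trans (toℚ-* (q ℕ.∸ 1) I) (cong (_* toℚ I) toℚ-pred))
          (trans (toℚ-* (d ℕ.* b) N) (cong (_* toℚ N) (toℚ-* d b)))
          (toℚ-mono (subst (λ e → (e ℕ.∸ 1) ℕ.* I ℕ.≤ d ℕ.* b ℕ.* N) length-elements (B.block-incidences i)))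
          where
          open +-*-Solver
          toℚ-pred : toℚ (q ℕ.∸ 1) ≡ toℚ q - 1ℚ
          toℚ-pred = trans (solve 1 (λ x → x := (con 1ℚ :+ x) :- con 1ℚ) refl (toℚ (q ℕ.∸ 1)))
            (cong (_- 1ℚ) (trans (sym (toℚ-+ 1 (q ℕ.∸ 1))) (cong toℚ (ℕ.m+[n∸m]≡n 1≤q))))
        tDq≤2db : t * toℚ D * toℚ q ≤ toℚ 2 * toℚ d * toℚ b
        tDq≤2db = block-size-bound {N = toℚ N} {b = toℚ b} {d = toℚ d} {I = toℚ I} (toℚ-pos 1≤N)
          (subst (1ℚ ≤_) (toℚ-* D N) (toℚ-mono (ℕ.*-mono-≤ 1≤D 1≤N))) (toℚ-mono (odd⇒3≤ odd F)) 0≤t 4δ′≤t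
          (ℚ.≤-trans (subst (λ e → t * e ≤ σ (A i) (𝒮 i) + δ′) Σσ≡ diagonal) (ℚ.+-monoˡ-≤ δ′ (σ≤incidences (A i) (𝒮 i))))
          incidence-bound
        3≤b : 3 ℕ.≤ b
        3≤b = block-large 1≤D (ℕ.m∸n≤m d 1) (ℕ.≤-trans (ℕ.s≤s ℕ.z≤n) 3≤d) (toℚ-cancel
          (subst₂ _≤_ (sym (toℚ-* D (C d)))
            (sym (trans (toℚ-+ (2 ℕ.* d ℕ.* b) D) (cong (_+ toℚ D) (trans (toℚ-* (2 ℕ.* d) b) (cong (_* toℚ b) (toℚ-* 2 d))))))
            (≤-from-difference
              (nonNeg-+ (0≤y-x tDq≤2db) (nonNeg-* (0≤toℚ D) (0≤y-x large)))
              (solve 5 (λ t D q k e → e :+ D :- D :* k := (e :- t :* D :* q) :+ D :* (q :* t :+ con 1ℚ :- k)) refl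
                t (toℚ D) (toℚ q) (toℚ (C d)) (toℚ 2 * toℚ d * toℚ b)))))
          where open +-*-Solver
        combinatorial : toℚ N * (toℚ b * toℚ b) + toℚ 2 * toℚ q * ((ℤ.+ offArea 𝒫 / q) * toℚ q)
                        ≤ toℚ 2 * toℚ q * (toℚ q * toℚ (offIncidences 𝒫) + toℚ q * toℚ (length R))
        combinatorial = subst₂ _≤_
          (trans (toℚ-+ (N ℕ.* (b ℕ.* b)) (2 ℕ.* q ℕ.* offArea 𝒫)) (cong₂ _+_
            (trans (toℚ-* N (b ℕ.* b)) (cong (toℚ N *_) (toℚ-* b b)))
            (trans (toℚ-* (2 ℕ.* q) (offArea 𝒫)) (cong₂ _*_ (toℚ-* 2 q) (sym (/-*-cancel (offArea 𝒫) q))))))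
          (trans (toℚ-* (2 ℕ.* q) (q ℕ.* offIncidences 𝒫 ℕ.+ q ℕ.* length R)) (cong₂ _*_ (toℚ-* 2 q)
            (trans (toℚ-+ (q ℕ.* offIncidences 𝒫) (q ℕ.* length R)) (cong₂ _+_ (toℚ-* q (offIncidences 𝒫)) (toℚ-* q (length R))))))
          (toℚ-mono (subst (λ e → N ℕ.* (b ℕ.* b) ℕ.+ 2 ℕ.* e ℕ.* offArea 𝒫 ℕ.≤ 2 ℕ.* e ℕ.* (e ℕ.* offIncidences 𝒫 ℕ.+ e ℕ.* length R))
            length-elements (B.off-diagonal-bound minimal 3≤b incidences-total area-total)))

      private
        -- Without points Σ = 0, and the positive parts are nonnegative. The case is split off
        -- because `block-size-bound` cancels N.
        empty-bound : ¬ 1 ℕ.≤ N → ∀ τ →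
          fromℕ 2 *ᴿ fromℚ (c d) *ᴿ (τ *ᴿ τ) *ᴿ fromℚ (Σσ 𝒟) ≤ᴿ fromℚ offDiagonal
        empty-bound N≡0 τ δ 0<δ = 0 , λ n _ → ℚ.≤-trans (ℚ.≤-reflexive (trans
              (cong (toℚ 2 * c d * (seq τ n * seq τ n) *_) Σσ≡0) (ℚ.*-zeroʳ (toℚ 2 * c d * (seq τ n * seq τ n)))))
              (nonNeg-+ (offDiagonal-nonNeg 𝒫) (ℚ.<⇒≤ 0<δ))
          where
          Σσ≡0 : Σσ 𝒟 ≡ 0ℚ
          Σσ≡0 = trans Σσ≡ (trans (cong (λ e → toℚ D * toℚ e) (ℕ.n<1⇒n≡0 (ℕ.≰⇒> N≡0))) (ℚ.*-zeroʳ (toℚ D)))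

        -- All real inequalities are read at one late index `n`, with `t = seq τ n`. Positivity of τ
        -- provides t ≥ δ₀ there, so the error δ₀ / 4 in the diagonal inequality is at most t / 4.
        -- The error 1 in the size condition is absorbed by `block-large`, and the error in the
        -- remainder condition is passed on unchanged.
        nonempty-bound : 1 ℕ.≤ N → ∀ τ → 0ᴿ <ᴿ τ → fromℕ (C d) ≤ᴿ fromℕ q *ᴿ τ →
          (∀ i → τ *ᴿ fromℚ (Σσ 𝒟) ≤ᴿ fromℚ (σ (A i) (𝒮 i))) →
          fromℚ (σ R objects) ≤ᴿ fromℚ (c d) *ᴿ (τ *ᴿ τ) *ᴿ fromℚ (Σσ 𝒟) →
          fromℕ 2 *ᴿ fromℚ (c d) *ᴿ (τ *ᴿ τ) *ᴿ fromℚ (Σσ 𝒟) ≤ᴿ fromℚ offDiagonal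
        nonempty-bound 1≤N τ (δ₀ , 0<δ₀ , N₀ , δ₀≤τ) large diagonal remainder δ 0<δ =
          let i , minimal = minimum (ℕ.≤-trans (ℕ.s≤s ℕ.z≤n) 2≤m) (λ j → length (𝒮 j))
              N₁ , diagonal′  = diagonal i (¼ * δ₀) (pos-* (ℚ.positive⁻¹ ¼) 0<δ₀)
              N₂ , large′     = large 1ℚ (ℚ.positive⁻¹ 1ℚ)
              N₃ , remainder′ = remainder δ 0<δ
              N₀₁ = N₀ ⊔ N₁
              N₂₃ = N₂ ⊔ N₃
          in N₀₁ ⊔ N₂₃ , λ n N≤n →
            let n₀₁ = ℕ.m⊔n≤o⇒m≤o N₀₁ N₂₃ N≤n
                n₂₃ = ℕ.m⊔n≤o⇒n≤o N₀₁ N₂₃ N≤n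
                δ₀≤t = subst (_≤ seq τ n) (ℚ.+-identityˡ δ₀) (δ₀≤τ n (ℕ.m⊔n≤o⇒m≤o N₀ N₁ n₀₁))
            in rational-bound 1≤N i minimal (ℚ.≤-trans (ℚ.<⇒≤ 0<δ₀) δ₀≤t)
                 (ℚ.≤-trans (ℚ.≤-reflexive (solve 1 (λ x → con (toℚ 4) :* (con ¼ :* x) := x) refl δ₀)) δ₀≤t)
                 (diagonal′ n (ℕ.m⊔n≤o⇒n≤o N₀ N₁ n₀₁))
                 (large′ n (ℕ.m⊔n≤o⇒m≤o N₂ N₃ n₂₃))
                 (remainder′ n (ℕ.m⊔n≤o⇒n≤o N₂ N₃ n₂₃))
          where
          open +-*-Solver
          ¼ = ½ * ½

      partition-bound : ∀ τ → 0ᴿ <ᴿ τ → fromℕ (C d) ≤ᴿ fromℕ q *ᴿ τ →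
        (∀ i → τ *ᴿ fromℚ (Σσ 𝒟) ≤ᴿ fromℚ (σ (A i) (𝒮 i))) →
        fromℚ (σ R objects) ≤ᴿ fromℚ (c d) *ᴿ (τ *ᴿ τ) *ᴿ fromℚ (Σσ 𝒟) →
        fromℕ 2 *ᴿ fromℚ (c d) *ᴿ (τ *ᴿ τ) *ᴿ fromℚ (Σσ 𝒟) ≤ᴿ fromℚ offDiagonal
      partition-bound τ 0<τ large diagonal remainder =
        [ (λ 1≤N → nonempty-bound 1≤N τ 0<τ large diagonal remainder) , (λ N≡0 → empty-bound N≡0 τ) ]′ (toSum (1 ℕ.≤? N))

  ≤ᴿ-trans : ∀ x y z → x ≤ᴿ y → y ≤ᴿ z → x ≤ᴿ z
  ≤ᴿ-trans x y z x≤y y≤z δ 0<δ =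
    let N₁ , x≤y′ = x≤y (½ * δ) 0<½δ
        N₂ , y≤z′ = y≤z (½ * δ) 0<½δ
    in N₁ ⊔ N₂ , λ n N≤n → ≤-from-difference
         (nonNeg-+ (0≤y-x (x≤y′ n (ℕ.m⊔n≤o⇒m≤o N₁ N₂ N≤n))) (0≤y-x (y≤z′ n (ℕ.m⊔n≤o⇒n≤o N₁ N₂ N≤n))))
         (solve 4 (λ x y z δ → z :+ δ :- x := (y :+ con ½ :* δ :- x) :+ (z :+ con ½ :* δ :- y))
              refl (seq x n) (seq y n) (seq z n) δ)
    where
    open +-*-Solver
    0<½δ = pos-* (ℚ.positive⁻¹ ½) 0<δ

  *ᴿ-monoˡ-≤ᴿ : ∀ {x y k} → 0ℚ < k → x ≤ᴿ y → x *ᴿ fromℚ k ≤ᴿ y *ᴿ fromℚ k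
  *ᴿ-monoˡ-≤ᴿ {x} {y} {k} 0<k x≤y δ 0<δ =
    let N , x≤y′ = x≤y (δ * ℚ.1/ k) (pos-* 0<δ (ℚ.positive⁻¹ (ℚ.1/ k) {{ℚ.1/pos⇒pos k}}))
    in N , λ n N≤n → ≤-from-difference (nonNeg-* (0≤y-x (x≤y′ n N≤n)) (ℚ.<⇒≤ 0<k))
         (trans (cong (λ e → seq y n * k + e - seq x n * k) (sym δ≡))
           (solve 5 (λ x y k δ r → y :* k :+ δ :* (r :* k) :- x :* k := (y :+ δ :* r :- x) :* k)
                refl (seq x n) (seq y n) k δ (ℚ.1/ k)))
    where
    open +-*-Solver
    instance
      k-positive : ℚ.Positive k
      k-positive = ℚ.positive 0<k
      k-nonZero : ℚ.NonZero k
      k-nonZero = ℚ.pos⇒nonZero k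
    δ≡ : δ * (ℚ.1/ k * k) ≡ δ
    δ≡ = trans (cong (δ *_) (ℚ.*-inverseˡ k)) (ℚ.*-identityʳ δ)

  -- Eventually a τ² s is at least e = a s δ₀², so an error of e / 2 cannot make up for the
  -- doubling.
  double-not-≤ : ∀ {τ a s} → 0ᴿ <ᴿ τ → 0ℚ < a → 0ℚ < s →
    ¬ fromℕ 2 *ᴿ fromℚ a *ᴿ (τ *ᴿ τ) *ᴿ fromℚ s ≤ᴿ fromℚ a *ᴿ (τ *ᴿ τ) *ᴿ fromℚ s
  double-not-≤ {τ} {a} {s} (δ₀ , 0<δ₀ , N₀ , δ₀≤τ) 0<a 0<s le =
    let N , le′ = le (½ * e) (pos-* (ℚ.positive⁻¹ ½) 0<e)
        n = N₀ ⊔ N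
        t = seq τ n
        δ₀≤t = subst (_≤ t) (ℚ.+-identityˡ δ₀) (δ₀≤τ n (ℕ.m≤m⊔n N₀ N))
    in ℚ.<-irrefl refl (ℚ.<-≤-trans 0<e (≤-from-difference
         (nonNeg-* (0≤toℚ 2) (nonNeg-+ (0≤y-x (le′ n (ℕ.m≤n⊔m N₀ N)))
           (nonNeg-* (ℚ.<⇒≤ (pos-* 0<a 0<s)) (nonNeg-* (0≤y-x δ₀≤t) (nonNeg-+ (ℚ.≤-trans (ℚ.<⇒≤ 0<δ₀) δ₀≤t) (ℚ.<⇒≤ 0<δ₀))))))
         (solve 4 (λ a t s k → con 0ℚ :- a :* s :* (k :* k) :=
            con (toℚ 2) :* ((a :* (t :* t) :* s :+ con ½ :* (a :* s :* (k :* k)) :- con (toℚ 2) :* a :* (t :* t) :* s)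
              :+ a :* s :* ((t :- k) :* (t :+ k)))) refl a t s δ₀)))
    where
    open +-*-Solver
    e = a * s * (δ₀ * δ₀)
    0<e : 0ℚ < e
    0<e = pos-* (pos-* 0<a 0<s) (pos-* 0<δ₀ 0<δ₀)

  c-positive : ∀ {d} → 2 ℕ.≤ d → 0ℚ < c d
  c-positive {suc zero}    (ℕ.s≤s ())
  c-positive {suc (suc k)} _ = ℚ.positive⁻¹ (c (suc (suc k))) {{ℚ.normalize-pos (suc k) (32 ℕ.* suc (suc k) ℕ.^ 2)}}

  -- `partition-bound` would give 2 c_d τ² Σ ≤ offDiagonal ≤ ε Σ ≤ c_d τ² Σ, impossible for Σ > 0.
  -- The bound on ε also supplies its remainder condition.
  no-decomposition : ∀ {q} (F : FiniteField q) {d} → 3 ℕ.≤ d → ¬ 2 ∣ q → ∀ γ {τ ε} → 0ᴿ <ᴿ τ →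
    fromℕ (C d) ≤ᴿ fromℕ q *ᴿ τ → ε ≤ᴿ fromℚ (c d) *ᴿ (τ *ᴿ τ) →
    ¬ CenteredBlockDecomposition (rootEvaluation F d γ) τ ε
  no-decomposition F {d} 3≤d odd γ {τ} {ε} 0<τ large ε≤cτ² decomposition =
    double-not-≤ {τ} 0<τ (c-positive (ℕ.≤-trans (ℕ.s≤s (ℕ.s≤s ℕ.z≤n)) 3≤d)) Σ-positive
      (≤ᴿ-trans (fromℕ 2 *ᴿ fromℚ (c d) *ᴿ (τ *ᴿ τ) *ᴿ fromℚ Σ) (fromℚ offDiagonal) bound
        (partition-bound F 3≤d odd γ m≥2 partition τ 0<τ large diagonal-large
          (≤ᴿ-trans (fromℚ (σ R objects)) (ε *ᴿ fromℚ Σ) bound remainder-small εΣ≤))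
        (≤ᴿ-trans (fromℚ offDiagonal) (ε *ᴿ fromℚ Σ) bound offDiagonal-small εΣ≤))
    where
    open CenteredBlockDecomposition decomposition
    open MatchedPartition partition
    open IncidenceSystem (rootEvaluation F d γ) using (σ; objects)
    Σ = Σσ (rootEvaluation F d γ)
    bound = fromℚ (c d) *ᴿ (τ *ᴿ τ) *ᴿ fromℚ Σ
    εΣ≤ : ε *ᴿ fromℚ Σ ≤ᴿ bound
    εΣ≤ = *ᴿ-monoˡ-≤ᴿ {ε} {fromℚ (c d) *ᴿ (τ *ᴿ τ)} Σ-positive ε≤cτ²

-- Transport of block decompositions along incidence isomorphisms.

module IncidenceIsomorphisms where

  open FiniteSums
  open Discrepancy
  open import Data.Fin.Base using (Fin)
  open import Data.List.Base as List using (List; _++_; map; concat; tabulate)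
  open import Data.List.Membership.Propositional using (_∈_)
  import Data.List.Membership.Propositional.Properties as ∈
  open import Data.List.Relation.Binary.Permutation.Propositional
    using (_↭_; ↭-trans; ↭-reflexive)
  import Data.List.Relation.Binary.Permutation.Propositional.Properties as ↭
  import Data.List.Properties as List
  import Data.Integer.Base as ℤ
  import Data.Nat.Base as ℕ
  open import Data.Product.Base using (_,_)
  open import Data.Rational.Base as ℚ using (ℚ; 0ℚ; _/_; _-_)
  import Data.Rational.Properties as ℚ
  open import Function.Base using (_∘_)
  open import Function.Bundles using (_⇔_; Equivalence)
  open import Relation.Binary.PropositionalEquality hiding (J)
  open import Relation.Nullary.Decidable using (Dec; yes; no)

  𝟙-cong : ∀ {P P′ : Set} → P ⇔ P′ → (P? : Dec P) (P′? : Dec P′) → 𝟙 P? ≡ 𝟙 P′?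
  𝟙-cong P⇔P′ (yes p) P′? = sym (𝟙-yes P′? (Equivalence.to P⇔P′ p))
  𝟙-cong P⇔P′ (no ¬p) P′? = sym (𝟙-no P′? (¬p ∘ Equivalence.from P⇔P′))

  -- The lists are duplicate-free, so the two permutations say that the maps are bijections between
  -- the listed points and between the listed objects. Off the lists the maps may take any values.
  record IncidenceIsomorphism (X Y : IncidenceSystem) : Set where
    private
      module X = IncidenceSystem X
      module Y = IncidenceSystem Y
    field
      q≡       : X.q ≡ Y.q
      toPoint  : X.Point → Y.Point
      toObject : X.Object → Y.Object
      points↭  : map toPoint X.points ↭ Y.points
      objects↭ : map toObject X.objects ↭ Y.objects
      incident : ∀ {p s} → p ∈ X.points → s ∈ X.objects →
                 X.Incident p s ⇔ Y.Incident (toPoint p) (toObject s)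

    private
      module XP = SystemProperties X
      module YP = SystemProperties Y

      division : ∀ {m n} → m ≡ n → (ℤ.+ m / X.q) {{X.q-nonZero}} ≡ (ℤ.+ n / Y.q) {{Y.q-nonZero}}
      division m≡n = ℚ./-cong {{X.q-nonZero}} {{Y.q-nonZero}} (cong ℤ.+_ m≡n) q≡

      σ-cong-Y : ∀ {B B′ T T′} → B ↭ B′ → T ↭ T′ → Y.σ B T ≡ Y.σ B′ T′
      σ-cong-Y {B} {B′} {T} {T′} B↭B′ T↭T′ = cong₂ (λ u v → (ℤ.+ u / 1) - (ℤ.+ v / Y.q) {{Y.q-nonZero}})
        (trans (YP.incidences≡∑ B T) (trans (∑-↭ B↭B′) (trans (∑-cong B′ λ _ → ∑-↭ T↭T′) (sym (YP.incidences≡∑ B′ T′)))))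
        (cong₂ ℕ._*_ (↭.↭-length B↭B′) (↭.↭-length T↭T′))

      σ-map : ∀ {B T} → (∀ {p} → p ∈ B → p ∈ X.points) → (∀ {s} → s ∈ T → s ∈ X.objects) →
              X.σ B T ≡ Y.σ (map toPoint B) (map toObject T)
      σ-map {B} {T} B⊆ T⊆ = cong₂ _-_
        (cong (λ u → ℤ.+ u / 1) (trans (XP.incidences≡∑ B T) (trans
          (∑-cong B λ {p} p∈ → trans (∑-cong T λ {s} s∈ → 𝟙-cong (incident (B⊆ p∈) (T⊆ s∈)) (X.incident? p s) (Y.incident? (toPoint p) (toObject s)))
                                       (sym (∑-map toObject T)))
          (trans (sym (∑-map toPoint B)) (sym (YP.incidences≡∑ (map toPoint B) (map toObject T)))))))
        (division (sym (cong₂ ℕ._*_ (List.length-map toPoint B) (List.length-map toObject T))))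

      σ-objects-map : ∀ {B} → (∀ {p} → p ∈ B → p ∈ X.points) → X.σ B X.objects ≡ Y.σ (map toPoint B) Y.objects
      σ-objects-map {B} B⊆ = trans (σ-map B⊆ λ s∈ → s∈) (σ-cong-Y {map toPoint B} _↭_.refl objects↭)

      Σσ≡ : Σσ X ≡ Σσ Y
      Σσ≡ = trans (σ-objects-map λ p∈ → p∈) (σ-cong-Y points↭ _↭_.refl)

      concat-tabulate-map : ∀ {V W : Set} {m} (f : V → W) (h : Fin m → List V) →
                            concat (tabulate (map f ∘ h)) ≡ map f (concat (tabulate h))
      concat-tabulate-map f h = trans (cong concat (sym (List.map-tabulate h (map f)))) (List.concat-map (tabulate h))

    -- σ depends only on incidences, list lengths and q, all of which are preserved when the blocks
    -- are mapped elementwise.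
    transport : ∀ {τ ε} → CenteredBlockDecomposition X τ ε → CenteredBlockDecomposition Y τ ε
    transport {τ} {ε} decomposition = record
      { Σ-positive        = subst (0ℚ ℚ.<_) Σσ≡ Σ-positive
      ; m                 = m
      ; m≥2               = m≥2
      ; partition         = 𝒫′
      ; diagonal-large    = λ i → subst₂ (λ u v → τ *ᴿ fromℚ u ≤ᴿ fromℚ v) Σσ≡ (σ≡ i i) (diagonal-large i)
      ; remainder-small   = subst₂ (λ u v → fromℚ u ≤ᴿ ε *ᴿ fromℚ v)
          (σ-objects-map (↭.∈-resp-↭ points-partition ∘ ∈.∈-++⁺ʳ (concat (tabulate A)))) Σσ≡ remainder-small
      ; offDiagonal-small = subst₂ (λ u v → fromℚ u ≤ᴿ ε *ᴿ fromℚ v)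
          (cong sumℚ (List.map-cong (λ (i , j) → cong _₊ (σ≡ i j)) (XP.offDiagonalPairs partition))) Σσ≡ offDiagonal-small
      }
      where
      open CenteredBlockDecomposition decomposition
      open MatchedPartition partition
      𝒫′ : MatchedPartition Y m
      𝒫′ = record
        { 𝒮 = map toObject ∘ 𝒮
        ; A = map toPoint ∘ A
        ; R = map toPoint R
        ; objects-partition = ↭-trans (↭-reflexive (concat-tabulate-map toObject 𝒮)) (↭-trans (↭.map⁺ toObject objects-partition) objects↭)
        ; points-partition  = ↭-trans (↭-reflexive (trans (cong (_++ map toPoint R) (concat-tabulate-map toPoint A))
            (sym (List.map-++ toPoint (concat (tabulate A)) R)))) (↭-trans (↭.map⁺ toPoint points-partition) points↭)
        }
      σ≡ : ∀ i j → X.σ (A i) (𝒮 j) ≡ Y.σ (map toPoint (A i)) (map toObject (𝒮 j))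
      σ≡ i j = σ-map
        (λ p∈ → ↭.∈-resp-↭ points-partition (∈.∈-++⁺ˡ (∈.∈-concat⁺′ p∈ (∈.∈-tabulate⁺ i))))
        (λ s∈ → ↭.∈-resp-↭ objects-partition (∈.∈-concat⁺′ s∈ (∈.∈-tabulate⁺ j)))

-- A ring solver with integer coefficients over a commutative ring.

module IntegerRingSolver where

  open import Algebra.Bundles using (CommutativeRing)
  open import Algebra.Solver.Ring.AlmostCommutativeRing
    using (fromCommutativeRing; Induced-equivalence; _-Raw-AlmostCommutative⟶_)
  import Algebra.Solver.Ring as RingSolver
  import Algebra.Properties.Ring as RingProperties
  import Algebra.Properties.Semiring.Mult.TCOptimised as Mult
  open import Data.Integer.Base as ℤ using (ℤ; +_; -[1+_])
  import Data.Integer.Properties as ℤ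
  import Data.Maybe.Base as Maybe
  open import Data.Nat.Base as ℕ using (ℕ; zero; suc)
  import Data.Nat.Properties as ℕ
  open import Relation.Binary.Definitions using (WeaklyDecidable)
  open import Level using (0ℓ)
  open import Relation.Nullary.Decidable using (dec⇒maybe)
  open import Relation.Binary.PropositionalEquality as ≡ using (_≡_)

  module IntegerCoefficients (R : CommutativeRing 0ℓ 0ℓ) where
    open CommutativeRing R
    open RingProperties ring
    -- With this version of multiples, 1 times x is x by computation, so `con (ℤ.+ 1)` evaluates to
    -- `1#` itself.
    open Mult semiring renaming (_×_ to _ˣ_)
    open import Relation.Binary.Reasoning.Setoid setoid

    ⟦_⟧ᶻ : ℤ → Carrier
    ⟦ + n ⟧ᶻ      = n ˣ 1#
    ⟦ -[1+ n ] ⟧ᶻ = - (suc n ˣ 1#)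

    neg-homo : ∀ i → ⟦ ℤ.- i ⟧ᶻ ≈ - ⟦ i ⟧ᶻ
    neg-homo (+ zero)  = sym -0#≈0#
    neg-homo (+ suc n) = refl
    neg-homo -[1+ n ]  = sym (-‿involutive _)

    ⊖-homo : ∀ m n → ⟦ m ℤ.⊖ n ⟧ᶻ ≈ m ˣ 1# - n ˣ 1#
    ⊖-homo zero    zero    = sym (-‿inverseʳ 0#)
    ⊖-homo (suc m) zero    = sym (trans (+-congˡ -0#≈0#) (+-identityʳ _))
    ⊖-homo zero    (suc n) = sym (+-identityˡ _)
    ⊖-homo (suc m) (suc n) = begin
      ⟦ suc m ℤ.⊖ suc n ⟧ᶻ                    ≡⟨ ≡.cong ⟦_⟧ᶻ (ℤ.[1+m]⊖[1+n]≡m⊖n m n) ⟩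
      ⟦ m ℤ.⊖ n ⟧ᶻ                            ≈⟨ ⊖-homo m n ⟩
      m ˣ 1# - n ˣ 1#                         ≈⟨ +-congʳ (trans (+-congʳ (-‿inverseʳ 1#)) (+-identityˡ _)) ⟨
      1# - 1# + m ˣ 1# - n ˣ 1#
        ≈⟨ +-congʳ (trans (+-assoc _ _ _) (trans (+-congˡ (+-comm _ _)) (sym (+-assoc _ _ _)))) ⟩
      1# + m ˣ 1# - 1# - n ˣ 1#               ≈⟨ trans (+-assoc _ _ _) (+-congˡ (-‿+-comm 1# (n ˣ 1#))) ⟩
      1# + m ˣ 1# - (1# + n ˣ 1#)             ≈⟨ +-cong (1+× m 1#) (-‿cong (1+× n 1#)) ⟨
      suc m ˣ 1# - suc n ˣ 1#                 ∎

    +-homo : ∀ i j → ⟦ i ℤ.+ j ⟧ᶻ ≈ ⟦ i ⟧ᶻ + ⟦ j ⟧ᶻ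
    +-homo (+ m)    (+ n)    = ×-homo-+ 1# m n
    +-homo (+ m)    -[1+ n ] = ⊖-homo m (suc n)
    +-homo -[1+ m ] (+ n)    = trans (⊖-homo n (suc m)) (+-comm _ _)
    +-homo -[1+ m ] -[1+ n ] = begin
      - (suc (suc (m ℕ.+ n)) ˣ 1#)        ≡⟨ ≡.cong (λ k → - (k ˣ 1#)) (≡.sym (ℕ.+-suc (suc m) n)) ⟩
      - ((suc m ℕ.+ suc n) ˣ 1#)          ≈⟨ -‿cong (×-homo-+ 1# (suc m) (suc n)) ⟩
      - (suc m ˣ 1# + suc n ˣ 1#)         ≈⟨ -‿+-comm _ _ ⟨
      - (suc m ˣ 1#) - suc n ˣ 1#         ∎

    +*-homo : ∀ m j → ⟦ + m ℤ.* j ⟧ᶻ ≈ m ˣ 1# * ⟦ j ⟧ᶻ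
    +*-homo m (+ n)    = trans (reflexive (≡.cong ⟦_⟧ᶻ (≡.sym (ℤ.pos-* m n)))) (×1-homo-* m n)
    +*-homo m -[1+ n ] = begin
      ⟦ + m ℤ.* ℤ.- (+ suc n) ⟧ᶻ      ≡⟨ ≡.cong ⟦_⟧ᶻ (≡.sym (ℤ.neg-distribʳ-* (+ m) (+ suc n))) ⟩
      ⟦ ℤ.- (+ m ℤ.* + suc n) ⟧ᶻ      ≈⟨ neg-homo (+ m ℤ.* + suc n) ⟩
      - ⟦ + m ℤ.* + suc n ⟧ᶻ          ≈⟨ -‿cong (+*-homo m (+ suc n)) ⟩
      - (m ˣ 1# * suc n ˣ 1#)         ≈⟨ -‿distribʳ-* _ _ ⟩
      m ˣ 1# * - (suc n ˣ 1#)         ∎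

    *-homo : ∀ i j → ⟦ i ℤ.* j ⟧ᶻ ≈ ⟦ i ⟧ᶻ * ⟦ j ⟧ᶻ
    *-homo (+ m)    j = +*-homo m j
    *-homo -[1+ m ] j = begin
      ⟦ ℤ.- (+ suc m) ℤ.* j ⟧ᶻ      ≡⟨ ≡.cong ⟦_⟧ᶻ (≡.sym (ℤ.neg-distribˡ-* (+ suc m) j)) ⟩
      ⟦ ℤ.- (+ suc m ℤ.* j) ⟧ᶻ      ≈⟨ neg-homo (+ suc m ℤ.* j) ⟩
      - ⟦ + suc m ℤ.* j ⟧ᶻ          ≈⟨ -‿cong (+*-homo (suc m) j) ⟩
      - (suc m ˣ 1# * ⟦ j ⟧ᶻ)       ≈⟨ -‿distribˡ-* _ _ ⟩
      - (suc m ˣ 1#) * ⟦ j ⟧ᶻ       ∎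

    integerMorphism : ℤ.+-*-rawRing -Raw-AlmostCommutative⟶ fromCommutativeRing R
    integerMorphism = record
      { ⟦_⟧    = ⟦_⟧ᶻ
      ; +-homo = +-homo
      ; *-homo = *-homo
      ; -‿homo = neg-homo
      ; 0-homo = refl
      ; 1-homo = refl
      }

    ⟦⟧ᶻ-equal? : WeaklyDecidable (Induced-equivalence integerMorphism)
    ⟦⟧ᶻ-equal? i j = Maybe.map (λ i≡j → reflexive (≡.cong ⟦_⟧ᶻ i≡j)) (dec⇒maybe (i ℤ.≟ j))

    open RingSolver ℤ.+-*-rawRing (fromCommutativeRing R) integerMorphism ⟦⟧ᶻ-equal? public

-- Finite-field algebra and polynomials with prescribed roots.

module FieldPolynomials where

  open FiniteSums
  open FieldSubsets
  open IntegerRingSolver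
  import Algebra.Properties.CommutativeMonoid.Sum as SumProperties
  import Algebra.Properties.Monoid.Mult as Mult
  open import Algebra.Bundles using (CommutativeRing)
  open import Data.Fin.Base as Fin using (Fin)
  import Data.Fin.Permutation as Perm
  open import Data.Integer.Base as ℤ using (ℤ)
  open import Data.List.Base as List
    using (List; []; _∷_; _++_; [_]; map; tabulate; length; foldr)
  import Data.List.Properties as List
  open import Data.List.Membership.Propositional using (_∈_)
  import Data.List.Membership.Propositional.Properties as ∈
  open import Data.List.Relation.Binary.Permutation.Propositional using (_↭_)
  import Data.List.Relation.Binary.Permutation.Propositional.Properties as ↭
  open import Data.List.Relation.Unary.All as All using ([]; _∷_)
  import Data.List.Relation.Unary.All.Properties as All
  open import Data.List.Relation.Unary.AllPairs using ([]; _∷_)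
  open import Data.List.Relation.Unary.Any using (here; there)
  open import Data.List.Relation.Unary.Unique.Propositional using (Unique)
  open import Data.Nat.Base as ℕ using (ℕ; zero; suc)
  open import Data.Nat.Divisibility using (_∣_; divides)
  import Data.Nat.Properties as ℕ
  open import Data.Product.Base using (∃; _×_; _,_)
  open import Data.Sum.Base using (_⊎_; inj₁; inj₂)
  open import Data.Vec.Base using ([]; _∷_; lookup)
  open import Function.Base using (_∘_)
  open import Function.Bundles using (_⇔_; mk⇔; mk↔ₛ′; module Equivalence)
  open import Relation.Binary.PropositionalEquality hiding (J; [_])
  open import Relation.Nullary.Decidable using (yes; no)
  open import Relation.Nullary.Negation using (¬_; contradiction)
  import Data.List.Membership.DecPropositional as DecMembership
  open import Relation.Binary.Definitions using (DecidableEquality)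

  unique-⊆⇒length≤ : {X : Set} {xs ys : List X} → Unique xs → (∀ {x} → x ∈ xs → x ∈ ys) → length xs ℕ.≤ length ys
  unique-⊆⇒length≤ {xs = []}     _            _     = ℕ.z≤n
  unique-⊆⇒length≤ {xs = x ∷ xs} {ys} (x∉xs ∷ xs!) xs⊆ys with ys′ , ys↭ ← ∈⇒↭-head (xs⊆ys (here refl)) =
    subst (suc (length xs) ℕ.≤_) (sym (↭.↭-length ys↭)) (ℕ.s≤s (unique-⊆⇒length≤ xs! λ {y} y∈xs →
      tail y∈xs (↭.∈-resp-↭ ys↭ (xs⊆ys (there y∈xs)))))
    where
    tail : ∀ {y} → y ∈ xs → y ∈ x ∷ ys′ → y ∈ ys′
    tail y∈xs (here refl) = contradiction refl (All.lookup x∉xs y∈xs)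
    tail y∈xs (there y∈)  = y∈

  -- If `y` were missed, `y ∷ map f xs` would be a duplicate-free list longer than the complete list
  -- `xs`.
  injective⇒surjective-on : {X : Set} (_≟_ : DecidableEquality X) {xs : List X} → Unique xs → (∀ x → x ∈ xs) →
    (f : X → X) → (∀ {x y} → f x ≡ f y → x ≡ y) → ∀ y → ∃ λ x → f x ≡ y
  injective⇒surjective-on _≟_ {xs} xs! complete f injective y with DecMembership._∈?_ _≟_ y (map f xs)
  ... | yes y∈ with x , _ , y≡fx ← ∈.∈-map⁻ f y∈ = x , sym y≡fx
  ... | no y∉ = contradiction (unique-⊆⇒length≤ {xs = y ∷ map f xs}
          (All.tabulate (λ {z} z∈ y≡z → y∉ (subst (_∈ map f xs) (sym y≡z) z∈)) ∷ Unique-map-injective (λ _ _ → injective) xs!)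
          (λ _ → complete _))
        (ℕ.<⇒≱ (ℕ.s≤s (ℕ.≤-reflexive (sym (List.length-map f xs)))))

  list⇒tabulate : {X : Set} {n : ℕ} (xs : List X) → length xs ≡ n → ∃ λ (h : Fin n → X) → xs ≡ tabulate h
  list⇒tabulate xs refl = List.lookup xs , sym (List.tabulate-lookup xs)

  -- Used on coefficient lists of `Ψ`: it separates the middle coefficients from the one of degree d
  -- - 1.
  tabulate-∷ʳ-injective : {X : Set} {n : ℕ} {f g : Fin n → X} {x y : X} {xs ys : List X} →
    tabulate f ++ x ∷ xs ≡ tabulate g ++ y ∷ ys → (∀ i → f i ≡ g i) × x ≡ y
  tabulate-∷ʳ-injective {n = zero} eq = (λ ()) , List.∷-injectiveˡ eq
  tabulate-∷ʳ-injective {n = suc n} {f} {g} eq with fs≡gs , x≡y ← tabulate-∷ʳ-injective {f = f ∘ Fin.suc} (List.∷-injectiveʳ eq) =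
    (λ { Fin.zero → List.∷-injectiveˡ eq ; (Fin.suc i) → fs≡gs i }) , x≡y

  module FieldAlgebra {q} (F : FiniteField q) where
    open FieldProperties F public
    open CommutativeRing commutativeRing public
      using (*-assoc; *-comm; *-identityˡ; *-identityʳ; zeroˡ; zeroʳ; distribˡ; +-commutativeMonoid; +-monoid)
    open IntegerCoefficients commutativeRing using (solve; _:=_; _:+_; _:*_; _:-_; :-_; con)

    difference≡0⇔ : ∀ {x y} → x - y ≡ 0# ⇔ x ≡ y
    difference≡0⇔ {x} {y} = mk⇔
      (λ eq → trans (solve 2 (λ x y → x := (x :- y) :+ y) refl x y) (trans (cong (_+ y) eq) (+-identityˡ y)))
      (λ { refl → -‿inverseʳ x })

    zero-divisor : ∀ {x y} → x * y ≡ 0# → x ≡ 0# ⊎ y ≡ 0#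
    zero-divisor {x} {y} xy≡0 with x ≟ 0#
    ... | yes x≡0 = inj₁ x≡0
    ... | no x≢0  = inj₂ (begin
      y                  ≡⟨ *-identityˡ y ⟨
      1# * y             ≡⟨ cong (_* y) (*-inverseʳ x x≢0) ⟨
      x * x ⁻¹ * y       ≡⟨ solve 3 (λ x i y → x :* i :* y := x :* y :* i) refl x (x ⁻¹) y ⟩
      x * y * x ⁻¹       ≡⟨ cong (_* x ⁻¹) xy≡0 ⟩
      0# * x ⁻¹          ≡⟨ zeroˡ _ ⟩
      0#                 ∎)
      where open ≡-Reasoning

    *-cancelˡ : ∀ {x y z} → x ≢ 0# → x * y ≡ x * z → y ≡ z
    *-cancelˡ {x} {y} {z} x≢0 eq with zero-divisor (trans (solve 3 (λ x y z → x :* (y :- z) := x :* y :- x :* z)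
         refl x y z)
                                                    (Equivalence.from difference≡0⇔ eq))
    ... | inj₁ x≡0 = contradiction x≡0 x≢0
    ... | inj₂ y-z≡0 = Equivalence.to difference≡0⇔ y-z≡0

    ^≡0 : ∀ t n → t ^ n ≡ 0# → t ≡ 0#
    ^≡0 t zero    1≡0 = contradiction (sym 1≡0) 0≢1
    ^≡0 t (suc n) eq with zero-divisor eq
    ... | inj₁ t≡0  = t≡0
    ... | inj₂ tⁿ≡0 = ^≡0 t n tⁿ≡0

    open SumProperties +-commutativeMonoid using (sum; sum-permute; ∑-distrib-+; sum-cong-≗; sum-replicate)
    open Mult +-monoid using (×-homo-+) renaming (_×_ to _ˣ_)

    -- Translating by 1 permutes the field, so Σ x = Σ (x + 1) = Σ x + q · 1.
    order-annihilates : q ˣ 1# ≡ 0#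
    order-annihilates = +-cancelˡ (sum element) (q ˣ 1#) 0# (begin
      sum element + q ˣ 1#                       ≡⟨ cong (sum element +_) (sum-replicate q) ⟨
      sum element + sum (λ (_ : Fin q) → 1#)     ≡⟨ ∑-distrib-+ element (λ _ → 1#) ⟨
      sum (λ i → element i + 1#)                 ≡⟨ sum-cong-≗ (λ i → sym (element-index (element i + 1#))) ⟩
      sum (λ i → element (index (element i + 1#))) ≡⟨ sum-permute element translate ⟨
      sum element                                ≡⟨ +-identityʳ _ ⟨
      sum element + 0#                           ∎)
      where
      open ≡-Reasoning
      translate : Perm.Permutation q q
      translate = mk↔ₛ′ (λ i → index (element i + 1#)) (λ i → index (element i - 1#))
        (λ i → trans (cong (λ x → index (x + 1#)) (element-index (element i - 1#)))
          (trans (cong index (solve 1 (λ x → x :- con (ℤ.+ 1) :+ con (ℤ.+ 1) := x)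
               refl (element i))) (index-element i)))
        (λ i → trans (cong (λ x → index (x - 1#)) (element-index (element i + 1#)))
          (trans (cong index (solve 1 (λ x → x :+ con (ℤ.+ 1) :- con (ℤ.+ 1) := x)
               refl (element i))) (index-element i)))

    -- If 1 + 1 = 0, then `order-annihilates` descends in steps of two from the odd number q to 1 =
    -- 0.
    2≢0 : ¬ 2 ∣ q → 1# + 1# ≢ 0#
    2≢0 odd 2≡0 = halves q (λ { (divides n q≡) → odd (divides n q≡) }) order-annihilates
      where
      halves : ∀ n → ¬ 2 ∣ n → n ˣ 1# ≢ 0#
      halves zero          n-odd _  = n-odd (divides 0 refl)
      halves (suc zero)    n-odd eq = 0≢1 (sym (trans (sym (+-identityʳ 1#)) eq))
      halves (suc (suc n)) n-odd eq = halves n (λ { (divides k n≡) → n-odd (divides (suc k) (cong (λ e → suc (suc e)) n≡)) })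
        (trans (sym (+-identityˡ _)) (trans (cong (_+ n ˣ 1#) (sym 2≡0)) (trans (+-assoc 1# 1# _) eq)))

    eval : List Carrier → Carrier → Carrier
    eval []      t = 0#
    eval (a ∷ p) t = a + t * eval p t

    eval-++ : ∀ p r t → eval (p ++ r) t ≡ eval p t + t ^ length p * eval r t
    eval-++ []      r t = sym (trans (+-identityˡ _) (*-identityˡ _))
    eval-++ (a ∷ p) r t = trans (cong (λ e → a + t * e) (eval-++ p r t))
      (solve 5 (λ a t p n r → a :+ t :* (p :+ n :* r) := a :+ t :* p :+ t :* n :* r)
           refl a t (eval p t) (t ^ length p) (eval r t))

    eval-timesLinear : ∀ a p t → eval (timesLinear F a p) t ≡ (t - a) * eval p t
    eval-timesLinear a p t = trans (shifted 0# p) (solve 3 (λ t a e → con ℤ.0ℤ :+ (t :- a) :* e := (t :- a) :* e)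
         refl t a (eval p t))
      where
      -- Generalised over the entry shifted in at the front, which becomes the previous coefficient
      -- in the recursion.
      shifted : ∀ b p → eval (List.zipWith _+_ (b ∷ p) (map (- a *_) p ++ [ 0# ])) t ≡ b + (t - a) * eval p t
      shifted b []      = solve 3 (λ b t a → b :+ con ℤ.0ℤ :+ t :* con ℤ.0ℤ := b :+ (t :- a) :* con ℤ.0ℤ)
           refl b t a
      shifted b (x ∷ p) = trans (cong (λ e → b + - a * x + t * e) (shifted x p))
        (solve 5 (λ b a x t e → b :+ (:- a) :* x :+ t :* (x :+ (t :- a) :* e) := b :+ (t :- a) :* (x :+ t :* e))
             refl b a x t (eval p t))

    private
      rootProduct : List Carrier → List Carrier
      rootProduct = foldr (timesLinear F) [ 1# ]

    rootProduct-root : ∀ {as t} → t ∈ as → eval (rootProduct as) t ≡ 0#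
    rootProduct-root {a ∷ as} {t} (here refl) = trans (eval-timesLinear t (rootProduct as) t)
      (trans (cong (_* eval (rootProduct as) t) (-‿inverseʳ t)) (zeroˡ _))
    rootProduct-root {a ∷ as} {t} (there t∈) = trans (eval-timesLinear a (rootProduct as) t)
      (trans (cong ((t - a) *_) (rootProduct-root t∈)) (zeroʳ _))

    root-rootProduct : ∀ as {t} → eval (rootProduct as) t ≡ 0# → t ∈ as
    root-rootProduct [] {t} eq = contradiction (sym (trans (solve 1 (λ t → con (ℤ.+ 1) := con (ℤ.+ 1) :+ t :* con ℤ.0ℤ)
         refl t) eq)) 0≢1
    root-rootProduct (a ∷ as) {t} eq with zero-divisor (trans (sym (eval-timesLinear a (rootProduct as) t)) eq)
    ... | inj₁ t-a≡0 = here (Equivalence.to difference≡0⇔ t-a≡0)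
    ... | inj₂ eq′   = there (root-rootProduct as eq′)

    root⇔∋ : ∀ {A t} → eval (rootPolynomial F A) t ≡ 0# ⇔ A ∋ t
    root⇔∋ {A} = mk⇔ (∈-members⁻ {A} ∘ root-rootProduct (members F A)) (rootProduct-root ∘ ∈-members⁺ {A})

    -- Vieta's formula for the coefficient below the leading one; it exists because there is at
    -- least one root. This coefficient is what the condition on γ in `𝔄` speaks about.
    rootProduct-shape : ∀ a as → ∃ λ low →
      length low ≡ length as × rootProduct (a ∷ as) ≡ low ++ - foldr _+_ 0# (a ∷ as) ∷ 1# ∷ []
    rootProduct-shape a [] = [] , refl , cong₂ (λ x y → x ∷ y ∷ [])
      (solve 1 (λ a → con ℤ.0ℤ :+ (:- a) :* con (ℤ.+ 1) := :- (a :+ con ℤ.0ℤ)) refl a) (+-identityʳ 1#)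
    rootProduct-shape a (a′ ∷ as) with low , len , eq ← rootProduct-shape a′ as =
      let low′ , len′ , eq′ = step 0# low (- foldr _+_ 0# (a′ ∷ as))
      in low′ , trans len′ (cong suc len) , trans (cong (timesLinear F a) eq) (trans eq′
           (cong (λ e → low′ ++ e ∷ 1# ∷ []) (solve 2 (λ a s → (:- s) :+ (:- a) :* con (ℤ.+ 1) := :- (a :+ s))
                refl a (foldr _+_ 0# (a′ ∷ as)))))
      where
      step : ∀ b low s → ∃ λ low′ → length low′ ≡ suc (length low) ×
        List.zipWith _+_ (b ∷ low ++ s ∷ 1# ∷ []) (map (- a *_) (low ++ s ∷ 1# ∷ []) ++ [ 0# ]) ≡ low′ ++ (s + - a * 1#) ∷ 1# ∷ []
      step b []        s = b + - a * s ∷ [] , refl , cong (λ e → b + - a * s ∷ s + - a * 1# ∷ e ∷ []) (+-identityʳ 1#)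
      step b (x ∷ low) s with low′ , len′ , eq′ ← step x low s =
        b + - a * x ∷ low′ , cong suc len′ , cong (b + - a * x ∷_) eq′

-- Sphere equations and the coefficients of Ψ.

module RationalNormalCurves where

  open FiniteSums
  open FieldSubsets
  open IncidenceIsomorphisms
  open FieldPolynomials
  open IntegerRingSolver
  open import Data.Fin.Base as Fin using (Fin; toℕ)
  open import Data.Fin.Subset using (∣_∣) renaming (_∈_ to _∈ₛ_)
  open import Data.Integer.Base as ℤ using (ℤ)
  open import Data.List.Base as List using (List; []; _∷_; _++_; tabulate; length; foldr)
  import Data.List.Properties as List
  open import Data.List.Membership.Propositional using (_∈_)
  import Data.List.Membership.Propositional.Properties as ∈
  open import Data.Nat.Base as ℕ using (ℕ; zero; suc)
  open import Data.Nat.Divisibility using (_∣_)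
  import Data.Nat.Properties as ℕ
  open import Data.Product.Base using (∃; _×_; _,_; proj₁; proj₂)
  open import Data.Vec.Base as Vec using (Vec; []; _∷_; lookup)
  import Data.Vec.Properties as Vec
  open import Function.Base using (_∘_)
  open import Function.Bundles using (_⇔_; mk⇔; module Equivalence)
  open import Relation.Binary.PropositionalEquality hiding (J; [_])
  open import Relation.Nullary.Negation using (¬_)

  module VectorProperties {q} (F : FiniteField q) where
    open FieldAlgebra F public
    open IntegerCoefficients commutativeRing using (solve; _:=_; _:+_; _:*_; _:-_; :-_; con)

    infixl 6 _⊕_ _⊖_
    infixl 7 _⊛_
    _⊕_ _⊖_ : ∀ {n} → Vec Carrier n → Vec Carrier n → Vec Carrier n
    _⊕_ = _+ᵥ_ F
    _⊖_ = _-ᵥ_ F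

    _⊛_ : ∀ {n} → Carrier → Vec Carrier n → Vec Carrier n
    _⊛_ = _*ᵥ_ F

    𝟘 : ∀ {n} → Vec Carrier n
    𝟘 = 0ᵥ F

    ⊕-comm : ∀ {n} (v w : Vec Carrier n) → v ⊕ w ≡ w ⊕ v
    ⊕-comm = Vec.zipWith-comm +-comm

    ⊕-identityˡ : ∀ {n} (v : Vec Carrier n) → 𝟘 ⊕ v ≡ v
    ⊕-identityˡ = Vec.zipWith-identityˡ +-identityˡ

    ⊕-identityʳ : ∀ {n} (v : Vec Carrier n) → v ⊕ 𝟘 ≡ v
    ⊕-identityʳ = Vec.zipWith-identityʳ +-identityʳ

    ⊖≡ : ∀ {n} (v w : Vec Carrier n) → v ⊖ w ≡ v ⊕ - 1# ⊛ w
    ⊖≡ []      []      = refl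
    ⊖≡ (x ∷ v) (y ∷ w) = cong₂ _∷_ (solve 2 (λ x y → x :- y := x :+ (:- con (ℤ.+ 1)) :* y) refl x y) (⊖≡ v w)

    ⊕-inverse : ∀ {n} (v : Vec Carrier n) → v ⊕ - 1# ⊛ v ≡ 𝟘
    ⊕-inverse []      = refl
    ⊕-inverse (x ∷ v) = cong₂ _∷_ (solve 1 (λ x → x :+ (:- con (ℤ.+ 1)) :* x := con ℤ.0ℤ) refl x) (⊕-inverse v)

    difference≡𝟘 : ∀ {n} (v w : Vec Carrier n) → v ⊕ - 1# ⊛ w ≡ 𝟘 → v ≡ w
    difference≡𝟘 []      []      _  = refl
    difference≡𝟘 (x ∷ v) (y ∷ w) eq = cong₂ _∷_
      (Equivalence.to difference≡0⇔ (trans (solve 2 (λ x y → x :- y := x :+ (:- con (ℤ.+ 1)) :* y)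
           refl x y) (Vec.∷-injectiveˡ eq)))
      (difference≡𝟘 v w (Vec.∷-injectiveʳ eq))

    0⊛ : ∀ {n} (v : Vec Carrier n) → 0# ⊛ v ≡ 𝟘
    0⊛ []      = refl
    0⊛ (x ∷ v) = cong₂ _∷_ (zeroˡ x) (0⊛ v)

    1⊛ : ∀ {n} (v : Vec Carrier n) → 1# ⊛ v ≡ v
    1⊛ []      = refl
    1⊛ (x ∷ v) = cong₂ _∷_ (*-identityˡ x) (1⊛ v)

    ⊛-𝟘 : ∀ {n} a → a ⊛ 𝟘 {n} ≡ 𝟘
    ⊛-𝟘 {zero}  a = refl
    ⊛-𝟘 {suc n} a = cong₂ _∷_ (zeroʳ a) (⊛-𝟘 a)

    ⊛-distribˡ : ∀ {n} a (v w : Vec Carrier n) → a ⊛ (v ⊕ w) ≡ a ⊛ v ⊕ a ⊛ w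
    ⊛-distribˡ a []      []      = refl
    ⊛-distribˡ a (x ∷ v) (y ∷ w) = cong₂ _∷_ (distribˡ a x y) (⊛-distribˡ a v w)

    ⊛-distribʳ : ∀ {n} a b (v : Vec Carrier n) → (a + b) ⊛ v ≡ a ⊛ v ⊕ b ⊛ v
    ⊛-distribʳ a b []      = refl
    ⊛-distribʳ a b (x ∷ v) = cong₂ _∷_ (solve 3 (λ a b x → (a :+ b) :* x := a :* x :+ b :* x)
         refl a b x) (⊛-distribʳ a b v)

    ⊛-assoc : ∀ {n} a b (v : Vec Carrier n) → a ⊛ (b ⊛ v) ≡ (a * b) ⊛ v
    ⊛-assoc a b []      = refl
    ⊛-assoc a b (x ∷ v) = cong₂ _∷_ (sym (*-assoc a b x)) (⊛-assoc a b v)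

    ⊕-interchange : ∀ {n} (v w x y : Vec Carrier n) → (v ⊕ w) ⊕ (x ⊕ y) ≡ (v ⊕ x) ⊕ (w ⊕ y)
    ⊕-interchange []      []      []      []      = refl
    ⊕-interchange (a ∷ v) (b ∷ w) (c ∷ x) (e ∷ y) =
      cong₂ _∷_ (solve 4 (λ a b c e → (a :+ b) :+ (c :+ e) := (a :+ c) :+ (b :+ e))
           refl a b c e) (⊕-interchange v w x y)

    module _ {d : ℕ} where

      linearCombination-⊕ : ∀ {n} (ζ ζ′ : Vec Carrier n) (u : Fin n → Vec Carrier d) →
        linearCombination F ζ u ⊕ linearCombination F ζ′ u ≡ linearCombination F (ζ ⊕ ζ′) u
      linearCombination-⊕ []      []        u = ⊕-identityˡ 𝟘
      linearCombination-⊕ (a ∷ ζ) (a′ ∷ ζ′) u = trans (⊕-interchange _ _ _ _)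
        (cong₂ _⊕_ (sym (⊛-distribʳ a a′ (u Fin.zero))) (linearCombination-⊕ ζ ζ′ (u ∘ Fin.suc)))

      linearCombination-⊛ : ∀ {n} a (ζ : Vec Carrier n) (u : Fin n → Vec Carrier d) →
        a ⊛ linearCombination F ζ u ≡ linearCombination F (a ⊛ ζ) u
      linearCombination-⊛ a []      u = ⊛-𝟘 a
      linearCombination-⊛ a (b ∷ ζ) u = trans (⊛-distribˡ a _ _)
        (cong₂ _⊕_ (⊛-assoc a b (u Fin.zero)) (linearCombination-⊛ a ζ (u ∘ Fin.suc)))

      module QuadraticForm {Q : Vec Carrier d → Carrier} (isQ : IsQuadraticForm F Q) where
        open IsQuadraticForm isQ

        polar-comm : ∀ v w → polar F Q v w ≡ polar F Q w v
        polar-comm v w = trans (cong (λ e → Q e - Q v - Q w) (⊕-comm v w))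
          (solve 3 (λ s a b → s :- a :- b := s :- b :- a) refl (Q (w ⊕ v)) (Q v) (Q w))

        Q-𝟘 : Q 𝟘 ≡ 0#
        Q-𝟘 = trans (cong Q (sym (0⊛ 𝟘))) (trans (homogeneous 0# 𝟘) (trans (cong (_* Q 𝟘) (zeroˡ _)) (zeroˡ (Q 𝟘))))

        polar-𝟘ˡ : ∀ w → polar F Q 𝟘 w ≡ 0#
        polar-𝟘ˡ w = trans (cong (λ e → polar F Q e w) (sym (0⊛ 𝟘))) (trans (polar-* 0# 𝟘 w) (zeroˡ _))

        Q-⊖ : ∀ v w → Q (v ⊖ w) ≡ Q v + Q w - polar F Q w v
        Q-⊖ v w = begin
          Q (v ⊖ w)                                  ≡⟨ cong Q (trans (⊖≡ v w) (⊕-comm v w′)) ⟩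
          Q (w′ ⊕ v)
            ≡⟨ solve 3 (λ s a b → s := s :- a :- b :+ (a :+ b)) refl (Q (w′ ⊕ v)) (Q w′) (Q v) ⟩
          polar F Q w′ v + (Q w′ + Q v)
            ≡⟨ cong₂ (λ x y → x + (y + Q v)) (polar-* (- 1#) w v) (homogeneous (- 1#) w) ⟩
          - 1# * polar F Q w v + ((- 1#) ^ 2 * Q w + Q v)
            ≡⟨ solve 3 (λ p a b → (:- con (ℤ.+ 1)) :* p :+ ((:- con (ℤ.+ 1)) :* ((:- con (ℤ.+ 1)) :* con (ℤ.+ 1)) :* a :+ b) := b :+ a :- p)
                 refl (polar F Q w v) (Q w) (Q v) ⟩
          Q v + Q w - polar F Q w v                  ∎
          where
          open ≡-Reasoning
          w′ = - 1# ⊛ w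

        polar-linearCombination : ∀ {n} (ζ : Vec Carrier n) (u : Fin n → Vec Carrier d) w →
          polar F Q (linearCombination F ζ u) w ≡ foldr _+_ 0# (tabulate λ j → lookup ζ j * polar F Q (u j) w)
        polar-linearCombination []      u w = polar-𝟘ˡ w
        polar-linearCombination (a ∷ ζ) u w = trans (polar-+ _ _ w)
          (cong₂ _+_ (polar-* a (u Fin.zero) w) (polar-linearCombination ζ (u ∘ Fin.suc) w))

    -- The offset `m` carries the induction. It is applied with m = 1, since the coordinates of z_t
    -- are t, t², and so on.
    foldr-powers : ∀ {n} t m (b : Fin n → Carrier) →
      foldr _+_ 0# (tabulate λ j → t ^ (m ℕ.+ toℕ j) * b j) ≡ t ^ m * eval (tabulate b) t
    foldr-powers {zero}  t m b = sym (zeroʳ _)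
    foldr-powers {suc n} t m b = trans
      (cong₂ (λ x y → t ^ x * b Fin.zero + foldr _+_ 0# y) (ℕ.+-identityʳ m)
        (List.tabulate-cong λ j → cong (λ e → t ^ e * b (Fin.suc j)) (ℕ.+-suc m (toℕ j))))
      (trans (cong (t ^ m * b Fin.zero +_) (foldr-powers t (suc m) (b ∘ Fin.suc)))
        (solve 4 (λ tm b t e → tm :* b :+ t :* tm :* e := tm :* (b :+ t :* e))
             refl (t ^ m) (b Fin.zero) t (eval (tabulate (b ∘ Fin.suc)) t)))

    eval-zeros : ∀ {n} (b : Fin n → Carrier) t → (∀ j → b j ≡ 0#) → eval (tabulate b) t ≡ 0#
    eval-zeros {zero}  b t b≡0 = refl
    eval-zeros {suc n} b t b≡0 = trans (cong₂ (λ x y → x + t * y) (b≡0 Fin.zero) (eval-zeros (b ∘ Fin.suc) t (b≡0 ∘ Fin.suc)))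
      (trans (+-identityˡ _) (zeroʳ t))

  module RationalNormalIsomorphism {q} (F : FiniteField q) (odd : ¬ 2 ∣ q) {k}
    {Q : Vec (FiniteField.Carrier F) (suc (suc k)) → FiniteField.Carrier F}
    (isQ : IsQuadraticForm F Q) (W : WittDecomposition F Q) (κ : FiniteField.Carrier F) where

    open VectorProperties F
    open QuadraticForm isQ
    open IsQuadraticForm isQ
    open IntegerCoefficients commutativeRing using (solve; _:=_; _:+_; _:*_; _:-_; :-_; con)
    open WittDecomposition W
    private
      module RN = RationalNormal F Q W
      d = suc (suc k)
      polarQ = polar F Q

    open RN using (centre; γ)

    S : Carrier → List (Vec Carrier d)
    S t = RN.sphere (centre t) (RN.radius κ t)

    point-⊕ : ∀ x y ζ x′ y′ ζ′ → point x y ζ ⊕ point x′ y′ ζ′ ≡ point (x + x′) (y + y′) (ζ ⊕ ζ′)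
    point-⊕ x y ζ x′ y′ ζ′ = trans (⊕-interchange _ _ _ _) (cong₂ _⊕_
      (trans (⊕-interchange _ _ _ _) (cong₂ _⊕_ (sym (⊛-distribʳ x x′ e)) (sym (⊛-distribʳ y y′ f))))
      (linearCombination-⊕ ζ ζ′ u))

    point-⊛ : ∀ a x y ζ → a ⊛ point x y ζ ≡ point (a * x) (a * y) (a ⊛ ζ)
    point-⊛ a x y ζ = trans (⊛-distribˡ a _ _) (cong₂ _⊕_
      (trans (⊛-distribˡ a _ _) (cong₂ _⊕_ (⊛-assoc a x e) (⊛-assoc a y f)))
      (linearCombination-⊛ a ζ u))

    point-00 : ∀ ζ → point 0# 0# ζ ≡ z[ ζ ]
    point-00 ζ = trans (cong (_⊕ z[ ζ ]) (trans (cong₂ _⊕_ (0⊛ e) (0⊛ f)) (⊕-identityˡ 𝟘))) (⊕-identityˡ _)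

    z-𝟘 : z[ 𝟘 ] ≡ 𝟘
    z-𝟘 = trans (cong z[_] (sym (0⊛ 𝟘))) (trans (sym (linearCombination-⊛ 0# 𝟘 u)) (0⊛ _))

    point-injective : ∀ {x y ζ x′ y′ ζ′} → point x y ζ ≡ point x′ y′ ζ′ → x ≡ x′ × y ≡ y′ × ζ ≡ ζ′
    point-injective {x} {y} {ζ} {x′} {y′} {ζ′} eq =
      let x≡ , y≡ , ζ≡ = independent _ _ _ vanishes in scalar x≡ , scalar y≡ , difference≡𝟘 ζ ζ′ ζ≡
      where
      open ≡-Reasoning
      vanishes : point (x + - 1# * x′) (y + - 1# * y′) (ζ ⊕ - 1# ⊛ ζ′) ≡ 𝟘
      vanishes = begin
        point (x + - 1# * x′) (y + - 1# * y′) (ζ ⊕ - 1# ⊛ ζ′)   ≡⟨ point-⊕ x y ζ _ _ _ ⟨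
        point x y ζ ⊕ point (- 1# * x′) (- 1# * y′) (- 1# ⊛ ζ′) ≡⟨ cong₂ _⊕_ eq (sym (point-⊛ (- 1#) x′ y′ ζ′)) ⟩
        point x′ y′ ζ′ ⊕ - 1# ⊛ point x′ y′ ζ′                  ≡⟨ ⊕-inverse _ ⟩
        𝟘                                                       ∎
      scalar : ∀ {a b} → a + - 1# * b ≡ 0# → a ≡ b
      scalar {a} {b} eq = Equivalence.to difference≡0⇔ (trans (solve 2 (λ a b → a :- b := a :+ (:- con (ℤ.+ 1)) :* b)
           refl a b) eq)

    -- f is isotropic, orthogonal to V₀ and pairs to 1 with e, so it reads off the coordinate x.
    polar-f : ∀ x y ζ → polarQ f (point x y ζ) ≡ x
    polar-f x y ζ = begin
      Q (f ⊕ point x y ζ) - Q f - Q (point x y ζ)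
        ≡⟨ cong₂ (λ a b → Q a - Q b - Q (point x y ζ)) (trans (cong (_⊕ point x y ζ) f≡) (point-⊕ 0# 1# 𝟘 x y ζ)) f≡ ⟩
      Q (point (0# + x) (1# + y) (𝟘 ⊕ ζ)) - Q (point 0# 1# 𝟘) - Q (point x y ζ)
        ≡⟨ cong₂ _-_ (cong₂ _-_ (hyperbolic (0# + x) (1# + y) (𝟘 ⊕ ζ)) (hyperbolic 0# 1# 𝟘)) (hyperbolic x y ζ) ⟩
      (0# + x) * (1# + y) + Q z[ 𝟘 ⊕ ζ ] - (0# * 1# + Q z[ 𝟘 ]) - (x * y + Q z[ ζ ])
        ≡⟨ cong₂ (λ a b → (0# + x) * (1# + y) + Q z[ a ] - (0# * 1# + b) - (x * y + Q z[ ζ ])) (⊕-identityˡ ζ) (trans (cong Q z-𝟘) Q-𝟘) ⟩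
      (0# + x) * (1# + y) + Q z[ ζ ] - (0# * 1# + 0#) - (x * y + Q z[ ζ ])
        ≡⟨ solve 3 (λ x y z → (con ℤ.0ℤ :+ x) :* (con (ℤ.+ 1) :+ y) :+ z :- (con ℤ.0ℤ :* con (ℤ.+ 1) :+ con ℤ.0ℤ) :- (x :* y :+ z) := x)
             refl x y (Q z[ ζ ]) ⟩
      x ∎
      where
      open ≡-Reasoning
      f≡ : f ≡ point 0# 1# 𝟘
      f≡ = sym (trans (cong₂ _⊕_ (trans (cong₂ _⊕_ (0⊛ e) (1⊛ f)) (⊕-identityˡ f)) z-𝟘) (⊕-identityʳ f))

    polar-z : ∀ ζ′ x y ζ → polarQ z[ ζ′ ] (point x y ζ) ≡ polarQ z[ ζ′ ] z[ ζ ]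
    polar-z ζ′ x y ζ = begin
      Q (z[ ζ′ ] ⊕ point x y ζ) - Q z[ ζ′ ] - Q (point x y ζ)
        ≡⟨ cong (λ a → Q a - Q z[ ζ′ ] - Q (point x y ζ)) (trans (cong (_⊕ point x y ζ) (sym (point-00 ζ′))) (point-⊕ 0# 0# ζ′ x y ζ)) ⟩
      Q (point (0# + x) (0# + y) (ζ′ ⊕ ζ)) - Q z[ ζ′ ] - Q (point x y ζ)
        ≡⟨ cong₂ (λ a b → a - Q z[ ζ′ ] - b) (hyperbolic (0# + x) (0# + y) (ζ′ ⊕ ζ)) (hyperbolic x y ζ) ⟩
      (0# + x) * (0# + y) + Q z[ ζ′ ⊕ ζ ] - Q z[ ζ′ ] - (x * y + Q z[ ζ ])
        ≡⟨ cong (λ a → (0# + x) * (0# + y) + Q a - Q z[ ζ′ ] - (x * y + Q z[ ζ ])) (sym (linearCombination-⊕ ζ′ ζ u)) ⟩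
      (0# + x) * (0# + y) + Q (z[ ζ′ ] ⊕ z[ ζ ]) - Q z[ ζ′ ] - (x * y + Q z[ ζ ])
        ≡⟨ solve 5 (λ x y s a b → (con ℤ.0ℤ :+ x) :* (con ℤ.0ℤ :+ y) :+ s :- a :- (x :* y :+ b) := s :- a :- b)
             refl x y (Q (z[ ζ′ ] ⊕ z[ ζ ])) (Q z[ ζ′ ]) (Q z[ ζ ]) ⟩
      polarQ z[ ζ′ ] z[ ζ ] ∎
      where open ≡-Reasoning

    -- These are the middle coefficients 2⟨z, u_j⟩ of `Ψ`, written with the polar form to avoid the
    -- factor 1/2.
    moments : Vec Carrier k → Fin k → Carrier
    moments ζ j = polarQ (u j) z[ ζ ]

    polar-centre : ∀ t x y ζ → polarQ (centre t) (point x y ζ) ≡ t ^ suc k * x + t * eval (tabulate (moments ζ)) t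
    polar-centre t x y ζ = begin
      polarQ (centre t) (point x y ζ)
        ≡⟨ polar-+ (t ^ suc k ⊛ f) z[ powers ] (point x y ζ) ⟩
      polarQ (t ^ suc k ⊛ f) (point x y ζ) + polarQ z[ powers ] (point x y ζ)
        ≡⟨ cong₂ _+_ (trans (polar-* (t ^ suc k) f (point x y ζ)) (cong (t ^ suc k *_) (polar-f x y ζ))) (polar-z powers x y ζ) ⟩
      t ^ suc k * x + polarQ z[ powers ] z[ ζ ]
        ≡⟨ cong (t ^ suc k * x +_) (trans (polar-linearCombination powers u z[ ζ ])
             (cong (foldr _+_ 0#) (List.tabulate-cong λ j → cong (_* moments ζ j) (Vec.lookup∘tabulate (λ i → t ^ suc (toℕ i)) j)))) ⟩
      t ^ suc k * x + foldr _+_ 0# (tabulate λ j → t ^ (1 ℕ.+ toℕ j) * moments ζ j)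
        ≡⟨ cong (t ^ suc k * x +_) (foldr-powers t 1 (moments ζ)) ⟩
      t ^ suc k * x + t ^ 1 * eval (tabulate (moments ζ)) t
        ≡⟨ cong (λ e → t ^ suc k * x + e * eval (tabulate (moments ζ)) t) (*-identityʳ t) ⟩
      t ^ suc k * x + t * eval (tabulate (moments ζ)) t ∎
      where
      open ≡-Reasoning
      powers = Vec.tabulate (λ j → t ^ suc (toℕ j))

    ∈-S⇔ : ∀ {p t} → p ∈ S t ⇔ Q (p ⊖ centre t) ≡ RN.radius κ t
    ∈-S⇔ {p} {t} = mk⇔
      (proj₂ ∘ ∈.∈-filter⁻ (λ p → Q (p ⊖ centre t) ≟ RN.radius κ t) {xs = RN.space})
      (∈.∈-filter⁺ (λ p → Q (p ⊖ centre t) ≟ RN.radius κ t) (allVecs-complete elements-complete p))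

    -- The polynomial Ψ(p) evaluated at t, partly in Horner form. With d = k + 2, the last product
    -- contains (x + γ) t^(d-1) + t^d.
    value : Carrier → Carrier → Vec Carrier k → Carrier → Carrier
    value x y ζ t = (κ - Q (point x y ζ)) + t * (eval (tabulate (moments ζ)) t + t ^ k * (x + γ + t))

    ∈-S⇔value : ∀ {x y ζ t} → point x y ζ ∈ S t ⇔ value x y ζ t ≡ 0#
    ∈-S⇔value {x} {y} {ζ} {t} = mk⇔
      (λ p∈ → trans (sym difference) (Equivalence.from difference≡0⇔ (sym (Equivalence.to ∈-S⇔ p∈))))
      (λ v≡0 → Equivalence.from ∈-S⇔ (sym (Equivalence.to difference≡0⇔ (trans difference v≡0))))
      where
      -- The summand Q(c_t) of the radius cancels the one from Q(p - c_t); what remains is a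
      -- polynomial of degree d in t.
      difference : RN.radius κ t - Q (point x y ζ ⊖ centre t) ≡ value x y ζ t
      difference = trans (cong (λ r → RN.radius κ t - r) (trans (Q-⊖ (point x y ζ) (centre t)) (cong (λ r → Q (point x y ζ) + Q (centre t) - r) (polar-centre t x y ζ))))
        (solve 8 (λ c t n g κ p x m → c :+ t :* (t :* n) :+ g :* (t :* n) :+ κ :- (p :+ c :- (t :* n :* x :+ t :* m))
                    := κ :- p :+ t :* (m :+ n :* (x :+ g :+ t)))
          refl (Q (centre t)) t (t ^ k) γ κ (Q (point x y ζ)) x (eval (tabulate (moments ζ)) t))

    module _ (p : Vec Carrier d) where
      open Coordinates (coordinates p) public using () renaming (x to x-of; y to y-of; ζ to ζ-of)

      point-of : point x-of y-of ζ-of ≡ p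
      point-of = proj₂ (spanning p)

    twice-inner : ∀ v w → (1# + 1#) * inner F Q v w ≡ polarQ w v
    twice-inner v w = trans (solve 3 (λ a p i → a :* (p :* i) := p :* (a :* i))
         refl (1# + 1#) (polarQ v w) ((1# + 1#) ⁻¹))
      (trans (cong (polarQ v w *_) (*-inverseʳ (1# + 1#) (2≢0 odd))) (trans (*-identityʳ _) (polar-comm v w)))

    Ψ≡ : ∀ p → RN.Ψ κ p ≡ (κ - Q p) ∷ tabulate (moments (ζ-of p)) ++ (x-of p + γ) ∷ 1# ∷ []
    Ψ≡ p = cong (λ l → (κ - Q p) ∷ l ++ (x-of p + γ) ∷ 1# ∷ []) (List.tabulate-cong λ j → twice-inner z[ ζ-of p ] (u j))

    eval-Ψ : ∀ p t → eval (RN.Ψ κ p) t ≡ value (x-of p) (y-of p) (ζ-of p) t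
    eval-Ψ p t = begin
      eval (RN.Ψ κ p) t
        ≡⟨ cong (λ l → eval l t) (Ψ≡ p) ⟩
      (κ - Q p) + t * eval (tabulate (moments (ζ-of p)) ++ (x-of p + γ) ∷ 1# ∷ []) t
        ≡⟨ cong (λ e → (κ - Q p) + t * e) (eval-++ (tabulate (moments (ζ-of p))) _ t) ⟩
      (κ - Q p) + t * (m + t ^ length (tabulate (moments (ζ-of p))) * (x-of p + γ + t * (1# + t * 0#)))
        ≡⟨ cong₂ (λ a b → (κ - Q a) + t * (m + t ^ b * (x-of p + γ + t * (1# + t * 0#)))) (sym (point-of p)) (List.length-tabulate (moments (ζ-of p))) ⟩
      (κ - Q (point (x-of p) (y-of p) (ζ-of p))) + t * (m + t ^ k * (x-of p + γ + t * (1# + t * 0#)))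
        ≡⟨ cong (λ e → (κ - Q (point (x-of p) (y-of p) (ζ-of p))) + t * (m + t ^ k * (x-of p + γ + e)))
             (solve 1 (λ t → t :* (con (ℤ.+ 1) :+ t :* con ℤ.0ℤ) := t) refl t) ⟩
      value (x-of p) (y-of p) (ζ-of p) t ∎
      where
      open ≡-Reasoning
      m = eval (tabulate (moments (ζ-of p))) t

    ∈-S⇔root : ∀ {p t} → p ∈ S t ⇔ eval (RN.Ψ κ p) t ≡ 0#
    ∈-S⇔root {p} {t} = mk⇔
      (λ p∈ → trans (eval-Ψ p t) (Equivalence.to (∈-S⇔value {x-of p} {y-of p} {ζ-of p}) (subst (_∈ S t) (sym (point-of p)) p∈)))
      (λ eq → subst (_∈ S t) (point-of p) (Equivalence.from (∈-S⇔value {x-of p} {y-of p} {ζ-of p}) (trans (sym (eval-Ψ p t)) eq)))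

    -- If the moments agree, the vector with coordinates ζ - ζ′ is orthogonal to every u_j, hence to
    -- V₀, and it vanishes because the form on V₀ is nondegenerate.
    moments-injective : ∀ {ζ ζ′} → (∀ j → moments ζ j ≡ moments ζ′ j) → ζ ≡ ζ′
    moments-injective {ζ} {ζ′} eq = difference≡𝟘 ζ ζ′ (proj₂ (proj₂ (independent 0# 0# η (trans (point-00 η)
        (nondegenerate⊥ η λ ζ″ → trans (cong (_* (1# + 1#) ⁻¹) (orthogonal ζ″)) (zeroˡ _))))))
      where
      η = ζ ⊕ - 1# ⊛ ζ′
      moments-η : ∀ j → polarQ (u j) z[ η ] ≡ 0#
      moments-η j = begin
        polarQ (u j) z[ η ]                                     ≡⟨ polar-comm (u j) z[ η ] ⟩
        polarQ z[ η ] (u j)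
          ≡⟨ cong (λ e → polarQ e (u j)) (sym (trans (cong (z[ ζ ] ⊕_) (linearCombination-⊛ (- 1#) ζ′ u)) (linearCombination-⊕ ζ _ u))) ⟩
        polarQ (z[ ζ ] ⊕ - 1# ⊛ z[ ζ′ ]) (u j)
          ≡⟨ trans (polar-+ _ _ _) (cong (polarQ z[ ζ ] (u j) +_) (polar-* (- 1#) z[ ζ′ ] (u j))) ⟩
        polarQ z[ ζ ] (u j) + - 1# * polarQ z[ ζ′ ] (u j)
          ≡⟨ cong₂ (λ a b → a + - 1# * b) (polar-comm z[ ζ ] (u j)) (polar-comm z[ ζ′ ] (u j)) ⟩
        moments ζ j + - 1# * moments ζ′ j                       ≡⟨ cong (λ e → e + - 1# * moments ζ′ j) (eq j) ⟩
        moments ζ′ j + - 1# * moments ζ′ j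
          ≡⟨ solve 1 (λ a → a :+ (:- con (ℤ.+ 1)) :* a := con ℤ.0ℤ) refl (moments ζ′ j) ⟩
        0#                                                      ∎
        where open ≡-Reasoning
      zeros : ∀ {n} (ζ″ : Vec Carrier n) (b : Fin n → Carrier) → (∀ j → b j ≡ 0#) → foldr _+_ 0# (tabulate λ j → lookup ζ″ j * b j) ≡ 0#
      zeros []       b b≡0 = refl
      zeros (a ∷ ζ″) b b≡0 = trans (cong₂ _+_ (trans (cong (a *_) (b≡0 Fin.zero)) (zeroʳ a)) (zeros ζ″ (b ∘ Fin.suc) (b≡0 ∘ Fin.suc))) (+-identityˡ 0#)
      orthogonal : ∀ ζ″ → polarQ z[ η ] z[ ζ″ ] ≡ 0#
      orthogonal ζ″ = trans (polar-comm z[ η ] z[ ζ″ ]) (trans (polar-linearCombination ζ″ u z[ η ]) (zeros ζ″ (λ j → polarQ (u j) z[ η ]) moments-η))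

    -- An injective self-map of the finite set F^k is onto; no Gram matrix has to be inverted.
    moments-surjective : ∀ h → ∃ λ ζ → ∀ j → moments ζ j ≡ h j
    moments-surjective h =
      let ζ , eq = injective⇒surjective-on (Vec.≡-dec _≟_) (allVecs-unique elements-unique k) (allVecs-complete elements-complete)
            moments-vector injective (Vec.tabulate h)
      in ζ , λ j → trans (sym (Vec.lookup∘tabulate (moments ζ) j)) (trans (cong (λ v → lookup v j) eq) (Vec.lookup∘tabulate h j))
      where
      moments-vector : Vec Carrier k → Vec Carrier k
      moments-vector ζ = Vec.tabulate (moments ζ)
      injective : ∀ {ζ ζ′} → moments-vector ζ ≡ moments-vector ζ′ → ζ ≡ ζ′
      injective {ζ} {ζ′} eq = moments-injective λ j → trans (sym (Vec.lookup∘tabulate (moments ζ) j))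
        (trans (cong (λ v → lookup v j) eq) (Vec.lookup∘tabulate (moments ζ′) j))

    -- The middle coefficients determine ζ and the one of degree d - 1 determines x. The constant
    -- term then gives x y + Q(z), and dividing by x ≠ 0 recovers y.
    Ψ-injective : ∀ {p p′} → x-of p ≢ 0# → RN.Ψ κ p ≡ RN.Ψ κ p′ → p ≡ p′
    Ψ-injective {p} {p′} x≢0 eq =
      trans (sym (point-of p)) (trans (cong₂ (λ a (b , c) → point a b c) x≡ (cong₂ _,_ y≡ ζ≡)) (point-of p′))
      where
      eq′ : (κ - Q p) ∷ tabulate (moments (ζ-of p)) ++ (x-of p + γ) ∷ 1# ∷ []
          ≡ (κ - Q p′) ∷ tabulate (moments (ζ-of p′)) ++ (x-of p′ + γ) ∷ 1# ∷ []
      eq′ = trans (sym (Ψ≡ p)) (trans eq (Ψ≡ p′))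
      coefficients≡ : (∀ j → moments (ζ-of p) j ≡ moments (ζ-of p′) j) × x-of p + γ ≡ x-of p′ + γ
      coefficients≡ = tabulate-∷ʳ-injective {f = moments (ζ-of p)} {g = moments (ζ-of p′)} (List.∷-injectiveʳ eq′)
      ζ≡ : ζ-of p ≡ ζ-of p′
      ζ≡ = moments-injective {ζ-of p} {ζ-of p′} (proj₁ coefficients≡)
      x≡ : x-of p ≡ x-of p′
      x≡ = +-cancelʳ γ _ _ (proj₂ coefficients≡)
      Q≡ : x-of p * y-of p + Q z[ ζ-of p ] ≡ x-of p′ * y-of p′ + Q z[ ζ-of p′ ]
      Q≡ = trans (sym (hyperbolic (x-of p) (y-of p) (ζ-of p))) (trans (cong Q (point-of p)) (trans Qp≡Qp′
        (trans (cong Q (sym (point-of p′))) (hyperbolic (x-of p′) (y-of p′) (ζ-of p′)))))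
        where
        Qp≡Qp′ : Q p ≡ Q p′
        Qp≡Qp′ = trans (solve 2 (λ κ a → a := κ :- (κ :- a)) refl κ (Q p)) (trans (cong (λ r → κ - r) (List.∷-injectiveˡ eq′)) (solve 2 (λ κ a → κ :- (κ :- a) := a) refl κ (Q p′)))
      y≡ : y-of p ≡ y-of p′
      y≡ = *-cancelˡ x≢0 (trans (+-cancelʳ (Q z[ ζ-of p ]) _ _ (trans Q≡ (cong (λ ζ → x-of p′ * y-of p′ + Q z[ ζ ]) (sym ζ≡)))) (cong (_* y-of p′) (sym x≡)))

-- The sphere system as a root-evaluation system.

module RationalNormalSystems where

  open FiniteSums
  open FieldSubsets
  open PartitionBound
  open IncidenceIsomorphisms
  open FieldPolynomials
  open RationalNormalCurves
  open IntegerRingSolver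
  open import Data.Bool.Base using (true)
  open import Data.Fin.Subset using (Subset; ∣_∣) renaming (_∈_ to _∈ₛ_)
  import Data.Fin.Subset.Properties as Subset
  open import Data.Integer.Base as ℤ using (ℤ)
  open import Data.List.Base as List using (List; []; _∷_; _++_; map; tabulate; length; foldr)
  import Data.List.Properties as List
  open import Data.List.Membership.Propositional using (_∈_; find; lose)
  import Data.List.Membership.DecPropositional as DecMembership
  import Data.List.Membership.Propositional.Properties as ∈
  open import Data.List.Relation.Unary.Any using (Any; any?; satisfied)
  open import Data.Nat.Base as ℕ using (ℕ; suc)
  import Data.Nat.Properties as ℕ
  open import Data.Nat.Divisibility using (_∣_)
  open import Data.Product.Base using (∃; _×_; _,_; proj₁; proj₂)
  open import Data.Sum.Base using (_⊎_; inj₁; inj₂)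
  open import Data.Vec.Base as Vec using (Vec; []; _∷_)
  import Data.Vec.Properties as Vec
  open import Function.Base using (_∘_)
  open import Function.Bundles using (_⇔_; mk⇔; module Equivalence)
  open import Relation.Binary.PropositionalEquality hiding (J; [_])
  open import Relation.Nullary.Decidable using (Dec; yes; no; does; dec-true)
  open import Relation.Nullary.Negation using (¬_; contradiction)

  does-true : ∀ {P : Set} (P? : Dec P) → does P? ≡ true → P
  does-true (yes p) _ = p

  module ParameterIsomorphism {q} (F : FiniteField q) (odd : ¬ 2 ∣ q) {k}
    {Q : Vec (FiniteField.Carrier F) (suc (suc k)) → FiniteField.Carrier F}
    (isQ : IsQuadraticForm F Q) (W : WittDecomposition F Q) (κ : FiniteField.Carrier F) where

    open RationalNormalIsomorphism F odd isQ W κ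
    open VectorProperties F
    open QuadraticForm isQ
    open IntegerCoefficients commutativeRing using (solve; _:=_; _:+_; _:*_; _:-_; :-_; con)
    open WittDecomposition W
    private
      module RN = RationalNormal F Q W
      d = suc (suc k)
    open RN using (γ)

    -- The points (x, y, 0) with x = ±1 on S t already determine t.
    S-injective : ∀ {t t′} → S t ≡ S t′ → t ≡ t′
    S-injective {t} {t′} St≡St′ = cases (zero-divisor (begin
        w * (t - t′)
          ≡⟨ solve 4 (λ w g t t′ → w :* (t :- t′) := w :* (con (ℤ.+ 1) :+ g :+ t) :- w :* (con (ℤ.+ 1) :+ g :+ t′))
               refl w γ t t′ ⟩
        w * (1# + γ + t) - w * (1# + γ + t′)
          ≡⟨ Equivalence.from difference≡0⇔ (trans h₊ (cong (_* (1# + γ + t′)) (sym w≡w′))) ⟩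
        0#                                             ∎))
      where
      open ≡-Reasoning
      w = t ^ suc k
      w′ = t′ ^ suc k
      value-𝟘 : ∀ x y s → value x y 𝟘 s ≡ κ - x * y + s ^ suc k * (x + γ + s)
      value-𝟘 x y s = trans
        (cong₂ (λ a b → (κ - a) + s * (b + s ^ k * (x + γ + s)))
          (trans (hyperbolic x y 𝟘) (trans (cong (x * y +_) (trans (cong Q z-𝟘) Q-𝟘)) (+-identityʳ _)))
          (eval-zeros (moments 𝟘) s λ j → trans (polar-comm (u j) z[ 𝟘 ]) (trans (cong (λ v → polar F Q v (u j)) z-𝟘) (polar-𝟘ˡ (u j)))))
        (solve 5 (λ a s n x g → a :+ s :* (con ℤ.0ℤ :+ n :* (x :+ g :+ s)) := a :+ s :* n :* (x :+ g :+ s))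
             refl (κ - x * y) s (s ^ k) x γ)
      equal : ∀ x → x * x ≡ 1# → w * (x + γ + t) ≡ w′ * (x + γ + t′)
      equal x x²≡1 = begin
        h                          ≡⟨ solve 2 (λ κ h → h := (κ :+ h) :- κ) refl κ h ⟩
        (κ + h) - κ                ≡⟨ cong (_- κ) (sym xy≡) ⟩
        x * y - κ                  ≡⟨ solve 3 (λ κ p h′ → p :- κ := h′ :- (κ :- p :+ h′)) refl κ (x * y) h′ ⟩
        h′ - (κ - x * y + h′)      ≡⟨ cong (λ e → h′ - e) on-S′ ⟩
        h′ - 0#                    ≡⟨ solve 1 (λ h′ → h′ :- con ℤ.0ℤ := h′) refl h′ ⟩
        h′                         ∎
        where
        h  = w * (x + γ + t)
        h′ = w′ * (x + γ + t′)
        -- Chosen so that x² = 1 gives x y = κ + h, which puts (x, y, 0) on `S t`.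
        y  = x * (κ + h)
        xy≡ : x * y ≡ κ + h
        xy≡ = trans (sym (*-assoc x x (κ + h))) (trans (cong (_* (κ + h)) x²≡1) (*-identityˡ _))
        on-S : value x y 𝟘 t ≡ 0#
        on-S = trans (value-𝟘 x y t) (trans (cong (λ e → κ - e + h) xy≡) (solve 2 (λ κ h → κ :- (κ :+ h) :+ h := con ℤ.0ℤ)
             refl κ h))
        on-S′ : κ - x * y + h′ ≡ 0#
        on-S′ = trans (sym (value-𝟘 x y t′)) (Equivalence.to (∈-S⇔value {x} {y} {𝟘})
          (subst (point x y 𝟘 ∈_) St≡St′ (Equivalence.from (∈-S⇔value {x} {y} {𝟘}) on-S)))
      h₊ = equal 1# (*-identityˡ 1#)
      h₋ = equal (- 1#) (solve 0 ((:- con (ℤ.+ 1)) :* (:- con (ℤ.+ 1)) := con (ℤ.+ 1)) refl)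
      w≡w′ : w ≡ w′
      -- Subtracting the relation for x = -1 from that for x = 1 leaves 2 w = 2 w′.
      w≡w′ = *-cancelˡ (2≢0 odd) (trans (double w t) (trans (cong₂ _-_ h₊ h₋) (sym (double w′ t′))))
        where
        double : ∀ w t → (1# + 1#) * w ≡ w * (1# + γ + t) - w * (- 1# + γ + t)
        double w t = solve 3 (λ w g t → (con (ℤ.+ 1) :+ con (ℤ.+ 1)) :* w := w :* (con (ℤ.+ 1) :+ g :+ t) :- w :* (:- con (ℤ.+ 1) :+ g :+ t))
             refl w γ t
      -- The power w = t^(d-1) may vanish, but then w′ vanishes too and both parameters are 0.
      cases : w ≡ 0# ⊎ t - t′ ≡ 0# → t ≡ t′
      cases (inj₁ w≡0)    = trans (^≡0 t (suc k) w≡0) (sym (^≡0 t′ (suc k) (trans (sym w≡w′) w≡0)))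
      cases (inj₂ t-t′≡0) = Equivalence.to difference≡0⇔ t-t′≡0

    private
      _∈?_ : ∀ (p : Vec Carrier d) s → Dec (p ∈ s)
      _∈?_ = DecMembership._∈?_ (Vec.≡-dec _≟_)

      _≟ˢ_ : ∀ (s s′ : List (Vec Carrier d)) → Dec (s ≡ s′)
      _≟ˢ_ = List.≡-dec (Vec.≡-dec _≟_)

    parameters : Vec Carrier d → Subset q
    parameters p = Vec.tabulate λ i → does (p ∈? S (element i))

    parameters-∋ : ∀ {p t} → parameters p ∋ t ⇔ p ∈ S t
    parameters-∋ {p} {t} = mk⇔
      (λ ∋t → subst (λ s → p ∈ S s) (element-index t) (does-true (p ∈? S (element (index t))) (trans (sym lookup≡) (Vec.[]=⇒lookup ∋t))))
      (λ p∈ → Vec.lookup⇒[]= (index t) (parameters p) (trans lookup≡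
        (dec-true (p ∈? S (element (index t))) (subst (λ s → p ∈ S s) (sym (element-index t)) p∈))))
      where
      lookup≡ = Vec.lookup∘tabulate (λ i → does (p ∈? S (element i))) (index t)

    -- Both sets consist of the zeros of the same polynomial.
    parameters-root : ∀ {p A} → RN.Ψ κ p ≡ rootPolynomial F A → parameters p ≡ A
    parameters-root {p} {A} eq = Subset.⊆-antisym
      (λ {i} i∈ → subst (_∈ₛ A) (index-element i) (to (subst (_∈ₛ parameters p) (sym (index-element i)) i∈)))
      (λ {i} i∈ → subst (_∈ₛ parameters p) (index-element i) (from (subst (_∈ₛ A) (sym (index-element i)) i∈)))
      where
      to : ∀ {t} → parameters p ∋ t → A ∋ t
      to {t} ∋t = Equivalence.to (root⇔∋ {A}) (trans (cong (λ l → eval l t) (sym eq)) (Equivalence.to ∈-S⇔root (Equivalence.to parameters-∋ ∋t)))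
      from : ∀ {t} → A ∋ t → parameters p ∋ t
      from {t} ∋t = Equivalence.from parameters-∋ (Equivalence.from ∈-S⇔root (trans (cong (λ l → eval l t) eq) (Equivalence.from (root⇔∋ {A}) ∋t)))

    private
      -- The decision is an argument so that `parameterFrom-S` can match on it; `0#` is a default
      -- for lists that are not spheres of the family.
      parameterFrom : ∀ {s} → Dec (Any (λ t → s ≡ S t) elements) → Carrier
      parameterFrom (yes found) = proj₁ (satisfied found)
      parameterFrom (no _)      = 0#

      parameterFrom-S : ∀ {t} (found? : Dec (Any (λ t′ → S t ≡ S t′) elements)) → parameterFrom found? ≡ t
      parameterFrom-S     (yes found) = sym (S-injective (proj₂ (satisfied found)))
      parameterFrom-S {t} (no ¬found) = contradiction (lose (elements-complete t) refl) ¬found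

    parameter : List (Vec Carrier d) → Carrier
    parameter s = parameterFrom (any? (λ t → s ≟ˢ S t) elements)

    parameter-S : ∀ t → parameter (S t) ≡ t
    parameter-S t = parameterFrom-S (any? (λ t′ → S t ≟ˢ S t′) elements)

    ∈-𝒮ᵣₙ : ∀ {s} → s ∈ RN.𝒮ᵣₙ κ → ∃ λ t → s ≡ S t
    ∈-𝒮ᵣₙ s∈ = let t , _ , s≡ = ∈.∈-map⁻ S (∈.∈-deduplicate⁻ _≟ˢ_ (map S elements) s∈) in t , s≡

    ∈-Pᵣₙ : ∀ {p} → p ∈ RN.Pᵣₙ κ → x-of p ≢ 0# × ∃ λ A → A ∈ 𝔄 F d γ × RN.Ψ κ p ≡ rootPolynomial F A
    ∈-Pᵣₙ p∈ = let _ , x≢0 , root = ∈.∈-filter⁻ (RN.isRootPoint? κ) {xs = RN.space} p∈ in x≢0 , find root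

    -- The point p_A is obtained by solving Ψ(p) = ∏ (T - a) coefficientwise: ζ from the middle
    -- coefficients, x from the one of degree d - 1 and y from the constant term. Dividing by x is
    -- possible because the condition defining `𝔄` says x ≠ 0.
    root-point : ∀ {A} → A ∈ 𝔄 F d γ → ∃ λ p → p ∈ RN.Pᵣₙ κ × RN.Ψ κ p ≡ rootPolynomial F A
    root-point {A} A∈ = from-shape (members F A) refl (trans (length-members A) (proj₁ (∈-𝔄⁻ d γ A∈)))
      where
      s = - elementSum F A
      solution : ∀ low → length low ≡ suc k → rootPolynomial F A ≡ low ++ s ∷ 1# ∷ [] → ∃ λ p → p ∈ RN.Pᵣₙ κ × RN.Ψ κ p ≡ rootPolynomial F A
      solution (l₀ ∷ ls) len root≡ = p , p∈ , Ψp≡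
        where
        h = proj₁ (list⇒tabulate ls (ℕ.suc-injective len))
        ls≡ = proj₂ (list⇒tabulate ls (ℕ.suc-injective len))
        ζ = proj₁ (moments-surjective h)
        x = s - γ
        x≢0 : x ≢ 0#
        x≢0 = proj₂ (∈-𝔄⁻ d γ A∈) ∘ Equivalence.to difference≡0⇔
        r = κ - l₀ - Q z[ ζ ]
        y = x ⁻¹ * r
        p = point x y ζ
        -- `Ψ` uses the coordinates returned by `spanning`; independence identifies them with the
        -- chosen x, y and ζ.
        coordinates≡ = point-injective {x-of p} {y-of p} {ζ-of p} {x} {y} {ζ} (point-of p)
        Qp≡ : κ - Q p ≡ l₀
        Qp≡ = trans (cong (λ e → κ - e) (trans (hyperbolic x y ζ) (cong (_+ Q z[ ζ ]) xy≡r)))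
          (solve 3 (λ κ l z → κ :- (κ :- l :- z :+ z) := l) refl κ l₀ (Q z[ ζ ]))
          where
          xy≡r : x * y ≡ r
          xy≡r = trans (sym (*-assoc x (x ⁻¹) r)) (trans (cong (_* r) (*-inverseʳ x x≢0)) (*-identityˡ r))
        Ψp≡ : RN.Ψ κ p ≡ rootPolynomial F A
        Ψp≡ = trans (Ψ≡ p) (trans (cong₂ (λ a l → a ∷ l) Qp≡ (cong₂ (λ l a → l ++ a ∷ 1# ∷ [])
            (trans (List.tabulate-cong λ j → trans (cong (λ ζ → moments ζ j) (proj₂ (proj₂ coordinates≡))) (proj₂ (moments-surjective h) j)) (sym ls≡))
            (trans (cong (_+ γ) (proj₁ coordinates≡)) (solve 2 (λ s g → s :- g :+ g := s) refl s γ))))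
          (sym root≡))
        p∈ : p ∈ RN.Pᵣₙ κ
        p∈ = ∈.∈-filter⁺ (RN.isRootPoint? κ) (allVecs-complete elements-complete p)
          ((λ x≡0 → x≢0 (trans (sym (proj₁ coordinates≡)) x≡0)) , lose A∈ Ψp≡)
      -- The list of members is abstracted so that it can be matched; its length d ≥ 2 excludes the
      -- empty list, for which `rootProduct-shape` says nothing.
      from-shape : ∀ as → members F A ≡ as → length as ≡ d → ∃ λ p → p ∈ RN.Pᵣₙ κ × RN.Ψ κ p ≡ rootPolynomial F A
      from-shape (a ∷ as) eq len =
        let low , low-length , shape = rootProduct-shape a as
        in solution low (trans low-length (ℕ.suc-injective len))
             (trans (cong (foldr (timesLinear F) (1# ∷ [])) eq) (trans shape (cong (λ as → low ++ - foldr _+_ 0# as ∷ 1# ∷ []) (sym eq))))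

    isomorphism : IncidenceIsomorphism (RN.system κ) (rootEvaluation F d γ)
    isomorphism = record
      { q≡       = refl
      ; toPoint  = parameters
      ; toObject = parameter
      ; points↭  = unique-⊆⇒↭ (Unique-map-injective points-injective (IncidenceSystem.points-unique (RN.system κ))) (𝔄-unique F d γ) to from
      ; objects↭ = unique-⊆⇒↭ (Unique-map-injective objects-injective (IncidenceSystem.objects-unique (RN.system κ))) elements-unique
          (λ _ → elements-complete _) (λ {t} _ → subst (_∈ map parameter (RN.𝒮ᵣₙ κ)) (parameter-S t)
            (∈.∈-map⁺ parameter (∈.∈-deduplicate⁺ _≟ˢ_ (∈.∈-map⁺ S (elements-complete t)))))
      ; incident = λ {p} {s} _ s∈ → incident p s (∈-𝒮ᵣₙ s∈)
      }
      where
      points-injective : ∀ {p p′} → p ∈ RN.Pᵣₙ κ → p′ ∈ RN.Pᵣₙ κ → parameters p ≡ parameters p′ → p ≡ p′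
      points-injective {p} {p′} p∈ p′∈ eq =
        let x≢0 , A , _ , Ψp≡  = ∈-Pᵣₙ p∈
            _ , A′ , _ , Ψp′≡ = ∈-Pᵣₙ p′∈
        in Ψ-injective x≢0 (trans Ψp≡ (trans (cong (rootPolynomial F)
             (trans (sym (parameters-root Ψp≡)) (trans eq (parameters-root Ψp′≡)))) (sym Ψp′≡)))
      to : ∀ {A} → A ∈ map parameters (RN.Pᵣₙ κ) → A ∈ 𝔄 F d γ
      to A∈ = let p , p∈ , A≡ = ∈.∈-map⁻ parameters A∈
                  _ , A′ , A′∈ , Ψp≡ = ∈-Pᵣₙ p∈
              in subst (_∈ 𝔄 F d γ) (sym (trans A≡ (parameters-root Ψp≡))) A′∈
      from : ∀ {A} → A ∈ 𝔄 F d γ → A ∈ map parameters (RN.Pᵣₙ κ)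
      from A∈ = let p , p∈ , Ψp≡ = root-point A∈
                in subst (_∈ map parameters (RN.Pᵣₙ κ)) (parameters-root Ψp≡) (∈.∈-map⁺ parameters p∈)
      objects-injective : ∀ {s s′} → s ∈ RN.𝒮ᵣₙ κ → s′ ∈ RN.𝒮ᵣₙ κ → parameter s ≡ parameter s′ → s ≡ s′
      objects-injective s∈ s′∈ eq =
        let t , s≡ = ∈-𝒮ᵣₙ s∈
            t′ , s′≡ = ∈-𝒮ᵣₙ s′∈
        in trans s≡ (trans (cong S (trans (sym (parameter-S t)) (trans (cong parameter (sym s≡)) (trans eq (trans (cong parameter s′≡) (parameter-S t′)))))) (sym s′≡))
      incident : ∀ p s → (∃ λ t → s ≡ S t) → p ∈ s ⇔ parameters p ∋ parameter s
      incident p _ (t , refl) = subst (λ t′ → p ∈ S t ⇔ parameters p ∋ t′) (sym (parameter-S t))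
        (mk⇔ (Equivalence.from parameters-∋) (Equivalence.to parameters-∋))

open PartitionBound using (no-decomposition; partition-bound)
open IncidenceIsomorphisms using (module IncidenceIsomorphism)
open RationalNormalSystems.ParameterIsomorphism using (isomorphism)

theorem4p12 : ∀ (d : ℕ) → 3 ℕ.≤ d →
    ∀ (τ : ℝ) → 0ᴿ <ᴿ τ → τ ≤ᴿ 1ᴿ →
    ∀ (q : ℕ) → OddPrimePower q → fromℕ (C d) ≤ᴿ fromℕ q *ᴿ τ →
    ∀ (F : FiniteField q) → let open FiniteField F using (Carrier) in let open FiniteField F using (-_) in
    (∀ (γ : Carrier) (ε : ℝ) → 0ᴿ ≤ᴿ ε → ε ≤ᴿ fromℚ (c d) *ᴿ (τ *ᴿ τ) →
    ¬ CenteredBlockDecomposition (rootEvaluation F d γ) τ ε)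
    ×
    (∀ (Q : Vec Carrier d → Carrier) → IsQuadraticForm F Q → Nondegenerate F Q →
    ∀ (W : WittDecomposition F Q) → let module RN = RationalNormal F Q W in
    ∀ (κ : Carrier) → (∀ t → RN.g t ≢ - κ) →
    ∀ (ε : ℝ) → 0ᴿ ≤ᴿ ε → ε ≤ᴿ fromℚ (c d) *ᴿ (τ *ᴿ τ) →
    ¬ CenteredBlockDecomposition (RN.system κ) τ ε)
    ×
    (∀ (γ : Carrier) → let 𝒟 = rootEvaluation F d γ in
    let open IncidenceSystem 𝒟 using (σ) in let open IncidenceSystem 𝒟 using (objects) in
    ∀ (m : ℕ) → 2 ℕ.≤ m →
    ∀ (𝒫 : MatchedPartition 𝒟 m) → let open MatchedPartition 𝒫 in
    (∀ i → τ *ᴿ fromℚ (Σσ 𝒟) ≤ᴿ fromℚ (σ (A i) (𝒮 i))) →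
    fromℚ (σ R objects) ≤ᴿ fromℚ (c d) *ᴿ (τ *ᴿ τ) *ᴿ fromℚ (Σσ 𝒟) →
    fromℕ 2 *ᴿ fromℚ (c d) *ᴿ (τ *ᴿ τ) *ᴿ fromℚ (Σσ 𝒟) ≤ᴿ fromℚ offDiagonal)
theorem4p12 (ℕ.suc ℕ.zero) (ℕ.s≤s ())
-- Matching exposes d as k + 2, so that `d ∸ 2` and `d ∸ 1` compute as `isomorphism` requires.
theorem4p12 d@(ℕ.suc (ℕ.suc _)) 3≤d τ 0<τ _ q (_ , odd) large F =
  (λ γ ε _ ε≤ → no-decomposition F 3≤d odd γ {τ} {ε} 0<τ large ε≤) ,
  (λ Q isQ _ W κ _ ε _ ε≤ decomposition →
    no-decomposition F 3≤d odd (RationalNormal.γ F Q W) {τ} {ε} 0<τ large ε≤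
      (IncidenceIsomorphism.transport (isomorphism F odd isQ W κ) {τ} {ε} decomposition)) ,
  λ γ m 2≤m 𝒫 → partition-bound F 3≤d odd γ 2≤m 𝒫 τ 0<τ large
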